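{- Let $k$ and $\ell$ be positive integers and write $m:=2^{\mathrm{ord}_2(\gcd(k,\ell))}$. Suppose that $q:=2^k$ and $Q:=2^\ell$ satisfy $\gcd(Q-1,q+1)=1$. Write $A(X):=1+bX+aX^v+dX^u$ where $a,b,d\in\mathbb{F}_{q^2}$ and $u,v$ are positive integers such that $u(Q-1)\equiv q\pmod{q+1}$ and $v(Q-1)\equiv Q\pmod{q+1}$. Then $f(X):=XA(X^{q-1})$ permutes $\mathbb{F}_{q^2}$ if and only if all of the following hold: (1) $e:=1+a^{q+1}+b^{q+1}+d^{q+1}$ is nonzero; (2) $(ab^q+d^q)^Q=e^{Q-1}(a+bd^q)$; (3) $\mathrm{Tr}_{\mathbb{F}_q/\mathbb{F}_{2^m}}\Bigl(\frac{a^{q+1}+d^{q+1}}{e}\Bigr)=0$.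
   Context: For a positive integer $n$, $\mathrm{ord}_2(n)$ is the largest integer $i\ge0$ with $2^i\mid n$. A polynomial permutes $\mathbb{F}_{q^2}$ if it induces a bijection of $\mathbb{F}_{q^2}$. $\mathrm{Tr}_{\mathbb{F}_q/\mathbb{F}_{2^m}}$ is the trace map (note $m\mid k$). -}

module Defs where

open import Algebra.Bundles using (CommutativeRing)
open import Data.Fin.Base using (Fin; toℕ)
open import Data.List.Base using (List; []; _∷_; foldr; map)
open import Data.Nat.Base as ℕ using (ℕ; zero; suc; NonZero; ∣_-_∣)
open import Data.Nat.DivMod using () renaming (_/_ to _div_)
open import Data.Nat.Divisibility using (_∣_; _∣?_; ∣⇒≤; 1∣_)
open import Data.Nat.Properties using (≤-refl; ≤-trans; <⇒≤; ≤∧≢⇒<; m≤n⇒m≤1+n; m^n>0; +-mono-≤; +-identityʳ; ≤-reflexive)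
open import Data.Product.Base using (_×_; _,_; proj₁; map₂)
open import Function.Bundles using (Inverse)
open import Level using (_⊔_) renaming (suc to lsuc)
open import Relation.Binary.PropositionalEquality as ≡ using (_≡_)
open import Relation.Nullary using (¬_; yes; no; contradiction)
import Algebra.Definitions
import Algebra.Properties.CommutativeMonoid.Sum as Summation
import Algebra.Properties.Semiring.Exp as Exponentiation
open import Function.Definitions using (Bijective)

------------------------------------------------------------------------
-- Natural numbers

infix 4 _≡_[mod_]

_≡_[mod_] : ℕ → ℕ → ℕ → Set
a ≡ b [mod n ] = n ∣ ∣ a - b ∣

greatestPower≤ : ℕ → ℕ → ℕ
greatestPower≤ zero    n = zero
greatestPower≤ (suc i) n with 2 ℕ.^ suc i ∣? n
... | yes _ = suc i
... | no  _ = greatestPower≤ i n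

-- Searching the exponents i ≤ n suffices: if 2 ^ i ∣ n and n is positive
-- then i < 2 ^ i ≤ n.  The value at n = 0 is junk.
ord₂ : ℕ → ℕ
ord₂ n = greatestPower≤ n n

private
  greatestPower≤-∣ : ∀ b n → 2 ℕ.^ greatestPower≤ b n ∣ n
  greatestPower≤-∣ zero    n = 1∣ n
  greatestPower≤-∣ (suc i) n with 2 ℕ.^ suc i ∣? n
  ... | yes p = p
  ... | no  _ = greatestPower≤-∣ i n

  greatestPower≤-max : ∀ b n {i} → i ℕ.≤ b → 2 ℕ.^ i ∣ n → i ℕ.≤ greatestPower≤ b n
  greatestPower≤-max zero    n i≤b _ = i≤b
  greatestPower≤-max (suc b) n {i} i≤b d with 2 ℕ.^ suc b ∣? n
  ... | yes _ = i≤b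
  ... | no ¬p = greatestPower≤-max b n
                  (ℕ.s≤s⁻¹ (≤∧≢⇒< i≤b λ { ≡.refl → ¬p d })) d

  n<2^n : ∀ n → n ℕ.< 2 ℕ.^ n
  n<2^n zero    = ≤-refl
  n<2^n (suc n) = +-mono-≤ (m^n>0 2 n)
    (≤-trans (n<2^n n) (≤-reflexive (≡.sym (+-identityʳ (2 ℕ.^ n)))))

ord₂-largest : ∀ n .{{_ : NonZero n}} →
               2 ℕ.^ ord₂ n ∣ n × (∀ i → 2 ℕ.^ i ∣ n → i ℕ.≤ ord₂ n)
ord₂-largest n = greatestPower≤-∣ n n , λ i d →
  greatestPower≤-max n n (<⇒≤ (≤-trans (n<2^n i) (∣⇒≤ d))) d

------------------------------------------------------------------------
-- Fields

record Field c ℓ : Set (lsuc (c ⊔ ℓ)) where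
  field
    commutativeRing : CommutativeRing c ℓ

  open CommutativeRing commutativeRing public
  open Algebra.Definitions _≈_ using (Invertible)

  field
    1≉0        : ¬ (1# ≈ 0#)
    invertible : ∀ x → ¬ (x ≈ 0#) → Invertible 1# _*_ x

module FieldTheory {c ℓ} (F : Field c ℓ) where

  open Field F public
  open Exponentiation semiring public using (_^_)
  open Summation +-commutativeMonoid using (sum)

  HasOrder : ℕ → Set (c ⊔ ℓ)
  HasOrder n = Inverse setoid (≡.setoid (Fin n))

  divide : (x y : Carrier) → ¬ (y ≈ 0#) → Carrier
  divide x y y≉0 = x * proj₁ (invertible y y≉0)

  syntax divide x y y≉0 = x / y by y≉0

  -- The trace from 𝔽_{2^k} to 𝔽_{2^m}, where m ∣ k, is the sum of the k/m
  -- conjugates x ^ ((2^m)^i).  The formula makes sense on all of F, and is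
  -- meant to be used on elements x of the subfield 𝔽_{2^k} of F, that is,
  -- when x ^ (2^k) ≈ x.
  Tr : (k m : ℕ) .{{_ : NonZero m}} → Carrier → Carrier
  Tr k m x = sum {k div m} λ i → x ^ ((2 ℕ.^ m) ℕ.^ toℕ i)

  -- A pair (c , n) stands for the monomial c Xⁿ, and a list for the sum of
  -- its entries; exponents may repeat and need not be sorted.
  Polynomial : Set c
  Polynomial = List (Carrier × ℕ)

  ⟦_⟧ : Polynomial → Carrier → Carrier
  ⟦ p ⟧ x = foldr (λ (a , n) s → a * x ^ n + s) 0# p

  X·_ : Polynomial → Polynomial
  X·_ = map (map₂ suc)

  -- p ∘X^ r is p(Xʳ).
  _∘X^_ : Polynomial → ℕ → Polynomial
  p ∘X^ r = map (map₂ (r ℕ.*_)) p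

  Permutes : Polynomial → Set (c ⊔ ℓ)
  Permutes p = Bijective _≈_ _≈_ ⟦ p ⟧

-- Writing x = s y^(Q-1) with s ∈ 𝔽_q, f(x) becomes s φ(y) / N(y), where φ(y) = B(y, y^Q) for an
-- 𝔽_q-bilinear map B on 𝔽_{q²}; so f permutes 𝔽_{q²} iff φ is injective on the projective line over 𝔽_q.
-- The 2×2×2 tensor B has hyperdeterminant e².  If e = 0 then φ has a zero or a collision.  If e ≠ 0
-- then B becomes diagonal over 𝔽_{q²}, say φ ~ (l₁(y) m₁(y^Q), l₂(y) m₂(y^Q)).  When the lᵢ are defined
-- over 𝔽_q, projective injectivity makes the zeros of l₁(y) and m₁(y^Q) coincide.  When they are
-- conjugate, φ is t (u t^Q + w t^(qQ)) in the coordinate t = l₁(y), and Σ φ^(q-1) = 0 forces u w = 0.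
-- In both cases {m₁, m₂} is the Frobenius twist of {l₁, l₂}, which is condition (2), and φ is
-- equivalent to X^(Q+1) or X^(Q-1), on ℙ¹(𝔽_q) or on μ_{q+1}; the trace in (3) tells the cases apart.
module Submission where

open import Algebra.Bundles using (CommutativeRing)
open import Algebra.Solver.Ring.AlmostCommutativeRing using (fromCommutativeSemiring; _-Raw-AlmostCommutative⟶_)
open import Data.Bool.Base using (Bool; true; false; if_then_else_)
open import Data.Fin.Base as Fin using (Fin; zero; suc; toℕ; fromℕ<)
open import Data.List.Base using ([]; _∷_)
open import Data.Maybe.Base using (Maybe; just; nothing)
open import Data.Nat.Base as ℕ using (ℕ; zero; suc; _∸_; s≤s; z≤n; NonZero)
open import Data.Nat.Coprimality using (gcd≡1⇒coprime; coprime-Bézout)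
open import Data.Nat.DivMod using (_%_; m%n<n; m≡m%n+[m/n]*n; m/n*n≡m) renaming (_/_ to _div_)
open import Data.Nat.Divisibility using (_∣_; divides; ∣-trans; ∣m+n∣m⇒∣n; ∣⇒≤; n∣m*n)
open import Data.Nat.GCD using (gcd; gcd[m,n]∣m; gcd[m,n]∣n; gcd-greatest; gcd[m,n]≢0; module Bézout)
open import Data.Nat.Properties using (m^n≢0)
open import Data.Product.Base using (Σ; ∃; _×_; _,_; proj₁; proj₂)
open import Data.Sum.Base as Sum using (_⊎_; inj₁; inj₂; [_,_]′)
open import Data.Vec.Functional using (Vector; removeAt)
open import Function.Base using (_∘_; id; case_of_)
open import Function.Bundles using (Inverse; _⇔_; mk⇔)
open import Function.Definitions using (Injective)
open import Level using (_⊔_)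
open import Relation.Binary.Definitions using (tri<; tri≈; tri>)
open import Relation.Binary.PropositionalEquality as ≡ using (_≡_; _≢_)
open import Relation.Nullary using (¬_; Dec; yes; no; contradiction)
open import Relation.Nullary.Decidable using (map′; ¬?; decidable-stable)
import Algebra.Properties.CommutativeMonoid.Sum as Summation
import Algebra.Properties.CommutativeSemigroup as CommutativeSemigroupProperties
import Algebra.Properties.CommutativeSemiring.Exp as CommutativeExp
import Algebra.Properties.Ring as RingProperties
import Algebra.Properties.Semiring.Mult as Multiplication
import Algebra.Properties.Semiring.Sum as SemiringSum
import Algebra.Solver.Ring as RingSolver
import Data.Bool.Properties as Bool
import Data.Fin.Permutation as Perm
import Data.Fin.Properties as Fin
import Data.Nat.Properties as ℕ
import Data.Nat.Tactic.RingSolver as ℕ-Solver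
import Relation.Binary.Reasoning.Setoid as SetoidReasoning
open import Defs

-- The diagonal form comes from a root `x` of `x (x + e) = C C̄`. Dividing by e² gives an
-- Artin-Schreier equation over 𝔽_q for S = x / e, so a root exists in 𝔽_{q²}, and S^q is S
-- (conjugate factors) or S + 1 (factors over 𝔽_q). Condition (2) makes `n` / `e` equal to S^Q + S
-- or S^Q + S + 1, according to which factor is twisted into which; this is how a trace can see the
-- geometry. Put D = k / m. The gcd hypothesis makes ℓ / m odd, and modulo 2 the trace in (3) is
-- then 0 for X^(Q-1) on μ_{q+1}, 1 for X^(Q-1) on ℙ¹(𝔽_q), D for X^(Q+1) on μ_{q+1} and D + 1 for
-- X^(Q+1) on ℙ¹(𝔽_q). Of these maps the first always qualifies, the second never, the third for
-- even D, the fourth for odd D: exactly when the value is 0. The main obstacle is (2) for conjugate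
-- factors. They have no zeros over 𝔽_q, so a wrong pairing offers no visible collision, and only a
-- count over the whole field excludes it. Diagonalisation also needs `C̄` and `H` nonzero; the
-- degenerate cases are settled separately.

injective⇒surjective : ∀ {n} (g : Fin n → Fin n) → Injective _≡_ _≡_ g →
                       ∀ j → ∃ λ i → g i ≡ j
injective⇒surjective {suc n} g inj j with Fin.any? (λ i → g i Fin.≟ j)
... | yes hit  = hit
... | no  miss = contradiction (Fin.pigeonhole ℕ.≤-refl h) λ (i , i′ , i<i′ , eq) →
  Fin.<⇒≢ i<i′ (inj (Fin.punchOut-injective (avoids i) (avoids i′) eq))
  where
  avoids : ∀ i → j ≢ g i
  avoids i eq = miss (i , ≡.sym eq)
  h : Fin (suc n) → Fin n
  h i = Fin.punchOut (avoids i)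

injective⇒permutation : ∀ {n} (g : Fin n → Fin n) → Injective _≡_ _≡_ g → Perm.Permutation n n
injective⇒permutation g inj = Perm.permutation g g⁻¹
  (λ j → proj₂ (surj j)) (λ i → inj (proj₂ (surj (g i))))
  where
  surj = injective⇒surjective g inj
  g⁻¹ = proj₁ ∘ surj

-- Fields: cancellation, powers and the root bound for monic polynomials.

module FieldLemmas {c c′} (F : Field c c′) where
  open FieldTheory F public hiding (zero; distrib)
  open RingProperties ring public using (x∙y⁻¹≈ε⇒x≈y; +-cancelˡ; +-cancelʳ)
  open CommutativeExp commutativeSemiring public using (^-congˡ; ^-homo-*; ^-assocʳ; ^-distrib-*)
  open CommutativeSemigroupProperties +-commutativeSemigroup public using (x∙yz≈y∙xz)
  open SetoidReasoning setoid public
  open Multiplication semiring public using (×1-homo-*; ×-congˡ) renaming (_×_ to _⊠_)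
  module Σ⁺ = SemiringSum semiring
  module Π* = Summation *-commutativeMonoid

  *-cancelˡ : ∀ x {y z} → ¬ x ≈ 0# → x * y ≈ x * z → y ≈ z
  *-cancelˡ x {y} {z} x≉0 eq = let x⁻¹ , x⁻¹x≈1 , _ = invertible x x≉0 in begin
    y  ≈⟨ *-identityˡ y ⟨
    1# * y  ≈⟨ *-congʳ x⁻¹x≈1 ⟨
    x⁻¹ * x * y  ≈⟨ *-assoc _ _ _ ⟩
    x⁻¹ * (x * y)  ≈⟨ *-congˡ eq ⟩
    x⁻¹ * (x * z)  ≈⟨ *-assoc _ _ _ ⟨
    x⁻¹ * x * z  ≈⟨ *-congʳ x⁻¹x≈1 ⟩
    1# * z  ≈⟨ *-identityˡ z ⟩
    z  ∎

  x≈0⇒xy≈0 : ∀ {x y} → x ≈ 0# → x * y ≈ 0#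
  x≈0⇒xy≈0 x≈0 = trans (*-congʳ x≈0) (zeroˡ _)

  y≈0⇒xy≈0 : ∀ {x y} → y ≈ 0# → x * y ≈ 0#
  y≈0⇒xy≈0 y≈0 = trans (*-congˡ y≈0) (zeroʳ _)

  x*y≉0 : ∀ {x y} → ¬ x ≈ 0# → ¬ y ≈ 0# → ¬ x * y ≈ 0#
  x*y≉0 {x} x≉0 y≉0 xy≈0 = y≉0 (*-cancelˡ x x≉0 (trans xy≈0 (sym (zeroʳ x))))

  x^n≉0 : ∀ {x} n → ¬ x ≈ 0# → ¬ x ^ n ≈ 0#
  x^n≉0 zero    x≉0 = 1≉0
  x^n≉0 (suc n) x≉0 = x*y≉0 x≉0 (x^n≉0 n x≉0)

  0^n≈0 : ∀ n → 0 ℕ.< n → 0# ^ n ≈ 0#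
  0^n≈0 (suc n) _ = zeroˡ _

  1^n≈1 : ∀ n → 1# ^ n ≈ 1#
  1^n≈1 zero    = refl
  1^n≈1 (suc n) = trans (*-identityˡ _) (1^n≈1 n)

  ^-comm : ∀ x i j → (x ^ i) ^ j ≈ (x ^ j) ^ i
  ^-comm x i j = trans (^-assocʳ x i j) (trans (reflexive (≡.cong (x ^_) (ℕ.*-comm i j))) (sym (^-assocʳ x j i)))

  infix 4 _≐_
  _≐_ : (Carrier → Carrier) → (Carrier → Carrier) → Set _
  f ≐ g = ∀ x → f x ≈ g x

  -- Monic n f: f is a polynomial function with leading term xⁿ, in Horner form.
  data Monic : ℕ → (Carrier → Carrier) → Set (c ⊔ c′) where
    one  : ∀ {f} → (∀ x → f x ≈ 1#) → Monic 0 f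
    step : ∀ {n f g} a → Monic n g → (∀ x → f x ≈ x * g x + a) → Monic (suc n) f

  -- Synthetic division: the Horner coefficients of the quotient are partial values at `r`, so the
  -- remainder appears as `f r` itself. Degree one is separate because its quotient is a constant.
  factor : ∀ {n f} → Monic (suc n) f → ∀ r → ∃ λ g → Monic n g × (∀ x → f x ≈ (x + - r) * g x + f r)
  factor {f = f} (step {g = h} a (one h≈1) f≈) r = h , one h≈1 , λ x → begin
    f x  ≈⟨ f≈ x ⟩
    x * h x + a  ≈⟨ +-congʳ (lem x r (h x)) ⟩
    (x + - r) * h x + r * h x + a  ≈⟨ +-assoc _ _ _ ⟩
    (x + - r) * h x + (r * h x + a)  ≈⟨ +-congˡ (+-congʳ (*-congˡ (trans (h≈1 x) (sym (h≈1 r))))) ⟩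
    (x + - r) * h x + (r * h r + a)  ≈⟨ +-congˡ (f≈ r) ⟨
    (x + - r) * h x + f r  ∎
    where
    lem : ∀ x r y → x * y ≈ (x + - r) * y + r * y
    lem x r y = begin
      x * y  ≈⟨ *-congʳ (trans (+-assoc _ _ _) (trans (+-congˡ (-‿inverseˡ r)) (+-identityʳ x))) ⟨
      (x + - r + r) * y  ≈⟨ distribʳ _ _ _ ⟩
      (x + - r) * y + r * y  ∎
  factor {f = f} (step {g = h} a h-monic@(step _ _ _) f≈) r =
    let g , g-monic , h≈ = factor h-monic r in
    (λ x → x * g x + h r) , step (h r) g-monic (λ _ → refl) , λ x → begin
    f x  ≈⟨ f≈ x ⟩
    x * h x + a  ≈⟨ +-congʳ (lem x r (h x) (g x) (h r) (h≈ x)) ⟩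
    (x + - r) * (x * g x + h r) + r * h r + a  ≈⟨ +-assoc _ _ _ ⟩
    (x + - r) * (x * g x + h r) + (r * h r + a)  ≈⟨ +-congˡ (f≈ r) ⟨
    (x + - r) * (x * g x + h r) + f r  ∎
    where
    lem : ∀ x r hx gx hr → hx ≈ (x + - r) * gx + hr → x * hx ≈ (x + - r) * (x * gx + hr) + r * hr
    lem x r hx gx hr eq = begin
      x * hx  ≈⟨ *-congˡ eq ⟩
      x * ((x + - r) * gx + hr)  ≈⟨ distribˡ _ _ _ ⟩
      x * ((x + - r) * gx) + x * hr  ≈⟨ +-cong lem₁ lem₂ ⟩
      (x + - r) * (x * gx) + ((x + - r) * hr + r * hr)  ≈⟨ +-assoc _ _ _ ⟨
      (x + - r) * (x * gx) + (x + - r) * hr + r * hr  ≈⟨ +-congʳ (distribˡ _ _ _) ⟨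
      (x + - r) * (x * gx + hr) + r * hr  ∎
      where
      lem₁ = begin
        x * ((x + - r) * gx)  ≈⟨ *-assoc _ _ _ ⟨
        x * (x + - r) * gx  ≈⟨ *-congʳ (*-comm _ _) ⟩
        (x + - r) * x * gx  ≈⟨ *-assoc _ _ _ ⟩
        (x + - r) * (x * gx)  ∎
      lem₂ = begin
        x * hr  ≈⟨ *-congʳ (trans (+-assoc _ _ _) (trans (+-congˡ (-‿inverseˡ r)) (+-identityʳ x))) ⟨
        (x + - r + r) * hr  ≈⟨ distribʳ _ _ _ ⟩
        (x + - r) * hr + r * hr  ∎

  rootBound : ∀ {n f} → Monic n f → (r : Fin (suc n) → Carrier) →
              Injective _≡_ _≈_ r → ¬ (∀ i → f (r i) ≈ 0#)
  rootBound (one f≈1) r inj zeros = 1≉0 (trans (sym (f≈1 _)) (zeros zero))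
  rootBound {suc n} {f} f-monic r inj zeros =
    let g , g-monic , f≈ = factor f-monic (r zero) in
    rootBound g-monic (r ∘ suc) (Fin.suc-injective ∘ inj) λ i →
      *-cancelˡ (r (suc i) + - r zero)
        (λ eq → case (inj (x∙y⁻¹≈ε⇒x≈y _ _ eq)) of λ ())
        (begin
          (r (suc i) + - r zero) * g (r (suc i))  ≈⟨ +-identityʳ _ ⟨
          (r (suc i) + - r zero) * g (r (suc i)) + 0#  ≈⟨ +-congˡ (zeros zero) ⟨
          (r (suc i) + - r zero) * g (r (suc i)) + f (r zero)  ≈⟨ f≈ _ ⟨
          f (r (suc i))  ≈⟨ zeros (suc i) ⟩
          0#  ≈⟨ zeroʳ _ ⟨
          (r (suc i) + - r zero) * 0#  ∎)

  monic-cong : ∀ {n f g} → g ≐ f → Monic n f → Monic n g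
  monic-cong g≈f (one f≈1)       = one λ x → trans (g≈f x) (f≈1 x)
  monic-cong g≈f (step a m f≈)   = step a m λ x → trans (g≈f x) (f≈ x)

  monic-+ : ∀ {m n f g} → m ℕ.< n → Monic n f → Monic m g → Monic n (λ x → f x + g x)
  monic-+ {n = suc n} {f} {g} _ (step {g = f′} a f′-monic f≈) (one g≈1) = step (a + 1#) f′-monic λ x → begin
    f x + g x  ≈⟨ +-cong (f≈ x) (g≈1 x) ⟩
    x * f′ x + a + 1#  ≈⟨ +-assoc _ _ _ ⟩
    x * f′ x + (a + 1#)  ∎
  monic-+ {n = suc n} {f} {g} (s≤s m<n) (step {g = f′} a f′-monic f≈) (step {g = g′} b g′-monic g≈) =
    step (a + b) (monic-+ m<n f′-monic g′-monic) λ x → begin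
    f x + g x  ≈⟨ +-cong (f≈ x) (g≈ x) ⟩
    x * f′ x + a + (x * g′ x + b)  ≈⟨ +-assoc _ _ _ ⟩
    x * f′ x + (a + (x * g′ x + b))  ≈⟨ +-congˡ (x∙yz≈y∙xz _ _ _) ⟩
    x * f′ x + (x * g′ x + (a + b))  ≈⟨ +-assoc _ _ _ ⟨
    x * f′ x + x * g′ x + (a + b)  ≈⟨ +-congʳ (distribˡ _ _ _) ⟨
    x * (f′ x + g′ x) + (a + b)  ∎

  monic-^ : ∀ n → Monic n (_^ n)
  monic-^ zero    = one λ _ → refl
  monic-^ (suc n) = step 0# (monic-^ n) λ _ → sym (+-identityʳ _)

-- Finite fields: Fermat's theorem and power sums.

module FiniteField {c c′} (F : Field c c′) (n : ℕ) (order : FieldTheory.HasOrder F n) where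
  open FieldLemmas F public
  open Inverse order

  private
    from-injective : Injective _≡_ _≈_ from
    from-injective {i} {j} eq = ≡.trans (≡.sym (inverseˡ refl)) (≡.trans (to-cong eq) (inverseˡ refl))

    to-injective : Injective _≈_ _≡_ to
    to-injective eq = trans (sym (inverseʳ ≡.refl)) (trans (from-cong eq) (inverseʳ ≡.refl))

    from∘to : ∀ x → from (to x) ≈ x
    from∘to x = inverseʳ ≡.refl

    on-indices : ∀ (g : Carrier → Carrier) → Fin n → Fin n
    on-indices g = to ∘ g ∘ from

    on-indices-injective : ∀ g → Injective _≈_ _≈_ g → Injective _≡_ _≡_ (on-indices g)
    on-indices-injective g inj = from-injective ∘ inj ∘ to-injective

  infix 4 _≟_
  _≟_ : ∀ x y → Dec (x ≈ y)
  x ≟ y = map′ to-injective to-cong (to x Fin.≟ to y)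

  injective⇒surjective-on-field : ∀ g → Injective _≈_ _≈_ g → ∀ y → ∃ λ x → g x ≈ y
  injective⇒surjective-on-field g inj y =
    let i , eq = injective⇒surjective (on-indices g) (on-indices-injective g inj) (to y) in
    from i , to-injective eq

  ∑ : (Carrier → Carrier) → Carrier
  ∑ f = Σ⁺.sum (f ∘ from)

  ∏ : (Carrier → Carrier) → Carrier
  ∏ f = Π*.sum (f ∘ from)

  ∑-cong : ∀ {f g} → f ≐ g → ∑ f ≈ ∑ g
  ∑-cong eq = Σ⁺.sum-cong-≋ (eq ∘ from)

  ∏-cong : ∀ {f g} → f ≐ g → ∏ f ≈ ∏ g
  ∏-cong eq = Π*.sum-cong-≋ (eq ∘ from)

  ∑-permute : ∀ f g → (∀ {x y} → x ≈ y → f x ≈ f y) → Injective _≈_ _≈_ g → ∑ (f ∘ g) ≈ ∑ f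
  ∑-permute f g cong inj = sym (trans
    (Σ⁺.sum-permute (f ∘ from) (injective⇒permutation _ (on-indices-injective g inj)))
    (Σ⁺.sum-cong-≋ {n} λ i → cong (from∘to (g (from i)))))

  ∏-permute : ∀ f g → (∀ {x y} → x ≈ y → f x ≈ f y) → Injective _≈_ _≈_ g → ∏ (f ∘ g) ≈ ∏ f
  ∏-permute f g cong inj = sym (trans
    (Π*.sum-permute (f ∘ from) (injective⇒permutation _ (on-indices-injective g inj)))
    (Π*.sum-cong-≋ {n} λ i → cong (from∘to (g (from i)))))

  -- Comparing the degree with the number of elements yields elements that no formula provides: one
  -- of nonzero trace, and ones whose i-th power differs from 1.
  nonroot : ∀ {d f} → Monic d f → (∀ {x y} → x ≈ y → f x ≈ f y) → d ℕ.< n → ∃ λ x → ¬ f x ≈ 0#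
  nonroot {f = f} f-monic cong d<n
    with Fin.any? (λ i → ¬? (f (from i) ≟ 0#))
  ... | yes (i , fi≉0) = from i , fi≉0
  ... | no  none = contradiction
    (λ i → decidable-stable (f (from (Fin.inject≤ i d<n)) ≟ 0#) λ ne → none (_ , ne))
    (rootBound f-monic (from ∘ λ i → Fin.inject≤ i d<n) (Fin.inject≤-injective _ _ _ _ ∘ from-injective))

  -- Multiplication by a permutes the nonzero elements, so it fixes their product.
  fermat-nonzero : ∀ a → ¬ a ≈ 0# → a ^ (n ∸ 1) ≈ 1#
  fermat-nonzero a a≉0 = *-cancelˡ (∏ unit) ∏-unit≉0 (begin
    ∏ unit * a ^ (n ∸ 1)  ≈⟨ *-congˡ ∏-scale ⟨
    ∏ unit * ∏ scale  ≈⟨ Π*.∑-distrib-+ (unit ∘ from) (scale ∘ from) ⟨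
    ∏ (λ x → unit x * scale x)  ≈⟨ ∏-cong unit-scale ⟩
    ∏ (λ x → unit (a * x))  ≈⟨ ∏-permute unit (a *_) unit-cong (*-cancelˡ a a≉0) ⟩
    ∏ unit  ≈⟨ *-identityʳ _ ⟨
    ∏ unit * 1#  ∎)
    where
    choose : ∀ {x} → Dec (x ≈ 0#) → Carrier → Carrier
    choose {x} (yes _) y = 1#
    choose {x} (no _)  y = y
    -- Zero would kill the product over the field, so `unit` counts it as 1; `scale x` is then the
    -- quotient of `unit (a * x)` by `unit x`.
    unit scale : Carrier → Carrier
    unit x  = choose (x ≟ 0#) x
    scale x = choose (x ≟ 0#) a

    unit-cong : ∀ {x y} → x ≈ y → unit x ≈ unit y
    unit-cong {x} {y} x≈y with x ≟ 0# | y ≟ 0#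
    ... | yes _   | yes _   = refl
    ... | yes x≈0 | no y≉0  = contradiction (trans (sym x≈y) x≈0) y≉0
    ... | no x≉0  | yes y≈0 = contradiction (trans x≈y y≈0) x≉0
    ... | no _    | no _    = x≈y

    unit-scale : ∀ x → unit x * scale x ≈ unit (a * x)
    unit-scale x with x ≟ 0# | a * x ≟ 0#
    ... | yes x≈0 | yes _    = *-identityʳ 1#
    ... | yes x≈0 | no ax≉0  = contradiction (trans (*-congˡ x≈0) (zeroʳ a)) ax≉0
    ... | no x≉0  | yes ax≈0 = contradiction ax≈0 (x*y≉0 a≉0 x≉0)
    ... | no _    | no _     = *-comm x a

    ∏≉0 : ∀ {m} (f : Vector Carrier m) → (∀ i → ¬ f i ≈ 0#) → ¬ Π*.sum f ≈ 0#
    ∏≉0 {zero}  f f≉0 = 1≉0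
    ∏≉0 {suc m} f f≉0 = x*y≉0 (f≉0 zero) (∏≉0 (f ∘ suc) (f≉0 ∘ suc))

    ∏-unit≉0 : ¬ ∏ unit ≈ 0#
    ∏-unit≉0 = ∏≉0 _ λ i → unit≉0 (from i)
      where
      unit≉0 : ∀ x → ¬ unit x ≈ 0#
      unit≉0 x with x ≟ 0#
      ... | yes _  = 1≉0
      ... | no x≉0 = x≉0

    replicate-^ : ∀ m → Π*.sum {m} (λ _ → a) ≈ a ^ m
    replicate-^ zero    = refl
    replicate-^ (suc m) = *-congˡ (replicate-^ m)

    scale-product : ∀ {m} (g : Fin m → Carrier) i → g i ≈ 0# → Injective _≡_ _≈_ g →
                    Π*.sum (scale ∘ g) ≈ a ^ (m ∸ 1)
    scale-product {suc m} g i gi≈0 inj = begin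
      Π*.sum (scale ∘ g)  ≈⟨ Π*.sum-remove {i = i} (scale ∘ g) ⟩
      scale (g i) * Π*.sum (removeAt (scale ∘ g) i)  ≈⟨ *-cong (at-zero gi≈0) (Π*.sum-cong-≋ λ j →
                                                            off-zero λ eq → Fin.punchInᵢ≢i i j (inj (trans eq (sym gi≈0)))) ⟩
      1# * Π*.sum {m} (λ _ → a)  ≈⟨ *-identityˡ _ ⟩
      Π*.sum {m} (λ _ → a)  ≈⟨ replicate-^ m ⟩
      a ^ m  ∎
      where
      at-zero : ∀ {x} → x ≈ 0# → scale x ≈ 1#
      at-zero {x} x≈0 with x ≟ 0#
      ... | yes _  = refl
      ... | no x≉0 = contradiction x≈0 x≉0
      off-zero : ∀ {x} → ¬ x ≈ 0# → scale x ≈ a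
      off-zero {x} x≉0 with x ≟ 0#
      ... | yes x≈0 = contradiction x≈0 x≉0
      ... | no _    = refl

    ∏-scale : ∏ scale ≈ a ^ (n ∸ 1)
    ∏-scale = scale-product from (to 0#) (from∘to 0#) from-injective

  order>1 : 1 ℕ.< n
  order>1 = two (to 0#) (to 1#) (1≉0 ∘ sym ∘ to-injective)
    where
    two : ∀ {m} (i j : Fin m) → i ≢ j → 1 ℕ.< m
    two {suc zero}    zero zero i≢j = contradiction ≡.refl i≢j
    two {suc (suc m)} _    _    _   = s≤s (s≤s z≤n)

  fermat : ∀ x → x ^ n ≈ x
  fermat x with x ≟ 0#
  ... | yes x≈0 = trans (^-congˡ n x≈0) (trans (0^n≈0 n (ℕ.<-trans (s≤s z≤n) order>1)) (sym x≈0))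
  ... | no x≉0  = begin
    x ^ n  ≡⟨ ≡.cong (x ^_) (ℕ.m+[n∸m]≡n (ℕ.<⇒≤ order>1)) ⟨
    x * x ^ (n ∸ 1)  ≈⟨ *-congˡ (fermat-nonzero x x≉0) ⟩
    x * 1#  ≈⟨ *-identityʳ x ⟩
    x  ∎

  -- Translation by 1 permutes the field, so the sum of all elements does not change when each term
  -- grows by 1.
  order×1≈0 : n ⊠ 1# ≈ 0#
  order×1≈0 = +-cancelʳ _ _ _ (begin
    n ⊠ 1# + ∑ (λ x → x)  ≈⟨ +-congʳ (Σ⁺.sum-replicate n) ⟨
    ∑ (λ _ → 1#) + ∑ (λ x → x)  ≈⟨ Σ⁺.∑-distrib-+ {n} (λ _ → 1#) from ⟨
    ∑ (1# +_)  ≈⟨ ∑-permute (λ x → x) (1# +_) (λ eq → eq) (+-cancelˡ 1# _ _) ⟩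
    ∑ (λ x → x)  ≈⟨ +-identityˡ _ ⟨
    0# + ∑ (λ x → x)  ∎)

  ∑-scale : ∀ a f → ∑ (λ x → a * f x) ≈ a * ∑ f
  ∑-scale a f = sym (Σ⁺.*-distribˡ-sum {n} a (f ∘ from))

  ∑-comm : ∀ {m} (f : Fin m → Carrier → Carrier) →
           ∑ (λ x → Σ⁺.sum (λ i → f i x)) ≈ Σ⁺.sum (λ i → ∑ (f i))
  ∑-comm {m} f = Σ⁺.∑-comm {n} {m} (λ j i → f i (from j))

  -- The sum consists of n - 1 ones; the additional 1 fills the place of the zero element, and n
  -- ones add up to zero.
  ∑-units : ∀ f → (∀ x → x ≈ 0# → f x ≈ 0#) → (∀ x → ¬ x ≈ 0# → f x ≈ 1#) → 1# + ∑ f ≈ 0#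
  ∑-units f f0≈0 f≈1 = trans (1+sum from (to 0#) (from∘to 0#) from-injective)
    (trans (Σ⁺.sum-replicate n) order×1≈0)
    where
    1+sum : ∀ {m} (g : Fin m → Carrier) i → g i ≈ 0# → Injective _≡_ _≈_ g →
            1# + Σ⁺.sum (f ∘ g) ≈ Σ⁺.sum {m} (λ _ → 1#)
    1+sum {suc m} g i gi≈0 inj = +-congˡ (begin
      Σ⁺.sum (f ∘ g)  ≈⟨ Σ⁺.sum-remove {i = i} (f ∘ g) ⟩
      f (g i) + Σ⁺.sum (removeAt (f ∘ g) i)  ≈⟨ +-cong (f0≈0 _ gi≈0) (Σ⁺.sum-cong-≋ {m} λ j →
                                                    f≈1 _ λ eq → Fin.punchInᵢ≢i i j (inj (trans eq (sym gi≈0)))) ⟩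
      0# + Σ⁺.sum {m} (λ _ → 1#)  ≈⟨ +-identityˡ _ ⟩
      Σ⁺.sum {m} (λ _ → 1#)  ∎)

  -- X (X^i - 1) would vanish everywhere otherwise, and its degree `suc i` is below the order of the
  -- field.
  x^i≉1 : ∀ i → 0 ℕ.< i → suc i ℕ.< n → ∃ λ x → ¬ x ≈ 0# × ¬ x ^ i ≈ 1#
  x^i≉1 (suc i) _ i<n =
    let x , fx≉0 = nonroot {f = λ x → x * (x * x ^ i + - 1#)}
          (step {g = λ x → x * x ^ i + - 1#} 0# (step (- 1#) (monic-^ i) λ _ → refl) (λ _ → sym (+-identityʳ _)))
          (λ eq → *-cong eq (+-congʳ (^-congˡ (suc i) eq))) i<n in
    x , (λ x≈0 → fx≉0 (x≈0⇒xy≈0 x≈0))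
      , (λ x^i≈1 → fx≉0 (y≈0⇒xy≈0 (trans (+-congʳ x^i≈1) (-‿inverseʳ 1#))))

  -- Rescaling the variable by `a` permutes the field and multiplies the sum by `a ^ i`, which is
  -- not 1.
  ∑-^≈0 : ∀ i → (∃ λ a → ¬ a ≈ 0# × ¬ a ^ i ≈ 1#) → ∑ (_^ i) ≈ 0#
  ∑-^≈0 i (a , a≉0 , a^i≉1) = *-cancelˡ (a ^ i + - 1#) (a^i≉1 ∘ x∙y⁻¹≈ε⇒x≈y _ _) (begin
    (a ^ i + - 1#) * S  ≈⟨ distribʳ _ _ _ ⟩
    a ^ i * S + - 1# * S  ≈⟨ +-congʳ (Σ⁺.*-distribˡ-sum {n} (a ^ i) (λ j → from j ^ i)) ⟩
    ∑ (λ x → a ^ i * x ^ i) + - 1# * S  ≈⟨ +-congʳ (∑-cong λ x → ^-distrib-* a x i) ⟨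
    ∑ (λ x → (a * x) ^ i) + - 1# * S  ≈⟨ +-congʳ (∑-permute (_^ i) (a *_) (^-congˡ i) (*-cancelˡ a a≉0)) ⟩
    S + - 1# * S  ≈⟨ +-congʳ (*-identityˡ S) ⟨
    1# * S + - 1# * S  ≈⟨ distribʳ _ _ _ ⟨
    (1# + - 1#) * S  ≈⟨ *-congʳ (-‿inverseʳ 1#) ⟩
    0# * S  ≈⟨ zeroˡ S ⟩
    0#  ≈⟨ zeroʳ _ ⟨
    (a ^ i + - 1#) * 0#  ∎)
    where S = ∑ (_^ i)

-- Characteristic 2: a solver for identities, and the powers of Frobenius.

OfCharacteristic₂ : ∀ {c c′} → Field c c′ → Set c′
OfCharacteristic₂ F = 1# + 1# ≈ 0#
  where open Field F

module Characteristic₂ {c c′} (F : Field c c′) (1+1≈0 : OfCharacteristic₂ F) where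
  open FieldLemmas F public

  x+x≈0 : ∀ x → x + x ≈ 0#
  x+x≈0 x = begin
    x + x  ≈⟨ +-cong (*-identityˡ x) (*-identityˡ x) ⟨
    1# * x + 1# * x  ≈⟨ distribʳ _ _ _ ⟨
    (1# + 1#) * x  ≈⟨ *-congʳ 1+1≈0 ⟩
    0# * x  ≈⟨ zeroˡ x ⟩
    0#  ∎

  private
    bit : Bool → Carrier
    bit b = if b then 1# else 0#

    morphism : CommutativeRing.rawRing Bool.xor-∧-commutativeRing
               -Raw-AlmostCommutative⟶ fromCommutativeSemiring commutativeSemiring
    morphism = record
      { ⟦_⟧    = bit
      ; +-homo = λ { true  true  → sym 1+1≈0
                   ; true  false → sym (+-identityʳ 1#)
                   ; false b     → sym (+-identityˡ _) }
      ; *-homo = λ { true  b → sym (*-identityˡ _)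
                   ; false b → sym (zeroˡ _) }
      ; -‿homo = λ _ → refl
      ; 0-homo = refl
      ; 1-homo = refl
      }

    bit≟ : ∀ b b′ → Maybe (bit b ≈ bit b′)
    bit≟ true  true  = just refl
    bit≟ false false = just refl
    bit≟ _     _     = nothing

  -- Coefficients in 𝔽₂ let the solver cancel x + x.
  module Solver₂ = RingSolver _ _ morphism bit≟
  open Solver₂ public using (solve; _:+_; _:*_; _:^_; _:=_; con)

  :0 :1 : ∀ {n} → Solver₂.Polynomial n
  :0 = con false
  :1 = con true

  +≈0⇒≈ : ∀ {x y} → x + y ≈ 0# → x ≈ y
  +≈0⇒≈ {x} {y} eq = begin
    x  ≈⟨ solve 2 (λ x y → x := x :+ y :+ y) refl x y ⟩
    x + y + y  ≈⟨ +-congʳ eq ⟩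
    0# + y  ≈⟨ +-identityˡ y ⟩
    y  ∎

  ≈⇒+≈0 : ∀ {x y} → x ≈ y → x + y ≈ 0#
  ≈⇒+≈0 {y = y} eq = trans (+-congʳ eq) (x+x≈0 y)

  -- An equation follows from others if the sum of its sides is a linear
  -- combination of the sums of their sides.
  combine₁ : ∀ {x y u v} a → x + y ≈ a * (u + v) → u ≈ v → x ≈ y
  combine₁ a eq u≈v = +≈0⇒≈ (trans eq (trans (*-congˡ (≈⇒+≈0 u≈v)) (zeroʳ a)))

  combine₂ : ∀ {x y u v u′ v′} a a′ → x + y ≈ a * (u + v) + a′ * (u′ + v′) → u ≈ v → u′ ≈ v′ → x ≈ y
  combine₂ a a′ eq u≈v u′≈v′ = +≈0⇒≈ (trans eq (trans
    (+-cong (trans (*-congˡ (≈⇒+≈0 u≈v)) (zeroʳ a)) (trans (*-congˡ (≈⇒+≈0 u′≈v′)) (zeroʳ a′)))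
    (+-identityʳ 0#)))

  combine₃ : ∀ {x y u v u′ v′ u″ v″} a a′ a″ → x + y ≈ a * (u + v) + a′ * (u′ + v′) + a″ * (u″ + v″) →
             u ≈ v → u′ ≈ v′ → u″ ≈ v″ → x ≈ y
  combine₃ a a′ a″ eq p p′ p″ = +≈0⇒≈ (trans eq (trans
    (+-cong (+-cong (trans (*-congˡ (≈⇒+≈0 p)) (zeroʳ a)) (trans (*-congˡ (≈⇒+≈0 p′)) (zeroʳ a′)))
            (trans (*-congˡ (≈⇒+≈0 p″)) (zeroʳ a″)))
    (trans (+-identityʳ _) (+-identityʳ 0#))))

  -- Indexed by the exponent of 2, so that composition becomes addition of indices and conjugation,
  -- `σ` and the steps of the trace are all instances.
  frob : ℕ → Carrier → Carrier
  frob i x = x ^ (2 ℕ.^ i)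

  frob-cong : ∀ i {x y} → x ≈ y → frob i x ≈ frob i y
  frob-cong i = ^-congˡ (2 ℕ.^ i)

  frob-* : ∀ i x y → frob i (x * y) ≈ frob i x * frob i y
  frob-* i x y = ^-distrib-* x y (2 ℕ.^ i)

  frob-0 : ∀ x → frob 0 x ≈ x
  frob-0 x = *-identityʳ x

  frob-∘ : ∀ i j x → frob i (frob j x) ≈ frob (j ℕ.+ i) x
  frob-∘ i j x = begin
    (x ^ (2 ℕ.^ j)) ^ (2 ℕ.^ i)  ≈⟨ ^-assocʳ x (2 ℕ.^ j) (2 ℕ.^ i) ⟩
    x ^ (2 ℕ.^ j ℕ.* 2 ℕ.^ i)  ≡⟨ ≡.cong (x ^_) (ℕ.^-distribˡ-+-* 2 j i) ⟨
    x ^ (2 ℕ.^ (j ℕ.+ i))  ∎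

  frob-comm : ∀ i j x → frob i (frob j x) ≈ frob j (frob i x)
  frob-comm i j x = begin
    frob i (frob j x)  ≈⟨ frob-∘ i j x ⟩
    frob (j ℕ.+ i) x  ≡⟨ ≡.cong (λ n → frob n x) (ℕ.+-comm j i) ⟩
    frob (i ℕ.+ j) x  ≈⟨ frob-∘ j i x ⟨
    frob j (frob i x)  ∎

  frob-suc : ∀ i x → frob (suc i) x ≈ frob i x * frob i x
  frob-suc i x = begin
    x ^ (2 ℕ.^ suc i)  ≡⟨ ≡.cong (λ n → x ^ (2 ℕ.^ i ℕ.+ n)) (ℕ.+-identityʳ _) ⟩
    x ^ (2 ℕ.^ i ℕ.+ 2 ℕ.^ i)  ≈⟨ ^-homo-* x (2 ℕ.^ i) (2 ℕ.^ i) ⟩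
    frob i x * frob i x  ∎

  frob-+ : ∀ i x y → frob i (x + y) ≈ frob i x + frob i y
  frob-+ zero    x y = trans (frob-0 _) (sym (+-cong (frob-0 x) (frob-0 y)))
  frob-+ (suc i) x y = begin
    frob (suc i) (x + y)  ≈⟨ frob-suc i _ ⟩
    frob i (x + y) * frob i (x + y)  ≈⟨ *-cong (frob-+ i x y) (frob-+ i x y) ⟩
    (frob i x + frob i y) * (frob i x + frob i y)  ≈⟨ solve 2 (λ x y → (x :+ y) :* (x :+ y) := x :* x :+ y :* y) refl _ _ ⟩
    frob i x * frob i x + frob i y * frob i y  ≈⟨ +-cong (frob-suc i x) (frob-suc i y) ⟨
    frob (suc i) x + frob (suc i) y  ∎

  frob-const-0 : ∀ i → frob i 0# ≈ 0#
  frob-const-0 i = 0^n≈0 (2 ℕ.^ i) (ℕ.m^n>0 2 i)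

  frob-≈0 : ∀ i {x} → x ≈ 0# → frob i x ≈ 0#
  frob-≈0 i x≈0 = trans (frob-cong i x≈0) (frob-const-0 i)

  frob-const-1 : ∀ i → frob i 1# ≈ 1#
  frob-const-1 i = 1^n≈1 (2 ℕ.^ i)

  frob-≉0 : ∀ i {x} → ¬ x ≈ 0# → ¬ frob i x ≈ 0#
  frob-≉0 i = x^n≉0 (2 ℕ.^ i)

-- The field with q² elements: conjugation, Hilbert 90 and Artin-Schreier.

module SquareOrder {c c′} (F : Field c c′) (k : ℕ) (0<k : 0 ℕ.< k)
                   (order : FieldTheory.HasOrder F ((2 ℕ.^ k) ℕ.^ 2)) where
  private
    q = 2 ℕ.^ k
    module FF = FiniteField F (q ℕ.^ 2) order

  -- The order of the field annihilates 1 and is a power of 2; without zero divisors one of the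
  -- factors 2 must already vanish.
  characteristic₂ : OfCharacteristic₂ F
  characteristic₂ with 1# FF.+ 1# FF.≟ 0#
    where open FF
  ... | yes 1+1≈0 = 1+1≈0
  ... | no  1+1≉0 = contradiction (trans (×-congˡ (≡.sym (ℕ.^-*-assoc 2 k 2))) order×1≈0) (2^i≉0 (k ℕ.* 2))
    where
    open FF
    2^i≉0 : ∀ i → ¬ (2 ℕ.^ i) ⊠ 1# ≈ 0#
    2^i≉0 zero    eq = 1≉0 (trans (sym (+-identityʳ 1#)) eq)
    2^i≉0 (suc i) eq = x*y≉0 1+1≉0 (2^i≉0 i) (trans
      (*-congʳ (+-congˡ (sym (+-identityʳ 1#)))) (trans (sym (×1-homo-* 2 (2 ℕ.^ i))) eq))

  open Characteristic₂ F characteristic₂ public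
  open FF public using (_≟_; ∑; ∑-cong; ∑-scale; ∑-comm; ∑-units; ∑-permute; injective⇒surjective-on-field; nonroot; x^i≉1; ∑-^≈0; fermat-nonzero; fermat; order>1)

  infixl 9 _ᶜ
  _ᶜ : Carrier → Carrier
  x ᶜ = frob k x

  ᶜ-cong : ∀ {x y} → x ≈ y → x ᶜ ≈ y ᶜ
  ᶜ-cong = frob-cong k

  ᶜ-+ : ∀ x y → (x + y) ᶜ ≈ x ᶜ + y ᶜ
  ᶜ-+ = frob-+ k

  ᶜ-* : ∀ x y → (x * y) ᶜ ≈ x ᶜ * y ᶜ
  ᶜ-* = frob-* k

  x*x^[q-1] : ∀ x → x * x ^ (q ∸ 1) ≈ x ᶜ
  x*x^[q-1] x = reflexive (≡.cong (x ^_) (ℕ.m+[n∸m]≡n (ℕ.m^n>0 2 k)))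

  frob-k+k : ∀ x → frob (k ℕ.+ k) x ≈ x
  frob-k+k x = begin
    x ^ (2 ℕ.^ (k ℕ.+ k))  ≡⟨ ≡.cong (x ^_) (≡.trans (ℕ.^-distribˡ-+-* 2 k k) (≡.cong (q ℕ.*_) (≡.sym (ℕ.*-identityʳ q)))) ⟩
    x ^ (q ℕ.^ 2)  ≈⟨ fermat x ⟩
    x  ∎

  ᶜᶜ : ∀ x → x ᶜ ᶜ ≈ x
  ᶜᶜ x = trans (frob-∘ k k x) (frob-k+k x)

  ᶜ-*ᶜ : ∀ x y → (x * y ᶜ) ᶜ ≈ x ᶜ * y
  ᶜ-*ᶜ x y = trans (ᶜ-* x (y ᶜ)) (*-congˡ (ᶜᶜ y))

  frob-injective : ∀ i {x y} → frob i x ≈ frob i y → x ≈ y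
  frob-injective i {x} {y} eq with x + y ≟ 0#
  ... | yes x+y≈0 = +≈0⇒≈ x+y≈0
  ... | no x+y≉0  = contradiction (trans (frob-+ i x y) (≈⇒+≈0 eq)) (frob-≉0 i x+y≉0)

  frob-surjective : ∀ i y → ∃ λ x → frob i x ≈ y
  frob-surjective i = injective⇒surjective-on-field (frob i) (frob-injective i)

  -- The 𝔽_q-linear map `z ↦ p z + r zᶜ` has determinant `p pᶜ + r rᶜ`. A kernel vector is
  -- `p ᶜ + r`, and if this is zero then `r` equals `p ᶜ`, which is itself a kernel vector.
  hilbert90 : ∀ p r → ¬ p ≈ 0# → p * p ᶜ ≈ r * r ᶜ → ∃ λ z → ¬ z ≈ 0# × p * z ≈ r * z ᶜ
  hilbert90 p r p≉0 Np≈Nr with p ᶜ + r ≟ 0#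
  ... | no ≉0  = p ᶜ + r , ≉0 , (begin
    p * (p ᶜ + r)  ≈⟨ combine₁ 1# (solve 4 (λ p p′ r r′ → p :* (p′ :+ r) :+ r :* (p :+ r′) := :1 :* (p :* p′ :+ r :* r′)) refl p (p ᶜ) r (r ᶜ)) Np≈Nr ⟩
    r * (p + r ᶜ)  ≈⟨ *-congˡ (+-congʳ (ᶜᶜ p)) ⟨
    r * (p ᶜ ᶜ + r ᶜ)  ≈⟨ *-congˡ (ᶜ-+ _ _) ⟨
    r * (p ᶜ + r) ᶜ  ∎)
  ... | yes ≈0 = p ᶜ , frob-≉0 k p≉0 , (begin
    p * p ᶜ  ≈⟨ *-comm _ _ ⟩
    p ᶜ * p  ≈⟨ *-cong (+≈0⇒≈ ≈0) (sym (ᶜᶜ p)) ⟩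
    r * p ᶜ ᶜ  ∎)

  -- On 𝔽_{2ⁱ} this is the absolute trace.
  T : ℕ → Carrier → Carrier
  T zero    x = 0#
  T (suc i) x = T i x + frob i x

  T-+ : ∀ i j x → T (i ℕ.+ j) x ≈ T j x + T i (frob j x)
  T-+ zero    j x = sym (+-identityʳ _)
  T-+ (suc i) j x = begin
    T (i ℕ.+ j) x + frob (i ℕ.+ j) x  ≈⟨ +-cong (T-+ i j x) (reflexive (≡.cong (λ n → frob n x) (ℕ.+-comm i j))) ⟩
    T j x + T i (frob j x) + frob (j ℕ.+ i) x  ≈⟨ +-congˡ (frob-∘ i j x) ⟨
    T j x + T i (frob j x) + frob i (frob j x)  ≈⟨ +-assoc _ _ _ ⟩
    T j x + (T i (frob j x) + frob i (frob j x))  ∎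

  T-cong : ∀ i {x y} → x ≈ y → T i x ≈ T i y
  T-cong zero    eq = refl
  T-cong (suc i) eq = +-cong (T-cong i eq) (frob-cong i eq)

  -- Squaring shifts the sum of conjugates by one place: `x` drops out at the start and `frob i x`
  -- enters at the end.
  T-square : ∀ i x → T i x * T i x ≈ T i x + x + frob i x
  T-square zero    x = begin
    0# * 0#  ≈⟨ zeroˡ 0# ⟩
    0#  ≈⟨ x+x≈0 x ⟨
    x + x  ≈⟨ +-cong (+-identityˡ x) (frob-0 x) ⟨
    0# + x + frob 0 x  ∎
  T-square (suc i) x = begin
    (t + y) * (t + y)  ≈⟨ solve 2 (λ t y → (t :+ y) :* (t :+ y) := t :* t :+ y :* y) refl t y ⟩
    t * t + y * y  ≈⟨ +-cong (T-square i x) (sym (frob-suc i x)) ⟩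
    t + x + y + frob (suc i) x  ≈⟨ +-congʳ (solve 3 (λ t x y → t :+ x :+ y := t :+ y :+ x) refl t x y) ⟩
    t + y + x + frob (suc i) x  ∎
    where t = T i x ; y = frob i x

  T-monic : ∀ i → Monic (2 ℕ.^ i) (T (suc i))
  T-monic zero    = step 0# (one λ _ → refl) λ x → +-comm 0# (x * 1#)
  T-monic (suc i) = monic-cong (λ x → +-comm _ _)
    (monic-+ (ℕ.^-monoʳ-< 2 ℕ.≤-refl (ℕ.n<1+n i)) (monic-^ (2 ℕ.^ suc i)) (T-monic i))

  -- The additive Hilbert 90 solution s = Σⱼ Tⱼ(α) η^(2ʲ), where η has absolute trace 1.
  artinSchreier : ∀ α → α ᶜ ≈ α → ∃ λ s → s * s + s ≈ α
  artinSchreier α αᶜ≈α = s , +≈0⇒≈ (begin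
    s * s + s + α  ≈⟨ +-congʳ (+-congʳ (s-square (k ℕ.+ k))) ⟩
    s + T (k ℕ.+ k) α * frob (k ℕ.+ k) η + α * (t * t) + s + α
      ≈⟨ +-congʳ (+-congʳ (+-cong (+-congˡ (*-congʳ Tα≈0)) (*-congˡ (*-cong t≈1 t≈1)))) ⟩
    s + 0# * frob (k ℕ.+ k) η + α * (1# * 1#) + s + α
      ≈⟨ solve 3 (λ s f α → s :+ :0 :* f :+ α :* (:1 :* :1) :+ s :+ α := :0) refl s _ α ⟩
    0# ∎)
    where
    -- As a polynomial the trace has degree 2^(2k-1), below q², so it does not vanish identically.
    η-exists : ∃ λ η → ¬ T (k ℕ.+ k) η ≈ 0#
    η-exists = ≡.subst (λ n → ∃ λ η → ¬ T n η ≈ 0#) (ℕ.m+[n∸m]≡n {1} {k ℕ.+ k} (ℕ.≤-trans 0<k (ℕ.m≤m+n k k)))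
      (nonroot (T-monic (k ℕ.+ k ∸ 1)) (T-cong (suc (k ℕ.+ k ∸ 1))) (≡.subst (2 ℕ.^ (k ℕ.+ k ∸ 1) ℕ.<_)
        (≡.trans (≡.cong (2 ℕ.^_) (≡.cong (k ℕ.+_) (≡.sym (ℕ.+-identityʳ k)))) (≡.trans (≡.cong (2 ℕ.^_) (ℕ.*-comm 2 k)) (≡.sym (ℕ.^-*-assoc 2 k 2))))
        (ℕ.^-monoʳ-< 2 ℕ.≤-refl (ℕ.∸-monoʳ-< {k ℕ.+ k} {1} {0} ℕ.≤-refl (ℕ.≤-trans 0<k (ℕ.m≤m+n k k))))))
    η = proj₁ η-exists
    t = T (k ℕ.+ k) η
    t≈1 : t ≈ 1#
    t≈1 = *-cancelˡ t (proj₂ η-exists) (begin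
      t * t  ≈⟨ T-square (k ℕ.+ k) η ⟩
      t + η + frob (k ℕ.+ k) η  ≈⟨ +-congˡ (frob-k+k η) ⟩
      t + η + η  ≈⟨ solve 2 (λ t η → t :+ η :+ η := t :* :1) refl t η ⟩
      t * 1#  ∎)
    -- The 2k conjugates of `α` repeat after k steps and cancel in pairs; this is where `α` in 𝔽_q
    -- enters.
    Tα≈0 : T (k ℕ.+ k) α ≈ 0#
    Tα≈0 = trans (T-+ k k α) (trans (+-congˡ (T-cong k αᶜ≈α)) (x+x≈0 _))
    S : ℕ → Carrier
    S zero    = 0#
    S (suc i) = S i + T i α * frob i η
    s = S (k ℕ.+ k)
    -- Squaring shifts the index and turns Tⱼ(α) into Tⱼ₊₁(α) + α. What remains is the sum itself,
    -- one boundary term, and `α` times a square of traces of `η`.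
    s-square : ∀ i → S i * S i ≈ S i + T i α * frob i η + α * (T i η * T i η)
    s-square zero    = solve 2 (λ α η → :0 :* :0 := :0 :+ :0 :* η :+ α :* (:0 :* :0)) refl α _
    s-square (suc i) = begin
      (p + u * v) * (p + u * v)  ≈⟨ solve 3 (λ p u v → (p :+ u :* v) :* (p :+ u :* v) := p :* p :+ u :* u :* (v :* v)) refl p u v ⟩
      p * p + u * u * (v * v)  ≈⟨ +-cong (s-square i) (*-congʳ (T-square i α)) ⟩
      p + u * v + α * (w * w) + (u + α + a) * (v * v)  ≈⟨ solve 6 (λ p u v w α a →
            p :+ u :* v :+ α :* (w :* w) :+ (u :+ α :+ a) :* (v :* v)
        :=  p :+ u :* v :+ (u :+ a) :* (v :* v) :+ α :* ((w :+ v) :* (w :+ v))) refl p u v w α a ⟩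
      p + u * v + (u + a) * (v * v) + α * ((w + v) * (w + v))  ≈⟨ +-congʳ (+-congˡ (*-congˡ (frob-suc i η))) ⟨
      p + u * v + (u + a) * frob (suc i) η + α * ((w + v) * (w + v))  ∎
      where p = S i ; u = T i α ; v = frob i η ; w = T i η ; a = frob i α

-- The bilinear map behind `φ` and its diagonalisation.

module Quadrinomial {c c′} (F : Field c c′) (k : ℕ) (0<k : 0 ℕ.< k)
                    (order : FieldTheory.HasOrder F ((2 ℕ.^ k) ℕ.^ 2))
                    (ℓ : ℕ) (a b d : Field.Carrier F) where
  open SquareOrder F k 0<k order public

  zero-product : ∀ {x y} → x * y ≈ 0# → x ≈ 0# ⊎ y ≈ 0#
  zero-product {x} {y} xy≈0 with x ≟ 0#
  ... | yes x≈0 = inj₁ x≈0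
  ... | no  x≉0 = inj₂ (*-cancelˡ x x≉0 (trans xy≈0 (sym (zeroʳ x))))

  σ : Carrier → Carrier
  σ = frob ℓ

  infix 4 _∥_
  _∥_ : Carrier → Carrier → Set c′
  x ∥ y = x * y ᶜ ≈ x ᶜ * y

  -- `n` / `e` is the argument of the trace in (3), while the conjugate `C̄` of `C` and `H` are the
  -- bases of the two sides of (2).
  e n C H : Carrier
  e = 1# + a * a ᶜ + b * b ᶜ + d * d ᶜ
  n = a * a ᶜ + d * d ᶜ
  C = d + a ᶜ * b
  H = a + b * d ᶜ

  C̄ H̄ : Carrier
  C̄ = d ᶜ + a * b ᶜ
  H̄ = a ᶜ + b ᶜ * d

  Cᶜ : C ᶜ ≈ C̄
  Cᶜ = trans (ᶜ-+ _ _) (+-congˡ (trans (ᶜ-* _ _) (*-congʳ (ᶜᶜ a))))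

  C̄ᶜ : C̄ ᶜ ≈ C
  C̄ᶜ = trans (ᶜ-cong (sym Cᶜ)) (ᶜᶜ C)

  Hᶜ : H ᶜ ≈ H̄
  Hᶜ = trans (ᶜ-+ _ _) (+-congˡ (ᶜ-*ᶜ _ _))

  norm-fixed : ∀ x → (x * x ᶜ) ᶜ ≈ x * x ᶜ
  norm-fixed x = trans (ᶜ-* _ _) (trans (*-congˡ (ᶜᶜ x)) (*-comm _ _))

  nᶜ : n ᶜ ≈ n
  nᶜ = trans (ᶜ-+ _ _) (+-cong (norm-fixed a) (norm-fixed d))

  eᶜ : e ᶜ ≈ e
  eᶜ = trans (ᶜ-+ _ _) (+-cong (trans (ᶜ-+ _ _) (+-cong (trans (ᶜ-+ _ _) (+-cong (frob-const-1 k) (norm-fixed a)))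
         (norm-fixed b))) (norm-fixed d))

  -- With z = y^Q this is the numerator of the degree-(Q+1) map on μ_{q+1}.  For fixed y it is an
  -- 𝔽_q-linear map in z of determinant C y² + e y ȳ + C̄ ȳ², and for fixed z one in y of
  -- determinant H̄ z² + e z z̄ + H z̄².
  B B̄ : (y ȳ z z̄ : Carrier) → Carrier
  B y ȳ z z̄ = z * ȳ + b * z̄ * y + a * z̄ * ȳ + d * z * y
  B̄ y ȳ z z̄ = z̄ * y + b ᶜ * z * ȳ + a ᶜ * z * y + d ᶜ * z̄ * ȳ

  φ φ̄ : Carrier → Carrier
  φ y = B y (y ᶜ) (σ y) (σ y ᶜ)
  φ̄ y = B̄ y (y ᶜ) (σ y) (σ y ᶜ)

  φᶜ : ∀ y → φ y ᶜ ≈ φ̄ y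
  φᶜ y = begin
    φ y ᶜ  ≈⟨ trans (ᶜ-+ _ _) (+-cong (trans (ᶜ-+ _ _) (+-cong (trans (ᶜ-+ _ _) (+-cong
               (ᶜ-*ᶜ _ _)
               (trans (ᶜ-* _ _) (*-congʳ (ᶜ-*ᶜ _ _)))))
               (trans (ᶜ-* _ _) (*-cong (ᶜ-*ᶜ _ _) (ᶜᶜ y)))))
               (trans (ᶜ-* _ _) (*-congʳ (ᶜ-* _ _)))) ⟩
    σ y ᶜ * y + b ᶜ * σ y * y ᶜ + a ᶜ * σ y * y + d ᶜ * σ y ᶜ * y ᶜ ∎

  -- As x ∥ y means x / y ∈ 𝔽_q (for y ≉ 0), this is injectivity on the projective line 𝔽_{q²}ˣ / 𝔽_qˣ.
  record Projectively-injective : Set (c ⊔ c′) where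
    field
      nonzero    : ∀ y → ¬ y ≈ 0# → ¬ φ y ≈ 0#
      injective  : ∀ y y′ → ¬ y ≈ 0# → ¬ y′ ≈ 0# → φ y ∥ φ y′ → y ∥ y′

  -- If x is a root then so is x + e; the two quadratic forms above are, up to scalars, the products
  -- l x · l (x + e) and m x · m (x + e).
  l m : (x y : Carrier) → Carrier
  l x y = C̄ * y ᶜ + x * y
  m x z = H * z ᶜ + (x + n) * z

  Root : Carrier → Set c′
  Root x = x * (x + e) ≈ C * C̄

  e-fixed-+ : ∀ {x} → x + e + e ≈ x
  e-fixed-+ {x} = solve 2 (λ x e → x :+ e :+ e := x) refl x e

  conjugate-root : ∀ {x} → Root x → Root (x + e)
  conjugate-root {x} root = trans (*-congˡ e-fixed-+) (trans (*-comm _ _) root)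

  -- Copies of the forms for the solver, with an element and its conjugate as independent variables.
  module :Forms {v} (a ā b b̄ d d̄ : Solver₂.Polynomial v) where
    :e = :1 :+ a :* ā :+ b :* b̄ :+ d :* d̄
    :n = a :* ā :+ d :* d̄
    :C = d :+ ā :* b
    :C̄ = d̄ :+ a :* b̄
    :H = a :+ b :* d̄
    :H̄ = ā :+ b̄ :* d
    :B :B̄ : (y ȳ z z̄ : Solver₂.Polynomial v) → Solver₂.Polynomial v
    :B y ȳ z z̄ = z :* ȳ :+ b :* z̄ :* y :+ a :* z̄ :* ȳ :+ d :* z :* y
    :B̄ y ȳ z z̄ = z̄ :* y :+ b̄ :* z :* ȳ :+ ā :* z :* y :+ d̄ :* z̄ :* ȳ

  -- By the identity `C C̄ + H H̄ = n (n + e)`. Both quadratic forms have middle coefficient `e`,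
  -- and a shift by `n` carries the roots of one to those of the other.
  root-H : ∀ {x} → Root x → (x + n) * (x + n + e) ≈ H * H̄
  root-H {x} = combine₁ 1# (solve 7 (λ x a ā b b̄ d d̄ → let open :Forms a ā b b̄ d d̄ in
    (x :+ :n) :* (x :+ :n :+ :e) :+ :H :* :H̄ := :1 :* (x :* (x :+ :e) :+ :C :* :C̄))
    refl x a (a ᶜ) b (b ᶜ) d (d ᶜ))

  -- Coefficients for which the combination of `φ` and `φ̄` has rank one, so that it splits into a
  -- factor in `y` and a factor in `σ y`.
  ρ₁ ρ₂ : Carrier → Carrier
  ρ₁ x = d ᶜ * x + C̄
  ρ₂ x = a * x + b * C̄

  diagonal : ∀ {x} → Root x → ∀ y → l x y * m (x + e) (σ y) ≈ ρ₁ x * φ y + ρ₂ x * φ̄ y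
  diagonal {x} root y = combine₁ (σ y * y) (solve 11 (λ x a ā b b̄ d d̄ y ȳ z z̄ → let open :Forms a ā b b̄ d d̄ in
      (:C̄ :* ȳ :+ x :* y) :* (:H :* z̄ :+ (x :+ :e :+ :n) :* z) :+
      ((d̄ :* x :+ :C̄) :* :B y ȳ z z̄ :+ (a :* x :+ b :* :C̄) :* :B̄ y ȳ z z̄)
    := (z :* y) :* (x :* (x :+ :e) :+ :C :* :C̄))
    refl x a (a ᶜ) b (b ᶜ) d (d ᶜ) y (y ᶜ) (σ y) (σ y ᶜ)) root

  ψ : (x y : Carrier) → Carrier
  ψ x y = l x y * m (x + e) (σ y)

  -- The combinations for `x` and for `x + e` form a change of basis of determinant `e C̄ H`, so
  -- proportionality of values of `φ` can be tested on `ψ`. The vanishing of `C̄` or `H` breaks this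
  -- and is treated apart.
  ψ-det : ∀ {x} → Root x → ∀ y y′ →
          ψ x y * ψ (x + e) y′ + ψ x y′ * ψ (x + e) y ≈ (e * C̄ * H) * (φ y * φ̄ y′ + φ̄ y * φ y′)
  ψ-det {x} root y y′ = begin
    ψ x y * ψ (x + e) y′ + ψ x y′ * ψ (x + e) y
      ≈⟨ +-cong (*-cong (diagonal root y) (diagonal (conjugate-root root) y′))
                (*-cong (diagonal root y′) (diagonal (conjugate-root root) y)) ⟩
    (ρ₁ x * φ y + ρ₂ x * φ̄ y) * (ρ₁ (x + e) * φ y′ + ρ₂ (x + e) * φ̄ y′) +
    (ρ₁ x * φ y′ + ρ₂ x * φ̄ y′) * (ρ₁ (x + e) * φ y + ρ₂ (x + e) * φ̄ y)
      ≈⟨ solve 10 (λ x e C̄ a b d̄ f f̄ g ḡ →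
           (((d̄ :* x :+ C̄) :* f :+ (a :* x :+ b :* C̄) :* f̄) :* ((d̄ :* (x :+ e) :+ C̄) :* g :+ (a :* (x :+ e) :+ b :* C̄) :* ḡ) :+
           ((d̄ :* x :+ C̄) :* g :+ (a :* x :+ b :* C̄) :* ḡ) :* ((d̄ :* (x :+ e) :+ C̄) :* f :+ (a :* (x :+ e) :+ b :* C̄) :* f̄))
         := e :* C̄ :* (a :+ b :* d̄) :* (f :* ḡ :+ f̄ :* g)) refl x e C̄ a b (d ᶜ) (φ y) (φ̄ y) (φ y′) (φ̄ y′) ⟩
    (e * C̄ * H) * (φ y * φ̄ y′ + φ̄ y * φ y′) ∎

  l-det : ∀ x y y′ → l x y * l (x + e) y′ + l x y′ * l (x + e) y ≈ (e * C̄) * (y * y′ ᶜ + y ᶜ * y′)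
  l-det x y y′ = solve 7 (λ x e C̄ y ȳ y′ ȳ′ →
      (C̄ :* ȳ :+ x :* y) :* (C̄ :* ȳ′ :+ (x :+ e) :* y′) :+ (C̄ :* ȳ′ :+ x :* y′) :* (C̄ :* ȳ :+ (x :+ e) :* y)
    := (e :* C̄) :* (y :* ȳ′ :+ ȳ :* y′)) refl x e C̄ y (y ᶜ) y′ (y′ ᶜ)

-- Parity and a divisibility between natural numbers.

Even Odd : ℕ → Set
Even n = ∃ λ i → n ≡ i ℕ.* 2
Odd  n = ∃ λ i → n ≡ suc (i ℕ.* 2)

even⊎odd : ∀ n → Even n ⊎ Odd n
even⊎odd zero    = inj₁ (0 , ≡.refl)
even⊎odd (suc n) with even⊎odd n
... | inj₁ (i , eq) = inj₂ (i , ≡.cong suc eq)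
... | inj₂ (i , eq) = inj₁ (suc i , ≡.cong suc eq)

-- For r = `suc M`, r is -1 modulo r + 1, so its even powers are 1. With r = 2^m this makes 2^m + 1
-- divide q² - 1.
M+1∣M^2D-1 : ∀ M D → ∃ λ i → (suc M ℕ.^ D) ℕ.* (suc M ℕ.^ D) ≡ suc (i ℕ.* suc (suc M))
M+1∣M^2D-1 M zero    = 0 , ≡.refl
M+1∣M^2D-1 M (suc D) with M+1∣M^2D-1 M D
... | i , eq = M ℕ.+ suc M ℕ.* suc M ℕ.* i , (begin
  suc M ℕ.* r ℕ.* (suc M ℕ.* r)  ≡⟨ lem₁ M r ⟩
  suc M ℕ.* suc M ℕ.* (r ℕ.* r)  ≡⟨ ≡.cong (suc M ℕ.* suc M ℕ.*_) eq ⟩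
  suc M ℕ.* suc M ℕ.* suc (i ℕ.* suc (suc M))  ≡⟨ lem₂ M i ⟩
  suc ((M ℕ.+ suc M ℕ.* suc M ℕ.* i) ℕ.* suc (suc M))  ∎)
  where
  open ≡.≡-Reasoning
  r = suc M ℕ.^ D
  lem₁ : ∀ M r → suc M ℕ.* r ℕ.* (suc M ℕ.* r) ≡ suc M ℕ.* suc M ℕ.* (r ℕ.* r)
  lem₁ = ℕ-Solver.solve-∀
  lem₂ : ∀ M i → suc M ℕ.* suc M ℕ.* suc (i ℕ.* suc (suc M)) ≡ suc ((M ℕ.+ suc M ℕ.* suc M ℕ.* i) ℕ.* suc (suc M))
  lem₂ = ℕ-Solver.solve-∀

-- Iterated Frobenius on μ_{2^m+1} and the relative trace.

module Iterates {c c′} (F : Field c c′) (k : ℕ) (0<k : 0 ℕ.< k)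
                (order : FieldTheory.HasOrder F ((2 ℕ.^ k) ℕ.^ 2))
                (m′ D : ℕ) (k≡Dm : k ≡ D ℕ.* m′) where
  open SquareOrder F k 0<k order

  frob-fixed : ∀ i t → frob i t ≈ t → ∀ j → frob (j ℕ.* i) t ≈ t
  frob-fixed i t fix zero    = frob-0 t
  frob-fixed i t fix (suc j) = begin
    frob (i ℕ.+ j ℕ.* i) t  ≈⟨ frob-∘ (j ℕ.* i) i t ⟨
    frob (j ℕ.* i) (frob i t)  ≈⟨ frob-cong (j ℕ.* i) fix ⟩
    frob (j ℕ.* i) t  ≈⟨ frob-fixed i t fix j ⟩
    t  ∎

  invertible⇒≉0 : ∀ {t u} → t * u ≈ 1# → ¬ t ≈ 0#
  invertible⇒≉0 tu≈1 t≈0 = 1≉0 (trans (sym tu≈1) (x≈0⇒xy≈0 t≈0))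

  -- The hypothesis says that `frob i` inverts `t`, so an even number of applications restores it;
  -- `frob-odd` is the companion.
  frob-even : ∀ i t → t * frob i t ≈ 1# → ∀ {j} → Even j → frob (j ℕ.* i) t ≈ t
  frob-even i t inv (zero , ≡.refl) = frob-0 t
  frob-even i t inv {j} (suc h , ≡.refl) = begin
    frob (i ℕ.+ (i ℕ.+ r)) t  ≈⟨ frob-∘ (i ℕ.+ r) i t ⟨
    frob (i ℕ.+ r) (frob i t)  ≈⟨ frob-∘ r i _ ⟨
    frob r (frob i (frob i t))  ≈⟨ frob-cong r (*-cancelˡ (frob i t) (invertible⇒≉0 (trans (*-comm _ _) inv)) (begin
      frob i t * frob i (frob i t)  ≈⟨ frob-* i t _ ⟨
      frob i (t * frob i t)  ≈⟨ frob-cong i inv ⟩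
      frob i 1#  ≈⟨ frob-const-1 i ⟩
      1#  ≈⟨ inv ⟨
      t * frob i t  ≈⟨ *-comm _ _ ⟩
      frob i t * t  ∎)) ⟩
    frob r t  ≈⟨ frob-even i t inv (h , ≡.refl) ⟩
    t  ∎
    where r = h ℕ.* 2 ℕ.* i

  frob-odd : ∀ i t → t * frob i t ≈ 1# → ∀ {j} → Odd j → t * frob (j ℕ.* i) t ≈ 1#
  frob-odd i t inv (h , ≡.refl) = begin
    t * frob (i ℕ.+ r) t  ≡⟨ ≡.cong (λ n → t * frob n t) (ℕ.+-comm i r) ⟩
    t * frob (r ℕ.+ i) t  ≈⟨ *-congˡ (frob-∘ i r t) ⟨
    t * frob i (frob r t)  ≈⟨ *-congˡ (frob-cong i (frob-even i t inv (h , ≡.refl))) ⟩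
    t * frob i t  ≈⟨ inv ⟩
    1#  ∎
    where r = h ℕ.* 2 ℕ.* i

  -- Since 2^m + 1 divides q² - 1 with quotient `i`, every nonzero i-th power lies in μ_{2^m+1}, and
  -- some i-th power of a nonzero element is not 1.
  unit-exists : ∃ λ ζ → ¬ ζ ≈ 1# × ζ * frob m′ ζ ≈ 1#
  unit-exists = proj₁ θ ^ i , proj₂ (proj₂ θ) , (begin
    x ^ i * frob m′ (x ^ i)  ≡⟨⟩
    (x ^ i) ^ suc (2 ℕ.^ m′)  ≈⟨ ^-assocʳ x i (suc (2 ℕ.^ m′)) ⟩
    x ^ (i ℕ.* suc (2 ℕ.^ m′))  ≡⟨ ≡.cong (λ j → x ^ (j ∸ 1)) q²≡ ⟨
    x ^ ((2 ℕ.^ k) ℕ.^ 2 ∸ 1)  ≈⟨ fermat-nonzero x (proj₁ (proj₂ θ)) ⟩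
    1#  ∎)
    where
    M-1 = 2 ℕ.^ m′ ∸ 1
    M≡ : suc M-1 ≡ 2 ℕ.^ m′
    M≡ = ℕ.m+[n∸m]≡n (ℕ.m^n>0 2 m′)
    i = proj₁ (M+1∣M^2D-1 M-1 D)
    q≡ : 2 ℕ.^ k ≡ suc M-1 ℕ.^ D
    q≡ = ≡.trans (≡.cong (2 ℕ.^_) (≡.trans k≡Dm (ℕ.*-comm D m′))) (≡.trans (≡.sym (ℕ.^-*-assoc 2 m′ D)) (≡.cong (ℕ._^ D) (≡.sym M≡)))
    q²≡ : (2 ℕ.^ k) ℕ.^ 2 ≡ suc (i ℕ.* suc (2 ℕ.^ m′))
    q²≡ = ≡.trans (≡.cong (2 ℕ.^ k ℕ.*_) (ℕ.*-identityʳ (2 ℕ.^ k))) (≡.trans (≡.cong₂ ℕ._*_ q≡ q≡)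
            (≡.trans (proj₂ (M+1∣M^2D-1 M-1 D)) (≡.cong (λ j → suc (i ℕ.* suc j)) M≡)))
    0<i : 0 ℕ.< i
    0<i = ℕ.n≢0⇒n>0 λ i≡0 → ℕ.<⇒≢ order>1 (≡.sym (≡.trans q²≡ (≡.cong (λ j → suc (j ℕ.* suc (2 ℕ.^ m′))) i≡0)))
    θ : ∃ λ x → ¬ x ≈ 0# × ¬ x ^ i ≈ 1#
    θ = x^i≉1 i 0<i (≡.subst (suc i ℕ.<_) (≡.sym q²≡) (s≤s (≡.subst (ℕ._< i ℕ.* suc (2 ℕ.^ m′)) (ℕ.*-identityʳ i)
          (ℕ.*-monoʳ-< i {{ℕ.>-nonZero 0<i}} (s≤s (ℕ.m^n>0 2 m′))))))
    x = proj₁ θ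

  -- An element of μ_{2^m+1}, used to exhibit collisions when D has the wrong parity.
  ζ : Carrier
  ζ = proj₁ unit-exists

  ζ≉1 : ¬ ζ ≈ 1#
  ζ≉1 = proj₁ (proj₂ unit-exists)

  ζ*ζᶜ≈1 : Odd D → ζ * ζ ᶜ ≈ 1#
  ζ*ζᶜ≈1 D-odd = ≡.subst (λ j → ζ * frob j ζ ≈ 1#) (≡.sym k≡Dm) (frob-odd m′ ζ (proj₂ (proj₂ unit-exists)) D-odd)

  ζᶜ≈ζ : Even D → ζ ᶜ ≈ ζ
  ζᶜ≈ζ D-even = ≡.subst (λ j → frob j ζ ≈ ζ) (≡.sym k≡Dm) (frob-even m′ ζ (proj₂ (proj₂ unit-exists)) D-even)

  τ : Carrier → Carrier
  τ = frob m′

  -- With n = k / m this unfolds to the trace in (3); the free length permits induction.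
  trace : ℕ → Carrier → Carrier
  trace n x = Σ⁺.sum {n} λ i → x ^ ((2 ℕ.^ m′) ℕ.^ toℕ i)

  trace-suc : ∀ n x → trace (suc n) x ≈ x + trace n (τ x)
  trace-suc n x = +-cong (*-identityʳ x) (Σ⁺.sum-cong-≋ {n} λ i → sym (^-assocʳ x (2 ℕ.^ m′) ((2 ℕ.^ m′) ℕ.^ toℕ i)))

  trace-cong : ∀ n {x y} → x ≈ y → trace n x ≈ trace n y
  trace-cong n eq = Σ⁺.sum-cong-≋ {n} λ i → ^-congˡ ((2 ℕ.^ m′) ℕ.^ toℕ i) eq

  trace-+ : ∀ n x y → trace n (x + y) ≈ trace n x + trace n y
  trace-+ zero    x y = sym (+-identityʳ 0#)
  trace-+ (suc n) x y = begin
    trace (suc n) (x + y)  ≈⟨ trace-suc n _ ⟩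
    x + y + trace n (τ (x + y))  ≈⟨ +-congˡ (trans (trace-cong n (frob-+ m′ x y)) (trace-+ n _ _)) ⟩
    x + y + (trace n (τ x) + trace n (τ y))  ≈⟨ solve 4 (λ x y t u → x :+ y :+ (t :+ u) := x :+ t :+ (y :+ u)) refl x y _ _ ⟩
    x + trace n (τ x) + (y + trace n (τ y))  ≈⟨ +-cong (trace-suc n x) (trace-suc n y) ⟨
    trace (suc n) x + trace (suc n) y  ∎

  trace-frob : ∀ n i x → trace n (frob i x) ≈ frob i (trace n x)
  trace-frob zero    i x = sym (frob-const-0 i)
  trace-frob (suc n) i x = begin
    trace (suc n) (frob i x)  ≈⟨ trace-suc n _ ⟩
    frob i x + trace n (τ (frob i x))  ≈⟨ +-congˡ (trans (trace-cong n (frob-comm m′ i x)) (trace-frob n i _)) ⟩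
    frob i x + frob i (trace n (τ x))  ≈⟨ frob-+ i _ _ ⟨
    frob i (x + trace n (τ x))  ≈⟨ frob-cong i (trace-suc n x) ⟨
    frob i (trace (suc n) x)  ∎

  trace-telescope : ∀ n x → trace n (τ x + x) ≈ frob (n ℕ.* m′) x + x
  trace-telescope zero    x = sym (trans (+-congʳ (frob-0 x)) (x+x≈0 x))
  trace-telescope (suc n) x = begin
    trace (suc n) (τ x + x)  ≈⟨ trace-suc n _ ⟩
    τ x + x + trace n (τ (τ x + x))  ≈⟨ +-congˡ (trans (trace-cong n (frob-+ m′ _ _)) (trace-telescope n (τ x))) ⟩
    τ x + x + (frob (n ℕ.* m′) (τ x) + τ x)  ≈⟨ solve 3 (λ t x f → t :+ x :+ (f :+ t) := f :+ x) refl _ x _ ⟩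
    frob (n ℕ.* m′) (τ x) + x  ≈⟨ +-congʳ (frob-∘ (n ℕ.* m′) m′ x) ⟩
    frob (m′ ℕ.+ n ℕ.* m′) x + x  ∎

  trace-1-even : ∀ {n} → Even n → trace n 1# ≈ 0#
  trace-1-even (zero , ≡.refl)  = refl
  trace-1-even (suc i , ≡.refl) = begin
    trace (suc (suc (i ℕ.* 2))) 1#  ≈⟨ trans (trace-suc (suc (i ℕ.* 2)) 1#) (+-congˡ (trans (trace-cong (suc (i ℕ.* 2)) (frob-const-1 m′)) (trans (trace-suc (i ℕ.* 2) 1#) (+-congˡ (trace-cong (i ℕ.* 2) (frob-const-1 m′)))))) ⟩
    1# + (1# + trace (i ℕ.* 2) 1#)  ≈⟨ solve 1 (λ t → :1 :+ (:1 :+ t) := t) refl _ ⟩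
    trace (i ℕ.* 2) 1#  ≈⟨ trace-1-even (i , ≡.refl) ⟩
    0#  ∎

  trace-1-odd : ∀ {n} → Odd n → trace n 1# ≈ 1#
  trace-1-odd (i , ≡.refl) = trans (trace-suc (i ℕ.* 2) 1#) (trans
    (+-congˡ (trans (trace-cong (i ℕ.* 2) (frob-const-1 m′)) (trace-1-even (i , ≡.refl)))) (+-identityʳ 1#))

  trace-τS+S : ∀ S → trace D (τ S + S) ≈ S ᶜ + S
  trace-τS+S S = trans (trace-telescope D S) (+-congʳ (reflexive (≡.cong (λ n → frob n S) (≡.sym k≡Dm))))

  module _ (ℓ ℓ′ : ℕ) (ℓ≡ℓ′m : ℓ ≡ ℓ′ ℕ.* m′) (ℓ′-odd : Odd ℓ′) (S : Carrier) where
    private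
      u : Carrier
      u = trace D S

      -- Of the 2D conjugates of `S` over 𝔽_{2^m} only D enter `u`, so after telescoping the two
      -- ends `S ᶜ` and `S` remain.
      τu+u : τ u + u ≈ S ᶜ + S
      τu+u = begin
        τ u + u  ≈⟨ +-congʳ (trace-frob D m′ S) ⟨
        trace D (τ S) + u  ≈⟨ trace-+ D _ _ ⟨
        trace D (τ S + S)  ≈⟨ trace-τS+S S ⟩
        S ᶜ + S  ∎

      frob-shift : τ u ≈ u + 1# → ∀ j → frob (j ℕ.* 2 ℕ.* m′) u ≈ u
      frob-shift τu≈ zero    = frob-0 u
      frob-shift τu≈ (suc j) = begin
        frob (m′ ℕ.+ (m′ ℕ.+ r)) u  ≈⟨ frob-∘ (m′ ℕ.+ r) m′ u ⟨
        frob (m′ ℕ.+ r) (τ u)  ≈⟨ frob-∘ r m′ _ ⟨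
        frob r (τ (τ u))  ≈⟨ frob-cong r (begin
          τ (τ u)  ≈⟨ frob-cong m′ τu≈ ⟩
          τ (u + 1#)  ≈⟨ frob-+ m′ u 1# ⟩
          τ u + τ 1#  ≈⟨ +-cong τu≈ (frob-const-1 m′) ⟩
          u + 1# + 1#  ≈⟨ solve 1 (λ u → u :+ :1 :+ :1 := u) refl u ⟩
          u  ∎) ⟩
        frob r u  ≈⟨ frob-shift τu≈ j ⟩
        u  ∎
        where r = j ℕ.* 2 ℕ.* m′

      trace-σS+S : trace D (frob ℓ S + S) ≈ frob ℓ u + u
      trace-σS+S = trans (trace-+ D _ _) (+-congʳ (trace-frob D ℓ S))

    trace-inert : S ᶜ ≈ S → trace D (frob ℓ S + S) ≈ 0#
    trace-inert Sᶜ≈S = trans trace-σS+S (≈⇒+≈0 (trans (reflexive (≡.cong (λ n → frob n u) ℓ≡ℓ′m))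
      (frob-fixed m′ u (+≈0⇒≈ (trans τu+u (≈⇒+≈0 Sᶜ≈S))) ℓ′)))

    -- Here `τ` adds 1 to `u`. As `frob ℓ` is an odd power of `τ`, it adds 1 as well, whereas in
    -- `trace-inert` both fix `u`.
    trace-split : S ᶜ ≈ S + 1# → trace D (frob ℓ S + S) ≈ 1#
    trace-split Sᶜ≈S+1 = trans trace-σS+S (begin
        frob ℓ u + u  ≡⟨ ≡.cong (λ n → frob n u + u) (≡.trans ℓ≡ℓ′m (≡.cong (ℕ._* m′) (proj₂ ℓ′-odd))) ⟩
        frob (m′ ℕ.+ h ℕ.* 2 ℕ.* m′) u + u  ≡⟨ ≡.cong (λ n → frob n u + u) (ℕ.+-comm m′ (h ℕ.* 2 ℕ.* m′)) ⟩
        frob (h ℕ.* 2 ℕ.* m′ ℕ.+ m′) u + u  ≈⟨ +-congʳ (frob-∘ m′ (h ℕ.* 2 ℕ.* m′) u) ⟨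
        τ (frob (h ℕ.* 2 ℕ.* m′) u) + u  ≈⟨ +-congʳ (frob-cong m′ (frob-shift τu≈ h)) ⟩
        τ u + u  ≈⟨ +-congʳ τu≈ ⟩
        u + 1# + u  ≈⟨ solve 1 (λ u → u :+ :1 :+ u := :1) refl u ⟩
        1#  ∎)
      where
      h = proj₁ ℓ′-odd
      τu≈ : τ u ≈ u + 1#
      τu≈ = combine₂ 1# 1# (solve 4 (λ t u s̄ s → t :+ (u :+ :1) := :1 :* (t :+ u :+ (s̄ :+ s)) :+ :1 :* (s̄ :+ (s :+ :1)))
        refl (τ u) u (S ᶜ) S) τu+u Sᶜ≈S+1

-- The four types of a root: inert or split, same or opposite.

module Diagonalisation {c c′} (F : Field c c′) (k : ℕ) (0<k : 0 ℕ.< k)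
                    (order : FieldTheory.HasOrder F ((2 ℕ.^ k) ℕ.^ 2))
                    (ℓ : ℕ) (a b d : Field.Carrier F)
                    (m′ D ℓ′ : ℕ) (k≡Dm : k ≡ D ℕ.* m′) (ℓ≡ℓ′m : ℓ ≡ ℓ′ ℕ.* m′) (ℓ′-odd : Odd ℓ′) where
  open Quadrinomial F k 0<k order ℓ a b d public
  open Iterates F k 0<k order m′ D k≡Dm public

  square≈1 : ∀ {t} → t * t ≈ 1# → t ≈ 1#
  square≈1 {t} tt≈1 = [ +≈0⇒≈ , +≈0⇒≈ ]′ (zero-product (trans
    (solve 1 (λ t → (t :+ :1) :* (t :+ :1) := t :* t :+ :1) refl t) (≈⇒+≈0 tt≈1)))

  kℓ′≡ℓD : ℓ′ ℕ.* k ≡ D ℕ.* ℓ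
  kℓ′≡ℓD = ≡.trans (≡.cong (ℓ′ ℕ.*_) k≡Dm) (≡.trans (≡.sym (ℕ.*-assoc ℓ′ D m′))
    (≡.trans (≡.cong (ℕ._* m′) (ℕ.*-comm ℓ′ D)) (≡.trans (ℕ.*-assoc D ℓ′ m′) (≡.cong (D ℕ.*_) (≡.sym ℓ≡ℓ′m)))))

  -- The exponent ℓ′ k = D ℓ is reached in two ways: ℓ′ conjugations, an odd number, invert `t`,
  -- while D applications of `σ`, an even number, fix it. Hence t² = 1. In `Q+1⊥q-1` the two roles
  -- are exchanged.
  Q+1⊥q+1 : Even D → ∀ t → t * t ᶜ ≈ 1# → t * σ t ≈ 1# → t ≈ 1#
  Q+1⊥q+1 D-even t ttᶜ≈1 tσt≈1 = square≈1 (begin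
    t * t  ≈⟨ *-congˡ (frob-even ℓ t tσt≈1 D-even) ⟨
    t * frob (D ℕ.* ℓ) t  ≡⟨ ≡.cong (λ n → t * frob n t) kℓ′≡ℓD ⟨
    t * frob (ℓ′ ℕ.* k) t  ≈⟨ frob-odd k t ttᶜ≈1 ℓ′-odd ⟩
    1#  ∎)

  Q+1⊥q-1 : Odd D → ∀ t → t ᶜ ≈ t → t * σ t ≈ 1# → t ≈ 1#
  Q+1⊥q-1 D-odd t tᶜ≈t tσt≈1 = square≈1 (begin
    t * t  ≈⟨ *-congˡ (frob-fixed k t tᶜ≈t ℓ′) ⟨
    t * frob (ℓ′ ℕ.* k) t  ≡⟨ ≡.cong (λ n → t * frob n t) kℓ′≡ℓD ⟩
    t * frob (D ℕ.* ℓ) t  ≈⟨ frob-odd ℓ t tσt≈1 D-odd ⟩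
    1#  ∎)

  -- Conjugation exchanges l x and l (x + e) up to scalars if x is inert, and preserves them if x is
  -- split.  The Frobenius twist of l x is proportional to m (x + e), its partner in ψ x, if x is
  -- Same, and to m x if x is Opposite.
  Inert Split Same Opposite : Carrier → Set c′
  Inert    x = x ᶜ ≈ x
  Split    x = x ᶜ ≈ x + e
  Same     x = e * σ x ≈ σ e * (x + n + e)
  Opposite x = e * σ x ≈ σ e * (x + n)

  -- Condition (2), multiplied by e.
  Balanced : Set c′
  Balanced = e * σ C̄ ≈ σ e * H

  σ-ᶜ : ∀ x → σ (x ᶜ) ≈ σ x ᶜ
  σ-ᶜ = frob-comm ℓ k

  -- The quadratic equation has coefficients in 𝔽_q, so `x ᶜ` is again one of its roots `x` and
  -- `x + e`.
  inert⊎split : ∀ {x} → Root x → Inert x ⊎ Split x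
  inert⊎split {x} root = Sum.map +≈0⇒≈ +≈0⇒≈ (zero-product (begin
    (x ᶜ + x) * (x ᶜ + (x + e))  ≈⟨ solve 3 (λ x x̄ e → (x̄ :+ x) :* (x̄ :+ (x :+ e)) := x̄ :* (x̄ :+ e) :+ x :* (x :+ e)) refl x (x ᶜ) e ⟩
    x ᶜ * (x ᶜ + e) + x * (x + e)  ≈⟨ ≈⇒+≈0 (begin
      x ᶜ * (x ᶜ + e)  ≈⟨ *-congˡ (+-congˡ eᶜ) ⟨
      x ᶜ * (x ᶜ + e ᶜ)  ≈⟨ *-congˡ (ᶜ-+ _ _) ⟨
      x ᶜ * (x + e) ᶜ  ≈⟨ ᶜ-* _ _ ⟨
      (x * (x + e)) ᶜ  ≈⟨ ᶜ-cong root ⟩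
      (C * C̄) ᶜ  ≈⟨ ᶜ-* _ _ ⟩
      C ᶜ * C̄ ᶜ  ≈⟨ *-cong Cᶜ C̄ᶜ ⟩
      C̄ * C  ≈⟨ *-comm _ _ ⟩
      C * C̄  ≈⟨ root ⟨
      x * (x + e)  ∎) ⟩
    0#  ∎))

  balanced-conjugate : Balanced → e * σ C ≈ σ e * H̄
  balanced-conjugate bal = begin
    e * σ C  ≈⟨ *-cong eᶜ (frob-cong ℓ C̄ᶜ) ⟨
    e ᶜ * σ (C̄ ᶜ)  ≈⟨ *-congˡ (σ-ᶜ C̄) ⟩
    e ᶜ * σ C̄ ᶜ  ≈⟨ ᶜ-* _ _ ⟨
    (e * σ C̄) ᶜ  ≈⟨ ᶜ-cong bal ⟩
    (σ e * H) ᶜ  ≈⟨ ᶜ-* _ _ ⟩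
    σ e ᶜ * H ᶜ  ≈⟨ *-cong (trans (sym (σ-ᶜ e)) (frob-cong ℓ eᶜ)) Hᶜ ⟩
    σ e * H̄  ∎

  -- Under (2) the element `e σ x / σ e` satisfies the quadratic equation of the second form, whose
  -- roots are `x + n` and `x + n + e` by `root-H`.
  opposite⊎same : Balanced → ∀ {x} → Root x → Opposite x ⊎ Same x
  opposite⊎same bal {x} root = Sum.map +≈0⇒≈ +≈0⇒≈ (zero-product (begin
    (e * σ x + σ e * (x + n)) * (e * σ x + σ e * (x + n + e))
      ≈⟨ solve 5 (λ e s f x n → (e :* s :+ f :* (x :+ n)) :* (e :* s :+ f :* (x :+ n :+ e))
           := e :* e :* (s :* (s :+ f)) :+ f :* f :* ((x :+ n) :* (x :+ n :+ e))) refl e (σ x) (σ e) x n ⟩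
    e * e * (σ x * (σ x + σ e)) + σ e * σ e * ((x + n) * (x + n + e))
      ≈⟨ ≈⇒+≈0 (begin
        e * e * (σ x * (σ x + σ e))  ≈⟨ *-congˡ (*-congˡ (frob-+ ℓ x e)) ⟨
        e * e * (σ x * σ (x + e))  ≈⟨ *-congˡ (frob-* ℓ _ _) ⟨
        e * e * σ (x * (x + e))  ≈⟨ *-congˡ (frob-cong ℓ root) ⟩
        e * e * σ (C * C̄)  ≈⟨ *-congˡ (frob-* ℓ _ _) ⟩
        e * e * (σ C * σ C̄)  ≈⟨ solve 3 (λ e x y → e :* e :* (x :* y) := (e :* x) :* (e :* y)) refl e _ _ ⟩
        (e * σ C) * (e * σ C̄)  ≈⟨ *-cong (balanced-conjugate bal) bal ⟩
        (σ e * H̄) * (σ e * H)  ≈⟨ solve 3 (λ f x y → (f :* x) :* (f :* y) := f :* f :* (y :* x)) refl (σ e) _ _ ⟩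
        σ e * σ e * (H * H̄)  ≈⟨ *-congˡ (root-H root) ⟨
        σ e * σ e * ((x + n) * (x + n + e))  ∎) ⟩
    0# ∎))

  conjugate-same : ∀ {x} → Same x → Same (x + e)
  conjugate-same {x} same = combine₁ 1# (begin
    e * σ (x + e) + σ e * (x + e + n + e)  ≈⟨ +-congʳ (*-congˡ (frob-+ ℓ x e)) ⟩
    e * (σ x + σ e) + σ e * (x + e + n + e)  ≈⟨ solve 5 (λ e s f x n → e :* (s :+ f) :+ f :* (x :+ e :+ n :+ e)
                                                   := :1 :* (e :* s :+ f :* (x :+ n :+ e))) refl e _ _ x n ⟩
    1# * (e * σ x + σ e * (x + n + e))  ∎) same

  conjugate-opposite : ∀ {x} → Opposite x → Opposite (x + e)
  conjugate-opposite {x} opp = combine₁ 1# (begin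
    e * σ (x + e) + σ e * (x + e + n)  ≈⟨ +-congʳ (*-congˡ (frob-+ ℓ x e)) ⟩
    e * (σ x + σ e) + σ e * (x + e + n)  ≈⟨ solve 5 (λ e s f x n → e :* (s :+ f) :+ f :* (x :+ e :+ n)
                                               := :1 :* (e :* s :+ f :* (x :+ n))) refl e _ _ x n ⟩
    1# * (e * σ x + σ e * (x + n))  ∎) opp

  conjugate-inert : ∀ {x} → Inert x → Inert (x + e)
  conjugate-inert inert = trans (ᶜ-+ _ _) (+-cong inert eᶜ)

  σ-l : ∀ x y → σ (l x y) ≈ σ C̄ * σ y ᶜ + σ x * σ y
  σ-l x y = trans (frob-+ ℓ _ _) (+-cong (trans (frob-* ℓ _ _) (*-congˡ (σ-ᶜ y))) (frob-* ℓ _ _))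

  m-same : Balanced → ∀ {x} → Same x → ∀ y → σ e * m (x + e) (σ y) ≈ e * σ (l x y)
  m-same bal {x} same y = sym (trans (*-congˡ (σ-l x y)) (combine₂ (σ y ᶜ) (σ y)
    (solve 9 (λ e f C̄ H x s n z z̄ →
        e :* (C̄ :* z̄ :+ s :* z) :+ f :* (H :* z̄ :+ (x :+ e :+ n) :* z)
     := z̄ :* (e :* C̄ :+ f :* H) :+ z :* (e :* s :+ f :* (x :+ n :+ e))) refl
       e (σ e) (σ C̄) H x (σ x) n (σ y) (σ y ᶜ)) bal same))

  m-opposite : Balanced → ∀ {x} → Opposite x → ∀ y → σ e * m x (σ y) ≈ e * σ (l x y)
  m-opposite bal {x} opp y = sym (trans (*-congˡ (σ-l x y)) (combine₂ (σ y ᶜ) (σ y)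
    (solve 9 (λ e f C̄ H x s n z z̄ →
        e :* (C̄ :* z̄ :+ s :* z) :+ f :* (H :* z̄ :+ (x :+ n) :* z)
     := z̄ :* (e :* C̄ :+ f :* H) :+ z :* (e :* s :+ f :* (x :+ n))) refl
       e (σ e) (σ C̄) H x (σ x) n (σ y) (σ y ᶜ)) bal opp))

  l-inert : ∀ {x} → Root x → Inert x → ∀ y → C̄ * l x y ᶜ ≈ x * l (x + e) y
  l-inert {x} root inert y = begin
    C̄ * l x y ᶜ  ≈⟨ *-congˡ (trans (ᶜ-+ _ _) (+-cong (trans (ᶜ-* _ _) (*-cong C̄ᶜ (ᶜᶜ y))) (trans (ᶜ-* _ _) (*-congʳ inert)))) ⟩
    C̄ * (C * y + x * y ᶜ)  ≈⟨ combine₁ y (solve 6 (λ x e C C̄ y ȳ →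
        C̄ :* (C :* y :+ x :* ȳ) :+ x :* (C̄ :* ȳ :+ (x :+ e) :* y) := y :* (x :* (x :+ e) :+ C :* C̄)) refl x e C C̄ y (y ᶜ)) root ⟩
    x * l (x + e) y  ∎

  l-split : ∀ {x} → Root x → Split x → ∀ y → C̄ * l x y ᶜ ≈ (x + e) * l x y
  l-split {x} root split y = begin
    C̄ * l x y ᶜ  ≈⟨ *-congˡ (trans (ᶜ-+ _ _) (+-cong (trans (ᶜ-* _ _) (*-cong C̄ᶜ (ᶜᶜ y))) (trans (ᶜ-* _ _) (*-congʳ split)))) ⟩
    C̄ * (C * y + (x + e) * y ᶜ)  ≈⟨ combine₁ y (solve 6 (λ x e C C̄ y ȳ →
        C̄ :* (C :* y :+ (x :+ e) :* ȳ) :+ (x :+ e) :* (C̄ :* ȳ :+ x :* y) := y :* (x :* (x :+ e) :+ C :* C̄)) refl x e C C̄ y (y ᶜ)) root ⟩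
    (x + e) * l x y  ∎

  conjugate-split : ∀ {x} → Split x → Split (x + e)
  conjugate-split split = trans (ᶜ-+ _ _) (+-cong split eᶜ)

  l-cong : ∀ {x x′} y → x ≈ x′ → l x y ≈ l x′ y
  l-cong y eq = +-congˡ (*-congʳ eq)

  quotient : ∀ R R′ → ¬ R′ ≈ 0# → ∃ λ t → R ≈ t * R′
  quotient R R′ R′≉0 = let i , iR′≈1 , _ = invertible R′ R′≉0 in R * i , (begin
    R  ≈⟨ *-identityʳ R ⟨
    R * 1#  ≈⟨ *-congˡ iR′≈1 ⟨
    R * (i * R′)  ≈⟨ *-assoc _ _ _ ⟨
    R * i * R′  ∎)

  same-side : Balanced → ∀ {x} → Same x → ∀ y y′ → e * e * (l x y * l (x + e) y′ * σ (l x y * l (x + e) y′)) ≈ σ e * σ e * (ψ x y * ψ (x + e) y′)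
  same-side bal {x} same y y′ = begin
    e * e * (l x y * l (x + e) y′ * σ (l x y * l (x + e) y′))  ≈⟨ *-congˡ (*-congˡ (frob-* ℓ _ _)) ⟩
    e * e * (l x y * l (x + e) y′ * (σ (l x y) * σ (l (x + e) y′)))  ≈⟨ solve 5 (λ e a b c d →
         e :* e :* (a :* b :* (c :* d)) := a :* b :* (e :* c :* (e :* d))) refl e _ _ _ _ ⟩
    l x y * l (x + e) y′ * (e * σ (l x y) * (e * σ (l (x + e) y′)))  ≈⟨ *-congˡ (*-cong (m-same bal same y) (m-same bal (conjugate-same same) y′)) ⟨
    l x y * l (x + e) y′ * (σ e * m (x + e) (σ y) * (σ e * m (x + e + e) (σ y′))) ≈⟨ solve 5 (λ e a b c d →
         a :* b :* (e :* c :* (e :* d)) := e :* e :* (a :* c :* (b :* d))) refl (σ e) _ _ _ _ ⟩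
    σ e * σ e * (ψ x y * ψ (x + e) y′)  ∎

  -- Substituting `x = e s` leaves `s² + s = C C̄ / e²`, whose right-hand side lies in 𝔽_q.
  root-exists : ¬ e ≈ 0# → ∃ Root
  root-exists e≉0 = e * s , (begin
    e * s * (e * s + e)  ≈⟨ solve 2 (λ e s → e :* s :* (e :* s :+ e) := e :* e :* (s :* s :+ s)) refl e s ⟩
    e * e * (s * s + s)  ≈⟨ *-congˡ (proj₂ solution) ⟩
    e * e * (C * C̄ * (i * i))  ≈⟨ solve 3 (λ e i c → e :* e :* (c :* (i :* i)) := (i :* e) :* (i :* e) :* c) refl e i _ ⟩
    (i * e) * (i * e) * (C * C̄)  ≈⟨ *-congʳ (*-cong ie≈1 ie≈1) ⟩
    1# * 1# * (C * C̄)  ≈⟨ solve 1 (λ c → :1 :* :1 :* c := c) refl _ ⟩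
    C * C̄  ∎)
    where
    i = proj₁ (invertible e e≉0)
    ie≈1 = proj₁ (proj₂ (invertible e e≉0))
    iᶜ : i ᶜ ≈ i
    iᶜ = *-cancelˡ e e≉0 (begin
      e * i ᶜ  ≈⟨ *-congʳ eᶜ ⟨
      e ᶜ * i ᶜ  ≈⟨ *-comm _ _ ⟩
      i ᶜ * e ᶜ  ≈⟨ ᶜ-* _ _ ⟨
      (i * e) ᶜ  ≈⟨ ᶜ-cong ie≈1 ⟩
      1# ᶜ  ≈⟨ frob-const-1 k ⟩
      1#  ≈⟨ ie≈1 ⟨
      i * e  ≈⟨ *-comm _ _ ⟩
      e * i  ∎)
    solution = artinSchreier (C * C̄ * (i * i)) (trans (ᶜ-* _ _) (*-cong
      (trans (ᶜ-* _ _) (trans (*-cong Cᶜ C̄ᶜ) (*-comm _ _))) (trans (ᶜ-* _ _) (*-cong iᶜ iᶜ))))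
    s = proj₁ solution

  module Diagonal (e≉0 : ¬ e ≈ 0#) (C̄≉0 : ¬ C̄ ≈ 0#) (H≉0 : ¬ H ≈ 0#) where

    C≉0 : ¬ C ≈ 0#
    C≉0 C≈0 = frob-≉0 k C̄≉0 (trans C̄ᶜ C≈0)

    eC̄H≉0 : ¬ e * C̄ * H ≈ 0#
    eC̄H≉0 = x*y≉0 (x*y≉0 e≉0 C̄≉0) H≉0

    l≈0⇒≈0 : ∀ x y → l x y ≈ 0# → l (x + e) y ≈ 0# → y ≈ 0#
    l≈0⇒≈0 x y p p′ = *-cancelˡ e e≉0 (begin
      e * y  ≈⟨ solve 4 (λ x e y u → e :* y := (u :+ x :* y) :+ (u :+ (x :+ e) :* y)) refl x e y (C̄ * y ᶜ) ⟩
      l x y + l (x + e) y  ≈⟨ +-cong p p′ ⟩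
      0# + 0#  ≈⟨ +-identityʳ 0# ⟩
      0#  ≈⟨ zeroʳ e ⟨
      e * 0#  ∎)

    root≉0 : ∀ {x} → Root x → ¬ x ≈ 0#
    root≉0 {x} root x≈0 = x*y≉0 C≉0 C̄≉0 (trans (sym root) (x≈0⇒xy≈0 x≈0))

    -- A split root has norm `x (x + e) = C C̄`, the norm of `C̄`, so `l x` is singular as an
    -- 𝔽_q-linear map.
    kernel-l : ∀ {x} → Root x → Split x → ∃ λ y → ¬ y ≈ 0# × l x y ≈ 0#
    kernel-l {x} root split =
      let y , y≉0 , eq = hilbert90 x C̄ (root≉0 root) (trans (*-congˡ split) (trans root (trans (*-comm _ _) (*-congˡ (sym C̄ᶜ))))) in
      y , y≉0 , ≈⇒+≈0 (sym eq)

    φ∥⇒cross : ∀ {x} → Root x → ∀ {y y′} → φ y ∥ φ y′ → ψ x y * ψ (x + e) y′ ≈ ψ x y′ * ψ (x + e) y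
    φ∥⇒cross {x} root {y} {y′} φ∥φ′ = +≈0⇒≈ (trans (ψ-det root y y′) (y≈0⇒xy≈0 (≈⇒+≈0 (begin
      φ y * φ̄ y′  ≈⟨ *-congˡ (φᶜ y′) ⟨
      φ y * φ y′ ᶜ  ≈⟨ φ∥φ′ ⟩
      φ y ᶜ * φ y′  ≈⟨ *-congʳ (φᶜ y) ⟩
      φ̄ y * φ y′  ∎))))

    cross⇒φ∥ : ∀ {x} → Root x → ∀ {y y′} → ψ x y * ψ (x + e) y′ ≈ ψ x y′ * ψ (x + e) y → φ y ∥ φ y′
    cross⇒φ∥ {x} root {y} {y′} eq = begin
      φ y * φ y′ ᶜ  ≈⟨ *-congˡ (φᶜ y′) ⟩
      φ y * φ̄ y′  ≈⟨ +≈0⇒≈ (*-cancelˡ (e * C̄ * H) eC̄H≉0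
                             (trans (sym (ψ-det root y y′)) (trans (≈⇒+≈0 eq) (sym (zeroʳ _))))) ⟩
      φ̄ y * φ y′  ≈⟨ *-congʳ (φᶜ y) ⟨
      φ y ᶜ * φ y′  ∎

    φ≈0⇒ψ≈0 : ∀ {x} → Root x → ∀ {y} → φ y ≈ 0# → ψ x y ≈ 0#
    φ≈0⇒ψ≈0 {x} root {y} φ≈0 = begin
      ψ x y  ≈⟨ diagonal root y ⟩
      ρ₁ x * φ y + ρ₂ x * φ̄ y  ≈⟨ +-cong (*-congˡ φ≈0) (*-congˡ (trans (sym (φᶜ y)) (frob-≈0 k φ≈0))) ⟩
      ρ₁ x * 0# + ρ₂ x * 0#  ≈⟨ solve 2 (λ r s → r :* :0 :+ s :* :0 := :0) refl _ _ ⟩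
      0#  ∎

    ψ≈0⇒φ≈0 : ∀ {x} → Root x → ∀ {y} → ψ x y ≈ 0# → ψ (x + e) y ≈ 0# → φ y ≈ 0#
    ψ≈0⇒φ≈0 {x} root {y} ψ≈0 ψ′≈0 = *-cancelˡ (e * C̄ * H) eC̄H≉0 (combine₂ (ρ₂ (x + e)) (ρ₂ x)
      (solve 8 (λ x e C̄ a b d̄ f f̄ →
           e :* C̄ :* (a :+ b :* d̄) :* f :+ e :* C̄ :* (a :+ b :* d̄) :* :0
        := (a :* (x :+ e) :+ b :* C̄) :* ((d̄ :* x :+ C̄) :* f :+ (a :* x :+ b :* C̄) :* f̄ :+ :0)
        :+ (a :* x :+ b :* C̄) :* ((d̄ :* (x :+ e) :+ C̄) :* f :+ (a :* (x :+ e) :+ b :* C̄) :* f̄ :+ :0))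
        refl x e C̄ a b (d ᶜ) (φ y) (φ̄ y))
      (trans (sym (diagonal root y)) ψ≈0) (trans (sym (diagonal (conjugate-root root) y)) ψ′≈0))

  module Ratio (x : Carrier) (y y′ : Carrier) where
    -- `R / R′` compares the values at `y` and `y′` of the projective coordinate `l x / l (x + e)`;
    -- products replace the quotient because these forms may vanish.
    R R′ : Carrier
    R  = l x y * l (x + e) y′
    R′ = l x y′ * l (x + e) y

    R≈R′⇒∥ : ¬ e * C̄ ≈ 0# → R ≈ R′ → y ∥ y′
    R≈R′⇒∥ eC̄≉0 eq = +≈0⇒≈ (*-cancelˡ (e * C̄) eC̄≉0 (trans (sym (l-det x y y′)) (trans (≈⇒+≈0 eq) (sym (zeroʳ _)))))

    ∥⇒R≈R′ : y ∥ y′ → R ≈ R′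
    ∥⇒R≈R′ y∥y′ = +≈0⇒≈ (trans (l-det x y y′) (y≈0⇒xy≈0 (≈⇒+≈0 y∥y′)))

    -- In the coordinate `l x / l (x + e)` the map is X^(Q+1) up to a constant, so equal images mean
    -- that `R` and `R′` have equal (Q+1)-th powers.
    same-cross : Balanced → ¬ e ≈ 0# → Same x → ψ x y * ψ (x + e) y′ ≈ ψ x y′ * ψ (x + e) y → R * σ R ≈ R′ * σ R′
    same-cross bal e≉0 same eq = *-cancelˡ (e * e) (x*y≉0 e≉0 e≉0) (begin
      e * e * (R * σ R)  ≈⟨ same-side bal same y y′ ⟩
      σ e * σ e * (ψ x y * ψ (x + e) y′)  ≈⟨ *-congˡ eq ⟩
      σ e * σ e * (ψ x y′ * ψ (x + e) y)  ≈⟨ same-side bal same y′ y ⟨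
      e * e * (R′ * σ R′)  ∎)

    same-cross⁻¹ : Balanced → ¬ e ≈ 0# → Same x → R * σ R ≈ R′ * σ R′ → ψ x y * ψ (x + e) y′ ≈ ψ x y′ * ψ (x + e) y
    same-cross⁻¹ bal e≉0 same eq = *-cancelˡ (σ e * σ e) (x*y≉0 (frob-≉0 ℓ e≉0) (frob-≉0 ℓ e≉0)) (begin
      σ e * σ e * (ψ x y * ψ (x + e) y′)  ≈⟨ same-side bal same y y′ ⟨
      e * e * (R * σ R)  ≈⟨ *-congˡ eq ⟩
      e * e * (R′ * σ R′)  ≈⟨ same-side bal same y′ y ⟩
      σ e * σ e * (ψ x y′ * ψ (x + e) y)  ∎)

    -- Now `ψ x` pairs `l x` with the twist of `l (x + e)`. The map is X^(1-Q) up to a constant, and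
    -- equal images mean that `σ` fixes `R / R′`.
    opposite-cross : Balanced → ¬ e ≈ 0# → Opposite x → ψ x y * ψ (x + e) y′ ≈ ψ x y′ * ψ (x + e) y → R * σ R′ ≈ R′ * σ R
    opposite-cross bal e≉0 opp eq = *-cancelˡ (e * e) (x*y≉0 e≉0 e≉0) (begin
      e * e * (R * σ R′)  ≈⟨ side y y′ ⟩
      σ e * σ e * (ψ x y * ψ (x + e) y′)  ≈⟨ *-congˡ eq ⟩
      σ e * σ e * (ψ x y′ * ψ (x + e) y)  ≈⟨ side y′ y ⟨
      e * e * (R′ * σ R)  ∎)
      where
      side : ∀ y y′ → e * e * (l x y * l (x + e) y′ * σ (l x y′ * l (x + e) y)) ≈ σ e * σ e * (ψ x y * ψ (x + e) y′)
      side y y′ = begin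
        e * e * (l x y * l (x + e) y′ * σ (l x y′ * l (x + e) y))  ≈⟨ *-congˡ (*-congˡ (frob-* ℓ _ _)) ⟩
        e * e * (l x y * l (x + e) y′ * (σ (l x y′) * σ (l (x + e) y)))  ≈⟨ *-congˡ (*-congˡ (*-congʳ (frob-cong ℓ (l-cong y′ e-fixed-+)))) ⟨
        e * e * (l x y * l (x + e) y′ * (σ (l (x + e + e) y′) * σ (l (x + e) y)))  ≈⟨ solve 5 (λ e a b c d →
             e :* e :* (a :* b :* (c :* d)) := a :* b :* (e :* d :* (e :* c))) refl e _ _ _ _ ⟩
        l x y * l (x + e) y′ * (e * σ (l (x + e) y) * (e * σ (l (x + e + e) y′)))  ≈⟨ *-congˡ (*-cong (m-opposite bal (conjugate-opposite opp) y) (m-opposite bal (conjugate-opposite (conjugate-opposite opp)) y′)) ⟨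
        l x y * l (x + e) y′ * (σ e * m (x + e) (σ y) * (σ e * m (x + e + e) (σ y′))) ≈⟨ solve 5 (λ e a b c d →
             a :* b :* (e :* c :* (e :* d)) := e :* e :* (a :* c :* (b :* d))) refl (σ e) _ _ _ _ ⟩
        σ e * σ e * (ψ x y * ψ (x + e) y′)  ∎

    module _ (root : Root x) (C̄≉0 : ¬ C̄ ≈ 0#) where
      -- Conjugation exchanges the two coordinates, so `R / R′` has norm 1. In `split-conj` it
      -- preserves them, and `R / R′` lies in 𝔽_q.
      inert-conj : Inert x → C̄ * R ᶜ ≈ C * R′
      inert-conj inert = *-cancelˡ C̄ C̄≉0 (begin
        C̄ * (C̄ * R ᶜ)  ≈⟨ *-congˡ (*-congˡ (ᶜ-* _ _)) ⟩
        C̄ * (C̄ * (l x y ᶜ * l (x + e) y′ ᶜ))  ≈⟨ solve 3 (λ c a b → c :* (c :* (a :* b)) := (c :* a) :* (c :* b)) refl C̄ _ _ ⟩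
        (C̄ * l x y ᶜ) * (C̄ * l (x + e) y′ ᶜ)  ≈⟨ *-cong (l-inert root inert y) (l-inert (conjugate-root root) (conjugate-inert inert) y′) ⟩
        (x * l (x + e) y) * ((x + e) * l (x + e + e) y′)  ≈⟨ *-congˡ (*-congˡ (l-cong y′ e-fixed-+)) ⟩
        (x * l (x + e) y) * ((x + e) * l x y′)  ≈⟨ solve 4 (λ x y a b → (x :* a) :* (y :* b) := (x :* y) :* (b :* a)) refl x (x + e) _ _ ⟩
        (x * (x + e)) * R′  ≈⟨ *-congʳ root ⟩
        (C * C̄) * R′  ≈⟨ solve 3 (λ x y z → x :* y :* z := y :* (x :* z)) refl C C̄ R′ ⟩
        C̄ * (C * R′)  ∎)

      split-conj : Split x → C̄ * R ᶜ ≈ C * R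
      split-conj split = *-cancelˡ C̄ C̄≉0 (begin
        C̄ * (C̄ * R ᶜ)  ≈⟨ *-congˡ (*-congˡ (ᶜ-* _ _)) ⟩
        C̄ * (C̄ * (l x y ᶜ * l (x + e) y′ ᶜ))  ≈⟨ solve 3 (λ c a b → c :* (c :* (a :* b)) := (c :* a) :* (c :* b)) refl C̄ _ _ ⟩
        (C̄ * l x y ᶜ) * (C̄ * l (x + e) y′ ᶜ)  ≈⟨ *-cong (l-split root split y) (l-split (conjugate-root root) (conjugate-split split) y′) ⟩
        ((x + e) * l x y) * ((x + e + e) * l (x + e) y′)  ≈⟨ *-congˡ (*-congʳ e-fixed-+) ⟩
        ((x + e) * l x y) * (x * l (x + e) y′)  ≈⟨ solve 4 (λ x y a b → (y :* a) :* (x :* b) := (x :* y) :* (a :* b)) refl x (x + e) _ _ ⟩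
        (x * (x + e)) * R  ≈⟨ *-congʳ root ⟩
        (C * C̄) * R  ≈⟨ solve 3 (λ x y z → x :* y :* z := y :* (x :* z)) refl C C̄ R ⟩
        C̄ * (C * R)  ∎)

  -- Sufficiency: projective injectivity from balance and the admissible types.

  module _ (Q-1⊥q+1 : ∀ t → t * t ᶜ ≈ 1# → σ t ≈ t → t ≈ 1#) where

    module _ {R R′ : Carrier} (R′≉0 : ¬ R′ ≈ 0#) where
      private
        t = proj₁ (quotient R R′ R′≉0)
        R≈tR′ = proj₂ (quotient R R′ R′≉0)

        conclude : t ≈ 1# → R ≈ R′
        conclude t≈1 = trans R≈tR′ (trans (*-congʳ t≈1) (*-identityˡ R′))

        frob≉0 : ∀ i → ¬ R′ * frob i R′ ≈ 0#
        frob≉0 i = x*y≉0 R′≉0 (frob-≉0 i R′≉0)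

        norm : ∀ i → R * frob i R ≈ R′ * frob i R′ → t * frob i t ≈ 1#
        norm i eq = *-cancelˡ (R′ * frob i R′) (frob≉0 i) (begin
          R′ * frob i R′ * (t * frob i t)  ≈⟨ solve 4 (λ a b c d → a :* b :* (c :* d) := c :* a :* (d :* b)) refl R′ (frob i R′) t (frob i t) ⟩
          t * R′ * (frob i t * frob i R′)  ≈⟨ *-congˡ (frob-* i _ _) ⟨
          t * R′ * frob i (t * R′)  ≈⟨ *-cong R≈tR′ (frob-cong i R≈tR′) ⟨
          R * frob i R  ≈⟨ eq ⟩
          R′ * frob i R′  ≈⟨ *-identityʳ _ ⟨
          R′ * frob i R′ * 1#  ∎)

        fixed : ∀ i → R * frob i R′ ≈ R′ * frob i R → frob i t ≈ t
        fixed i eq = *-cancelˡ (R′ * frob i R′) (frob≉0 i) (begin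
          R′ * frob i R′ * frob i t  ≈⟨ solve 3 (λ a b d → a :* b :* d := a :* (d :* b)) refl R′ (frob i R′) (frob i t) ⟩
          R′ * (frob i t * frob i R′)  ≈⟨ *-congˡ (frob-* i _ _) ⟨
          R′ * frob i (t * R′)  ≈⟨ *-congˡ (frob-cong i R≈tR′) ⟨
          R′ * frob i R  ≈⟨ eq ⟨
          R * frob i R′  ≈⟨ *-congʳ R≈tR′ ⟩
          t * R′ * frob i R′  ≈⟨ solve 3 (λ a b c → c :* a :* b := a :* b :* c) refl R′ (frob i R′) t ⟩
          R′ * frob i R′ * t  ∎)

      -- The quotient `t` of `R` by `R′` has norm 1 and is fixed by `σ`, so its order divides q + 1
      -- and Q - 1. The two companions below set Q + 1 against q + 1 and against q - 1, where the
      -- parity of D decides.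
      equal-opposite-inert : R * R ᶜ ≈ R′ * R′ ᶜ → R * σ R′ ≈ R′ * σ R → R ≈ R′
      equal-opposite-inert p p′ = conclude (Q-1⊥q+1 t (norm k p) (fixed ℓ p′))

      equal-same-inert : Even D → R * R ᶜ ≈ R′ * R′ ᶜ → R * σ R ≈ R′ * σ R′ → R ≈ R′
      equal-same-inert D-even p p′ = conclude (Q+1⊥q+1 D-even t (norm k p) (norm ℓ p′))

      equal-same-split : Odd D → R * R′ ᶜ ≈ R′ * R ᶜ → R * σ R ≈ R′ * σ R′ → R ≈ R′
      equal-same-split D-odd p p′ = conclude (Q+1⊥q-1 D-odd t (fixed k p) (norm ℓ p′))

    module _ (e≉0 : ¬ e ≈ 0#) (balanced : Balanced) where

      H≉0 : ¬ C̄ ≈ 0# → ¬ H ≈ 0#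
      H≉0 C̄≉0 H≈0 = x*y≉0 e≉0 (frob-≉0 ℓ C̄≉0) (trans balanced (y≈0⇒xy≈0 H≈0))

      module NonzeroC (C̄≉0 : ¬ C̄ ≈ 0#) {x : Carrier} (root : Root x) where

        open Diagonal e≉0 C̄≉0 (H≉0 C̄≉0)

        l-inert≈0 : Inert x → ∀ {y} → l x y ≈ 0# → l (x + e) y ≈ 0#
        l-inert≈0 inert {y} l≈0 = *-cancelˡ x (root≉0 root) (begin
          x * l (x + e) y  ≈⟨ l-inert root inert y ⟨
          C̄ * l x y ᶜ  ≈⟨ *-congˡ (ᶜ-cong l≈0) ⟩
          C̄ * 0# ᶜ  ≈⟨ *-congˡ (frob-const-0 k) ⟩
          C̄ * 0#  ≈⟨ zeroʳ C̄ ⟩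
          0#  ≈⟨ zeroʳ x ⟨
          x * 0#  ∎)

        l-inert≈0′ : Inert x → ∀ {y} → l (x + e) y ≈ 0# → l x y ≈ 0#
        l-inert≈0′ inert {y} l≈0 = *-cancelˡ (x + e) (root≉0 (conjugate-root root)) (begin
          (x + e) * l x y  ≈⟨ *-congˡ (l-cong y e-fixed-+) ⟨
          (x + e) * l (x + e + e) y  ≈⟨ l-inert (conjugate-root root) (conjugate-inert inert) y ⟨
          C̄ * l (x + e) y ᶜ  ≈⟨ *-congˡ (ᶜ-cong l≈0) ⟩
          C̄ * 0# ᶜ  ≈⟨ *-congˡ (frob-const-0 k) ⟩
          C̄ * 0#  ≈⟨ zeroʳ C̄ ⟩
          0#  ≈⟨ zeroʳ (x + e) ⟨
          (x + e) * 0#  ∎)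

        -- By conjugation the two coordinates vanish together, and together they determine `y`.
        l-inert≉0 : Inert x → ∀ {y} → ¬ y ≈ 0# → ¬ l x y ≈ 0# × ¬ l (x + e) y ≈ 0#
        l-inert≉0 inert y≉0 = (λ l≈0 → y≉0 (l≈0⇒≈0 x _ l≈0 (l-inert≈0 inert l≈0)))
                            , (λ l≈0 → y≉0 (l≈0⇒≈0 x _ (l-inert≈0′ inert l≈0) l≈0))

        m≈0⇒l≈0 : ∀ {x x′ y} → σ e * m x (σ y) ≈ e * σ (l x′ y) → m x (σ y) ≈ 0# → l x′ y ≈ 0#
        m≈0⇒l≈0 {x} {x′} {y} eq m≈0 = decidable-stable (l x′ y ≟ 0#) λ l≉0 →
          x*y≉0 e≉0 (frob-≉0 ℓ l≉0) (trans (sym eq) (y≈0⇒xy≈0 m≈0))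

        module _ (inert-same : Inert x → Same x → Even D) (split-same : Split x → Same x → Odd D)
                 (opposite-inert : Opposite x → Inert x) where

          -- The trace condition enters through the three implications assumed here. They leave
          -- three situations: opposite and inert; same and inert with D even; same and split with D
          -- odd.
          injective-nonzeroC : Projectively-injective
          injective-nonzeroC = record { nonzero = nonzero ; injective = injective }
            where
            nonzero : ∀ y → ¬ y ≈ 0# → ¬ φ y ≈ 0#
            nonzero y y≉0 φ≈0 = [ opposite-case , same-case ]′ (opposite⊎same balanced root)
              where
              -- In the same case the two factors of `ψ x` vanish together, and so do those of
              -- `ψ (x + e)`; a zero of `φ` therefore kills both coordinates of `y`.
              same-case : ¬ Same x
              same-case same = y≉0 (l≈0⇒≈0 x y (vanish root same) (vanish (conjugate-root root) (conjugate-same same)))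
                where
                vanish : ∀ {x} → Root x → Same x → l x y ≈ 0#
                vanish root same = [ (λ l≈0 → l≈0) , m≈0⇒l≈0 (m-same balanced same y) ]′ (zero-product (φ≈0⇒ψ≈0 root φ≈0))
              opposite-case : ¬ Opposite x
              opposite-case opposite = [ proj₁ l≉0 , proj₂ l≉0 ∘ m≈0⇒l≈0 (m-opposite balanced (conjugate-opposite opposite) y) ]′
                    (zero-product (φ≈0⇒ψ≈0 root φ≈0))
                where l≉0 = l-inert≉0 (opposite-inert opposite) y≉0

            injective : ∀ y y′ → ¬ y ≈ 0# → ¬ y′ ≈ 0# → φ y ∥ φ y′ → y ∥ y′
            injective y y′ y≉0 y′≉0 φ∥φ′ = R≈R′⇒∥ (x*y≉0 e≉0 C̄≉0) (equal (opposite⊎same balanced root) (inert⊎split root))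
              where
              open Ratio x y y′
              module Swap = Ratio x y′ y
              cross = φ∥⇒cross root φ∥φ′

              RRᶜ : Inert x → R * R ᶜ ≈ R′ * R′ ᶜ
              RRᶜ inert = *-cancelˡ C̄ C̄≉0 (begin
                C̄ * (R * R ᶜ)  ≈⟨ solve 3 (λ c r s → c :* (r :* s) := r :* (c :* s)) refl C̄ R (R ᶜ) ⟩
                R * (C̄ * R ᶜ)  ≈⟨ *-congˡ (inert-conj root C̄≉0 inert) ⟩
                R * (C * R′)  ≈⟨ solve 3 (λ c r s → r :* (c :* s) := s :* (c :* r)) refl C R R′ ⟩
                R′ * (C * R)  ≈⟨ *-congˡ (Swap.inert-conj root C̄≉0 inert) ⟨
                R′ * (C̄ * R′ ᶜ)  ≈⟨ solve 3 (λ c r s → c :* (r :* s) := r :* (c :* s)) refl C̄ R′ (R′ ᶜ) ⟨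
                C̄ * (R′ * R′ ᶜ)  ∎)

              RR′ᶜ : Split x → R * R′ ᶜ ≈ R′ * R ᶜ
              RR′ᶜ split = *-cancelˡ C̄ C̄≉0 (begin
                C̄ * (R * R′ ᶜ)  ≈⟨ solve 3 (λ c r s → c :* (r :* s) := r :* (c :* s)) refl C̄ R (R′ ᶜ) ⟩
                R * (C̄ * R′ ᶜ)  ≈⟨ *-congˡ (Swap.split-conj root C̄≉0 split) ⟩
                R * (C * R′)  ≈⟨ solve 3 (λ c r s → r :* (c :* s) := s :* (c :* r)) refl C R R′ ⟩
                R′ * (C * R)  ≈⟨ *-congˡ (split-conj root C̄≉0 split) ⟨
                R′ * (C̄ * R ᶜ)  ≈⟨ solve 3 (λ c r s → c :* (r :* s) := r :* (c :* s)) refl C̄ R′ (R ᶜ) ⟨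
                C̄ * (R′ * R ᶜ)  ∎)

              R′≉0 : Inert x → ¬ R′ ≈ 0#
              R′≉0 inert = x*y≉0 (proj₁ (l-inert≉0 inert y′≉0)) (proj₂ (l-inert≉0 inert y≉0))

              equal : Opposite x ⊎ Same x → Inert x ⊎ Split x → R ≈ R′
              equal (inj₁ opposite) _ = equal-opposite-inert (R′≉0 inert) (RRᶜ inert) (opposite-cross balanced e≉0 opposite cross)
                where inert = opposite-inert opposite
              equal (inj₂ same) (inj₁ inert) = equal-same-inert (R′≉0 inert) (inert-same inert same) (RRᶜ inert) (same-cross balanced e≉0 same cross)
              -- In the split case `R′` may vanish, but then `R` vanishes too by the equation
              -- between (Q+1)-th powers. Arguing by contradiction makes `R′` invertible.
              equal (inj₂ same) (inj₂ split) = decidable-stable (R ≟ R′) λ R≉R′ →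
                R≉R′ (equal-same-split (λ R′≈0 → R≉R′ (trans (R≈0 R′≈0) (sym R′≈0)))
                  (split-same split same) (RR′ᶜ split) (same-cross balanced e≉0 same cross))
                where
                R≈0 : R′ ≈ 0# → R ≈ 0#
                R≈0 R′≈0 = decidable-stable (R ≟ 0#) λ R≉0 → x*y≉0 R≉0 (frob-≉0 ℓ R≉0)
                  (trans (same-cross balanced e≉0 same cross) (x≈0⇒xy≈0 R′≈0))

      module ZeroC (C≈0 : C ≈ 0#) where

        C̄≈0 : C̄ ≈ 0#
        C̄≈0 = trans (sym Cᶜ) (frob-≈0 k C≈0)

        H≈0 : H ≈ 0#
        H≈0 = *-cancelˡ (σ e) (frob-≉0 ℓ e≉0) (trans (sym balanced) (trans
                (*-congˡ (frob-≈0 ℓ C̄≈0)) (trans (zeroʳ e) (sym (zeroʳ (σ e))))))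

        H̄≈0 : H̄ ≈ 0#
        H̄≈0 = trans (sym Hᶜ) (frob-≈0 k H≈0)

        -- Balance has removed `H` together with `C`, and `e * a` lies in the ideal generated by
        -- `H`, `C̄` and `C`. Only the terms 1 and `b` of the quadrinomial survive.
        a≈0 : a ≈ 0#
        a≈0 = *-cancelˡ e e≉0 (combine₃ (1# + a * a ᶜ) b (a * d ᶜ)
          (solve 6 (λ a ā b b̄ d d̄ → let open :Forms a ā b b̄ d d̄ in
             :e :* a :+ :e :* :0 := (:1 :+ a :* ā) :* (:H :+ :0) :+ b :* (:C̄ :+ :0) :+ a :* d̄ :* (:C :+ :0))
             refl a (a ᶜ) b (b ᶜ) d (d ᶜ)) H≈0 C̄≈0 C≈0)

        d≈0 : d ≈ 0#
        d≈0 = combine₂ b 1# (solve 3 (λ ā b d → d :+ :0 := b :* (ā :+ :0) :+ :1 :* ((d :+ ā :* b) :+ :0)) refl (a ᶜ) b d)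
          (frob-≈0 k a≈0) C≈0

        n≈0 : n ≈ 0#
        n≈0 = trans (+-cong (x≈0⇒xy≈0 a≈0) (x≈0⇒xy≈0 d≈0)) (+-identityʳ 0#)

        -- Up to the norm of `y` this is y^(Q-1). With `a` and `d` zero, `φ` is `ω + b ω̄`, a
        -- relation that `eω` and `eω̄` invert.
        ω ω̄ : Carrier → Carrier
        ω y = σ y * y ᶜ
        ω̄ y = σ y ᶜ * y

        eω : ∀ y → e * ω y ≈ φ y + b * φ̄ y
        eω y = combine₃ (σ y ᶜ * y ᶜ) (σ y * y) (σ y * y ᶜ)
          (solve 10 (λ a ā b b̄ d d̄ y ȳ z z̄ → let open :Forms a ā b b̄ d d̄ in
             :e :* (z :* ȳ) :+ (:B y ȳ z z̄ :+ b :* :B̄ y ȳ z z̄)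
             := z̄ :* ȳ :* (:H :+ :0) :+ z :* y :* (:C :+ :0) :+ z :* ȳ :* (:n :+ :0))
             refl a (a ᶜ) b (b ᶜ) d (d ᶜ) y (y ᶜ) (σ y) (σ y ᶜ)) H≈0 C≈0 n≈0

        eω̄ : ∀ y → e * ω̄ y ≈ φ̄ y + b ᶜ * φ y
        eω̄ y = combine₃ (σ y * y) (σ y ᶜ * y ᶜ) (σ y ᶜ * y)
          (solve 10 (λ a ā b b̄ d d̄ y ȳ z z̄ → let open :Forms a ā b b̄ d d̄ in
             :e :* (z̄ :* y) :+ (:B̄ y ȳ z z̄ :+ b̄ :* :B y ȳ z z̄)
             := z :* y :* (:H̄ :+ :0) :+ z̄ :* ȳ :* (:C̄ :+ :0) :+ z̄ :* y :* (:n :+ :0))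
             refl a (a ᶜ) b (b ᶜ) d (d ᶜ) y (y ᶜ) (σ y) (σ y ᶜ)) H̄≈0 C̄≈0 n≈0

        injective-zeroC : Projectively-injective
        injective-zeroC = record { nonzero = nonzero ; injective = injective }
          where
          nonzero : ∀ y → ¬ y ≈ 0# → ¬ φ y ≈ 0#
          nonzero y y≉0 φ≈0 = x*y≉0 e≉0 (x*y≉0 (frob-≉0 ℓ y≉0) (frob-≉0 k y≉0)) (begin
            e * ω y  ≈⟨ eω y ⟩
            φ y + b * φ̄ y  ≈⟨ +-cong φ≈0 (*-congˡ (trans (sym (φᶜ y)) (frob-≈0 k φ≈0))) ⟩
            0# + b * 0#  ≈⟨ solve 1 (λ b → :0 :+ b :* :0 := :0) refl b ⟩
            0#  ∎)

          injective : ∀ y y′ → ¬ y ≈ 0# → ¬ y′ ≈ 0# → φ y ∥ φ y′ → y ∥ y′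
          injective y y′ y≉0 y′≉0 φ∥φ′ = sym (trans (*-comm _ _)
            (equal-opposite-inert {y′ * y ᶜ} {y * y′ ᶜ} (x*y≉0 y≉0 (frob-≉0 k y′≉0))
              (begin
                y′ * y ᶜ * (y′ * y ᶜ) ᶜ  ≈⟨ *-congˡ (ᶜ-*ᶜ _ _) ⟩
                y′ * y ᶜ * (y′ ᶜ * y)  ≈⟨ solve 4 (λ y ȳ y′ ȳ′ → y′ :* ȳ :* (ȳ′ :* y) := y :* ȳ′ :* (ȳ :* y′)) refl y (y ᶜ) y′ (y′ ᶜ) ⟩
                y * y′ ᶜ * (y ᶜ * y′)  ≈⟨ *-congˡ (ᶜ-*ᶜ _ _) ⟨
                y * y′ ᶜ * (y * y′ ᶜ) ᶜ  ∎)
              (begin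
                y′ * y ᶜ * σ (y * y′ ᶜ)  ≈⟨ *-congˡ (trans (frob-* ℓ _ _) (*-congˡ (σ-ᶜ y′))) ⟩
                y′ * y ᶜ * (σ y * σ y′ ᶜ)  ≈⟨ solve 4 (λ y′ ȳ z z̄′ → y′ :* ȳ :* (z :* z̄′) := z :* ȳ :* (z̄′ :* y′)) refl y′ (y ᶜ) (σ y) (σ y′ ᶜ) ⟩
                ω y * ω̄ y′  ≈⟨ ωω̄ ⟩
                ω̄ y * ω y′  ≈⟨ solve 4 (λ y ȳ′ z′ z̄ → y :* ȳ′ :* (z′ :* z̄) := z̄ :* y :* (z′ :* ȳ′)) refl y (y′ ᶜ) (σ y′) (σ y ᶜ) ⟨
                y * y′ ᶜ * (σ y′ * σ y ᶜ)  ≈⟨ *-congˡ (trans (frob-* ℓ _ _) (*-congˡ (σ-ᶜ y))) ⟨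
                y * y′ ᶜ * σ (y′ * y ᶜ)  ∎)))
            where
            ωω̄ : ω y * ω̄ y′ ≈ ω̄ y * ω y′
            ωω̄ = *-cancelˡ (e * e) (x*y≉0 e≉0 e≉0) (begin
              e * e * (ω y * ω̄ y′)  ≈⟨ solve 3 (λ e x y → e :* e :* (x :* y) := (e :* x) :* (e :* y)) refl e _ _ ⟩
              (e * ω y) * (e * ω̄ y′)  ≈⟨ *-cong (eω y) (eω̄ y′) ⟩
              (φ y + b * φ̄ y) * (φ̄ y′ + b ᶜ * φ y′)  ≈⟨ combine₁ (1# + b * b ᶜ) (solve 6 (λ b b̄ f f̄ g ḡ →
                  (f :+ b :* f̄) :* (ḡ :+ b̄ :* g) :+ (f̄ :+ b̄ :* f) :* (g :+ b :* ḡ) := (:1 :+ b :* b̄) :* (f :* ḡ :+ f̄ :* g)) refl b (b ᶜ) _ _ _ _)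
                  (trans (*-congˡ (sym (φᶜ y′))) (trans φ∥φ′ (*-congʳ (φᶜ y)))) ⟩
              (φ̄ y + b ᶜ * φ y) * (φ y′ + b * φ̄ y′)  ≈⟨ *-cong (eω̄ y) (eω y′) ⟨
              (e * ω̄ y) * (e * ω y′)  ≈⟨ solve 3 (λ e x y → e :* e :* (x :* y) := (e :* x) :* (e :* y)) refl e _ _ ⟨
              e * e * (ω̄ y * ω y′)  ∎)

-- Necessity of (1).

module Nondegenerate {c c′} (F : Field c c′) (k : ℕ) (0<k : 0 ℕ.< k)
                    (order : FieldTheory.HasOrder F ((2 ℕ.^ k) ℕ.^ 2))
                    (ℓ : ℕ) (a b d : Field.Carrier F) where
  open Quadrinomial F k 0<k order ℓ a b d public

  -- Without its middle term the first quadratic form is a square in characteristic 2: with r² = C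
  -- it is the square of `r y + rᶜ yᶜ`, which vanishes at `y = rᶜ`.
  degenerate-vector : ∃ λ y → ¬ y ≈ 0# × C * (y * y) ≈ C̄ * (y ᶜ * y ᶜ)
  degenerate-vector = choose (r ≟ 0#)
    where
    r = proj₁ (frob-surjective 1 C)
    rr≈C : r * r ≈ C
    rr≈C = trans (*-congˡ (sym (*-identityʳ r))) (proj₂ (frob-surjective 1 C))
    choose : Dec (r ≈ 0#) → ∃ λ y → ¬ y ≈ 0# × C * (y * y) ≈ C̄ * (y ᶜ * y ᶜ)
    choose (no r≉0)  = r ᶜ , frob-≉0 k r≉0 , (begin
      C * (r ᶜ * r ᶜ)  ≈⟨ *-cong (sym rr≈C) (trans (sym (ᶜ-* r r)) (trans (ᶜ-cong rr≈C) Cᶜ)) ⟩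
      r * r * C̄  ≈⟨ *-comm _ _ ⟩
      C̄ * (r * r)  ≈⟨ *-congˡ (*-cong (ᶜᶜ r) (ᶜᶜ r)) ⟨
      C̄ * (r ᶜ ᶜ * r ᶜ ᶜ)  ∎)
    choose (yes r≈0) = 1# , 1≉0 , trans (x≈0⇒xy≈0 C≈0) (sym (x≈0⇒xy≈0 C̄≈0))
      where
      C≈0 : C ≈ 0#
      C≈0 = trans (sym rr≈C) (trans (*-congʳ r≈0) (zeroˡ r))
      C̄≈0 : C̄ ≈ 0#
      C̄≈0 = trans (sym Cᶜ) (frob-≈0 k C≈0)

  -- If `e` is zero, some `y` makes the map z ↦ B(y, z) singular. Take `z` in its kernel and write
  -- it as `σ y′`. The values of `φ` at `y` and `y′` are proportional, hence so are `y` and `y′`,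
  -- and then `σ y` and `z`; thus `σ y` is in the kernel as well and `φ y` is zero.
  e≉0 : Projectively-injective → ¬ e ≈ 0#
  e≉0 φ-injective e≈0 = nonzero y y≉0 (*-cancelˡ z z≉0 (begin
    z * φ y  ≈⟨ *-congˡ φ-PR ⟩
    z * (w * P + w ᶜ * R)  ≈⟨ combine₂ w R (solve 6 (λ z z̄ w w̄ P R →
        z :* (w :* P :+ w̄ :* R) :+ z :* :0 := w :* (P :* z :+ R :* z̄) :+ R :* (w :* z̄ :+ w̄ :* z))
        refl z (z ᶜ) w (w ᶜ) P R) Pz≈Rz̄ wz̄≈w̄z ⟩
    z * 0#  ∎))
    where
    open Projectively-injective φ-injective
    y = proj₁ degenerate-vector
    y≉0 = proj₁ (proj₂ degenerate-vector)
    w = σ y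
    P = y ᶜ + d * y
    R = b * y + a * y ᶜ
    P̄ = y + d ᶜ * y ᶜ
    R̄ = b ᶜ * y ᶜ + a ᶜ * y

    Pᶜ : P ᶜ ≈ P̄
    Pᶜ = trans (ᶜ-+ _ _) (+-cong (ᶜᶜ y) (ᶜ-* _ _))

    Rᶜ : R ᶜ ≈ R̄
    Rᶜ = trans (ᶜ-+ _ _) (+-cong (ᶜ-* _ _) (ᶜ-*ᶜ _ _))

    NP≈NR : P * P ᶜ ≈ R * R ᶜ
    NP≈NR = trans (*-congˡ Pᶜ) (trans (combine₂ 1# (y * y ᶜ)
      (solve 8 (λ a ā b b̄ d d̄ y ȳ → let open :Forms a ā b b̄ d d̄ in
        (ȳ :+ d :* y) :* (y :+ d̄ :* ȳ) :+ (b :* y :+ a :* ȳ) :* (b̄ :* ȳ :+ ā :* y)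
        := :1 :* (:C :* (y :* y) :+ :C̄ :* (ȳ :* ȳ)) :+ y :* ȳ :* (:e :+ :0)) refl a (a ᶜ) b (b ᶜ) d (d ᶜ) y (y ᶜ))
      (proj₂ (proj₂ degenerate-vector)) e≈0) (sym (*-congˡ Rᶜ)))

    φ-PR : φ y ≈ w * P + w ᶜ * R
    φ-PR = solve 7 (λ a b d y ȳ z z̄ →
      z :* ȳ :+ b :* z̄ :* y :+ a :* z̄ :* ȳ :+ d :* z :* y := z :* (ȳ :+ d :* y) :+ z̄ :* (b :* y :+ a :* ȳ))
      refl a b d y (y ᶜ) w (w ᶜ)

    P≉0 : ¬ P ≈ 0#
    P≉0 P≈0 = nonzero y y≉0 (begin
      φ y  ≈⟨ φ-PR ⟩
      w * P + w ᶜ * R  ≈⟨ +-cong (*-congˡ P≈0) (*-congˡ R≈0) ⟩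
      w * 0# + w ᶜ * 0#  ≈⟨ solve 2 (λ x y → x :* :0 :+ y :* :0 := :0) refl _ _ ⟩
      0#  ∎)
      where
      R≈0 : R ≈ 0#
      R≈0 = decidable-stable (R ≟ 0#) λ R≉0 → x*y≉0 R≉0 (frob-≉0 k R≉0)
        (trans (sym NP≈NR) (x≈0⇒xy≈0 P≈0))

    kernel = hilbert90 P R P≉0 NP≈NR
    z = proj₁ kernel
    z≉0 = proj₁ (proj₂ kernel)
    Pz≈Rz̄ = proj₂ (proj₂ kernel)
    y′ = proj₁ (frob-surjective ℓ z)
    σy′≈z : σ y′ ≈ z
    σy′≈z = proj₂ (frob-surjective ℓ z)
    y′≉0 : ¬ y′ ≈ 0#
    y′≉0 y′≈0 = z≉0 (trans (sym σy′≈z) (frob-≈0 ℓ y′≈0))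

    P̄z̄≈R̄z : P̄ * z ᶜ ≈ R̄ * z
    P̄z̄≈R̄z = begin
      P̄ * z ᶜ  ≈⟨ *-congʳ Pᶜ ⟨
      P ᶜ * z ᶜ  ≈⟨ ᶜ-* _ _ ⟨
      (P * z) ᶜ  ≈⟨ ᶜ-cong Pz≈Rz̄ ⟩
      (R * z ᶜ) ᶜ  ≈⟨ ᶜ-* _ _ ⟩
      R ᶜ * z ᶜ ᶜ  ≈⟨ *-cong Rᶜ (ᶜᶜ z) ⟩
      R̄ * z  ∎

    -- Write [s, t] for s tᶜ + sᶜ t. The identity is [B(y,w), B(y′,z)] + [B(y,z), B(y′,w)] = e
    -- [y,y′] [w,z], and both `e` and B(y,z) are zero.
    φ∥φ′ : φ y ∥ φ y′
    φ∥φ′ = begin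
      φ y * φ y′ ᶜ  ≈⟨ *-congˡ (trans (φᶜ y′) B̄-at) ⟩
      φ y * B̄ y′ (y′ ᶜ) z (z ᶜ)  ≈⟨ combine₃ ((y * y′ ᶜ + y ᶜ * y′) * (w * z ᶜ + w ᶜ * z)) (B̄ y′ (y′ ᶜ) w (w ᶜ)) (B y′ (y′ ᶜ) w (w ᶜ))
          (solve 14 (λ a ā b b̄ d d̄ y ȳ w w̄ y′ ȳ′ z z̄ → let open :Forms a ā b b̄ d d̄ in
             :B y ȳ w w̄ :* :B̄ y′ ȳ′ z z̄ :+ :B̄ y ȳ w w̄ :* :B y′ ȳ′ z z̄
             := (y :* ȳ′ :+ ȳ :* y′) :* (w :* z̄ :+ w̄ :* z) :* (:e :+ :0)
                :+ :B̄ y′ ȳ′ w w̄ :* ((ȳ :+ d :* y) :* z :+ (b :* y :+ a :* ȳ) :* z̄)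
                :+ :B y′ ȳ′ w w̄ :* ((y :+ d̄ :* ȳ) :* z̄ :+ (b̄ :* ȳ :+ ā :* y) :* z))
             refl a (a ᶜ) b (b ᶜ) d (d ᶜ) y (y ᶜ) w (w ᶜ) y′ (y′ ᶜ) z (z ᶜ)) e≈0 Pz≈Rz̄ P̄z̄≈R̄z ⟩
      φ̄ y * B y′ (y′ ᶜ) z (z ᶜ)  ≈⟨ *-cong (φᶜ y) B-at ⟨
      φ y ᶜ * φ y′  ∎
      where
      B-at : φ y′ ≈ B y′ (y′ ᶜ) z (z ᶜ)
      B-at = +-cong (+-cong (+-cong (*-congʳ σy′≈z) (*-congʳ (*-congˡ (ᶜ-cong σy′≈z)))) (*-congʳ (*-congˡ (ᶜ-cong σy′≈z))))
               (*-congʳ (*-congˡ σy′≈z))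
      B̄-at : φ̄ y′ ≈ B̄ y′ (y′ ᶜ) z (z ᶜ)
      B̄-at = +-cong (+-cong (+-cong (*-congʳ (ᶜ-cong σy′≈z)) (*-congʳ (*-congˡ σy′≈z))) (*-congʳ (*-congˡ σy′≈z)))
               (*-congʳ (*-congˡ (ᶜ-cong σy′≈z)))

    wz̄≈w̄z : w * z ᶜ ≈ w ᶜ * z
    wz̄≈w̄z = begin
      w * z ᶜ  ≈⟨ *-congˡ (trans (frob-comm ℓ k y′) (ᶜ-cong σy′≈z)) ⟨
      σ y * σ (y′ ᶜ)  ≈⟨ frob-* ℓ _ _ ⟨
      σ (y * y′ ᶜ)  ≈⟨ frob-cong ℓ (injective y y′ y≉0 y′≉0 φ∥φ′) ⟩
      σ (y ᶜ * y′)  ≈⟨ frob-* ℓ _ _ ⟩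
      σ (y ᶜ) * σ y′  ≈⟨ *-cong (frob-comm ℓ k y) σy′≈z ⟩
      w ᶜ * z  ∎

-- 2 is inverted by 2ᵏ⁻¹ + 1 modulo 2ᵏ + 1.
2^ℓ-unit : ∀ k ℓ → 0 ℕ.< k → ∃ λ x → suc (2 ℕ.^ k) ∣ suc (2 ℕ.^ ℓ ℕ.* x)
2^ℓ-unit (suc k) zero    _ = 2 ℕ.^ suc k , divides 1 ≡.refl
2^ℓ-unit (suc k) (suc ℓ) 0<k with 2^ℓ-unit (suc k) ℓ 0<k
... | x , divides c eq = x ℕ.* suc h , divides (c ℕ.+ L ℕ.* x) (begin
  suc (2 ℕ.* L ℕ.* (x ℕ.* suc h))  ≡⟨ lem₁ L x h ⟩
  suc (L ℕ.* x) ℕ.+ L ℕ.* x ℕ.* suc (2 ℕ.* h)  ≡⟨ ≡.cong (ℕ._+ L ℕ.* x ℕ.* suc (2 ℕ.* h)) eq ⟩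
  c ℕ.* suc (2 ℕ.* h) ℕ.+ L ℕ.* x ℕ.* suc (2 ℕ.* h)  ≡⟨ ℕ.*-distribʳ-+ (suc (2 ℕ.* h)) c _ ⟨
  (c ℕ.+ L ℕ.* x) ℕ.* suc (2 ℕ.* h)  ∎)
  where
  open ≡.≡-Reasoning
  L = 2 ℕ.^ ℓ
  h = 2 ℕ.^ k
  lem₁ : ∀ L x h → suc (2 ℕ.* L ℕ.* (x ℕ.* suc h)) ≡ suc (L ℕ.* x) ℕ.+ L ℕ.* x ℕ.* suc (2 ℕ.* h)
  lem₁ = ℕ-Solver.solve-∀

-- The power sum that excludes wrong pairings of conjugate factors.

module PowerSums {c c′} (F : Field c c′) (k : ℕ) (0<k : 0 ℕ.< k)
                 (order : FieldTheory.HasOrder F ((2 ℕ.^ k) ℕ.^ 2)) (ℓ : ℕ) (0<ℓ : 0 ℕ.< ℓ) where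
  open SquareOrder F k 0<k order

  private
    q Q p : ℕ
    q = 2 ℕ.^ k
    Q = 2 ℕ.^ ℓ
    p = q ∸ 1
    σ = frob ℓ

    1<q : 1 ℕ.< q
    1<q = ℕ.^-monoʳ-< 2 ℕ.≤-refl 0<k

    q≡1+p : q ≡ suc p
    q≡1+p = ≡.sym (ℕ.m+[n∸m]≡n (ℕ.<⇒≤ 1<q))

    0<p : 0 ℕ.< p
    0<p = ℕ.m<n⇒0<n∸m 1<q

    q²≡ : q ℕ.^ 2 ≡ suc (p ℕ.* suc q)
    q²≡ = ≡.subst (λ x → x ℕ.^ 2 ≡ suc (p ℕ.* suc x)) (≡.sym q≡1+p) (lem p)
      where
      lem : ∀ p → suc p ℕ.* (suc p ℕ.* 1) ≡ suc (p ℕ.* suc (suc p))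
      lem = ℕ-Solver.solve-∀

  x^[p*w]≈1 : ∀ {w} → suc q ∣ w → ∀ x → ¬ x ≈ 0# → x ^ (p ℕ.* w) ≈ 1#
  x^[p*w]≈1 {w} (divides j ≡.refl) x x≉0 = begin
    x ^ (p ℕ.* (j ℕ.* suc q))  ≡⟨ ≡.cong (x ^_) (≡.trans (≡.cong (p ℕ.*_) (ℕ.*-comm j (suc q))) (≡.sym (ℕ.*-assoc p (suc q) j))) ⟩
    x ^ (p ℕ.* suc q ℕ.* j)  ≈⟨ ^-assocʳ x (p ℕ.* suc q) j ⟨
    (x ^ (p ℕ.* suc q)) ^ j  ≡⟨ ≡.cong (λ n → (x ^ (n ∸ 1)) ^ j) q²≡ ⟨
    (x ^ (q ℕ.^ 2 ∸ 1)) ^ j  ≈⟨ ^-congˡ j (fermat-nonzero x x≉0) ⟩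
    1# ^ j  ≈⟨ 1^n≈1 j ⟩
    1#  ∎

  x^[p*δ]≉1 : ∀ δ → 0 ℕ.< δ → δ ℕ.≤ p → ∃ λ x → ¬ x ≈ 0# × ¬ x ^ (p ℕ.* δ) ≈ 1#
  x^[p*δ]≉1 δ 0<δ δ≤p = x^i≉1 (p ℕ.* δ) (ℕ.*-mono-≤ 0<p 0<δ)
    (≡.subst (suc (p ℕ.* δ) ℕ.<_) (≡.sym q²≡) (s≤s (ℕ.*-monoʳ-< p {{ℕ.>-nonZero 0<p}} (s≤s (ℕ.≤-trans δ≤p (ℕ.m∸n≤m q 1))))))

  -- With v = t^(q-1), `ψ t` is t^(Q+1) (α + β v^Q), so the i-th term of its (q-1)-th power contains
  -- v to the exponent 1 + Q + Q i.
  E : ℕ → ℕ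
  E i = p ℕ.* suc (Q ℕ.* suc i)

  -- Raising the index by `δ` multiplies by the Q-th power of `x ^ (p * δ)`, and Frobenius is
  -- injective.
  E-difference : ∀ i δ x → ¬ x ≈ 0# → x ^ E i ≈ 1# → x ^ E (i ℕ.+ δ) ≈ 1# → x ^ (p ℕ.* δ) ≈ 1#
  E-difference i δ x x≉0 eq eq′ = frob-injective ℓ (trans (*-cancelˡ (x ^ E i) (x^n≉0 (E i) x≉0) (begin
    x ^ E i * σ (x ^ (p ℕ.* δ))  ≈⟨ *-congˡ (^-assocʳ x (p ℕ.* δ) Q) ⟩
    x ^ E i * x ^ (p ℕ.* δ ℕ.* Q)  ≈⟨ ^-homo-* x (E i) (p ℕ.* δ ℕ.* Q) ⟨
    x ^ (E i ℕ.+ p ℕ.* δ ℕ.* Q)  ≡⟨ ≡.cong (x ^_) (lem p Q i δ) ⟨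
    x ^ E (i ℕ.+ δ)  ≈⟨ trans eq′ (sym eq) ⟩
    x ^ E i  ≈⟨ *-identityʳ _ ⟨
    x ^ E i * 1#  ∎)) (sym (frob-const-1 ℓ)))
    where
    lem : ∀ p Q i δ → p ℕ.* suc (Q ℕ.* suc (i ℕ.+ δ)) ≡ p ℕ.* suc (Q ℕ.* suc i) ℕ.+ p ℕ.* δ ℕ.* Q
    lem = ℕ-Solver.solve-∀

  -- Of the exponents E i occurring in ψ^(q-1), only E i₀ is divisible by q² - 1.
  surviving : ∃ λ (i : Fin (suc p)) → suc q ∣ suc (Q ℕ.* suc (toℕ i))
  surviving = index (x % suc q) ≡.refl
    where
    x = proj₁ (2^ℓ-unit k ℓ 0<k)
    index : ∀ r → r ≡ x % suc q → ∃ λ (i : Fin (suc p)) → suc q ∣ suc (Q ℕ.* suc (toℕ i))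
    index r r≡ = go r r<1+q Qr
      where
      r<1+q : r ℕ.< suc q
      r<1+q = ≡.subst (ℕ._< suc q) (≡.sym r≡) (m%n<n x (suc q))
      Qr : suc q ∣ suc (Q ℕ.* r)
      Qr = ∣m+n∣m⇒∣n (≡.subst (suc q ∣_) (≡.trans (≡.cong (λ y → suc (Q ℕ.* y)) (≡.trans (m≡m%n+[m/n]*n x (suc q)) (≡.cong (ℕ._+ (x div suc q) ℕ.* suc q) (≡.sym r≡)))) (lem Q r (x div suc q) (suc q)))
             (proj₂ (2^ℓ-unit k ℓ 0<k))) (n∣m*n (Q ℕ.* (x div suc q)))
        where
        lem : ∀ Q r y w → suc (Q ℕ.* (r ℕ.+ y ℕ.* w)) ≡ Q ℕ.* y ℕ.* w ℕ.+ suc (Q ℕ.* r)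
        lem = ℕ-Solver.solve-∀
      -- The residue is not zero because q + 1 does not divide 1, so it is the successor of an index
      -- below q.
      go : ∀ r → r ℕ.< suc q → suc q ∣ suc (Q ℕ.* r) → ∃ λ (i : Fin (suc p)) → suc q ∣ suc (Q ℕ.* suc (toℕ i))
      go zero    _           dvd = contradiction (∣⇒≤ dvd) (ℕ.<⇒≱ (s≤s (ℕ.≤-trans (ℕ.≤-reflexive (≡.cong suc (ℕ.*-zeroʳ Q))) (ℕ.<⇒≤ 1<q))))
      go (suc r) (s≤s r<q) dvd = fromℕ< r<1+p , ≡.subst (λ y → suc q ∣ suc (Q ℕ.* suc y)) (≡.sym (Fin.toℕ-fromℕ< r<1+p)) dvd
        where
        r<1+p : r ℕ.< suc p
        r<1+p = ≡.subst (r ℕ.<_) q≡1+p r<q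

  i₀ : Fin (suc p)
  i₀ = proj₁ surviving

  x^Ei₀≈1 : ∀ x → ¬ x ≈ 0# → x ^ E (toℕ i₀) ≈ 1#
  x^Ei₀≈1 = x^[p*w]≈1 (proj₂ surviving)

  -- If `E i` and `E i₀` both acted trivially, so would `p * δ` for the difference `δ` of the
  -- indices; but this exponent is positive and below q² - 1, so some `x` detects it.
  ∑-x^E : ∀ i → i ≢ i₀ → ∑ (_^ E (toℕ i)) ≈ 0#
  ∑-x^E i i≢i₀ = ∑-^≈0 (E (toℕ i)) (nontrivial (ℕ.<-cmp (toℕ i) (toℕ i₀)))
    where
    toℕ≤p : ∀ (i : Fin (suc p)) → toℕ i ℕ.≤ p
    toℕ≤p = Fin.toℕ≤pred[n]
    nontrivial : _ → ∃ λ x → ¬ x ≈ 0# × ¬ x ^ E (toℕ i) ≈ 1#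
    nontrivial (tri≈ _ eq _) = contradiction (Fin.toℕ-injective eq) i≢i₀
    nontrivial (tri< lt _ _) =
      let x , x≉0 , ne = x^[p*δ]≉1 (toℕ i₀ ∸ toℕ i) (ℕ.m<n⇒0<n∸m lt) (ℕ.≤-trans (ℕ.m∸n≤m (toℕ i₀) (toℕ i)) (toℕ≤p i₀)) in
      x , x≉0 , λ eq → ne (E-difference (toℕ i) _ x x≉0 eq
        (≡.subst (λ j → x ^ E j ≈ 1#) (≡.sym (ℕ.m+[n∸m]≡n (ℕ.<⇒≤ lt))) (x^Ei₀≈1 x x≉0)))
    nontrivial (tri> _ _ gt) =
      let x , x≉0 , ne = x^[p*δ]≉1 (toℕ i ∸ toℕ i₀) (ℕ.m<n⇒0<n∸m gt) (ℕ.≤-trans (ℕ.m∸n≤m (toℕ i) (toℕ i₀)) (toℕ≤p i)) in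
      x , x≉0 , λ eq → ne (E-difference (toℕ i₀) _ x x≉0 (x^Ei₀≈1 x x≉0)
        (≡.subst (λ j → x ^ E j ≈ 1#) (≡.sym (ℕ.m+[n∸m]≡n (ℕ.<⇒≤ gt))) eq))

  0<E : ∀ i → 0 ℕ.< E i
  0<E i = ℕ.*-mono-≤ 0<p (s≤s z≤n)

  ∑-x^Ei₀ : ∑ (_^ E (toℕ i₀)) ≈ 1#
  ∑-x^Ei₀ = sym (+≈0⇒≈ (∑-units (_^ E (toℕ i₀))
    (λ x x≈0 → trans (^-congˡ (E (toℕ i₀)) x≈0) (0^n≈0 (E (toℕ i₀)) (0<E _)))
    x^Ei₀≈1))

  geometric : ∀ n A B → (A + B) * Σ⁺.sum {n} (λ i → A ^ (n ∸ suc (toℕ i)) * B ^ toℕ i) ≈ A ^ n + B ^ n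
  geometric zero    A B = trans (zeroʳ _) (sym (x+x≈0 1#))
  geometric (suc n) A B = begin
    (A + B) * (A ^ n * 1# + Σ⁺.sum {n} (λ i → A ^ (n ∸ suc (toℕ i)) * (B * B ^ toℕ i)))
      ≈⟨ *-congˡ (+-congˡ (trans (Σ⁺.sum-cong-≋ {n} λ i → solve 3 (λ x y z → x :* (y :* z) := y :* (x :* z)) refl _ B _)
           (sym (Σ⁺.*-distribˡ-sum {n} B _)))) ⟩
    (A + B) * (A ^ n * 1# + B * G)  ≈⟨ solve 4 (λ A B X G → (A :+ B) :* (X :* :1 :+ B :* G) := A :* X :+ B :* X :+ B :* ((A :+ B) :* G)) refl A B (A ^ n) G ⟩
    A * A ^ n + B * A ^ n + B * ((A + B) * G)  ≈⟨ +-congˡ (*-congˡ (geometric n A B)) ⟩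
    A * A ^ n + B * A ^ n + B * (A ^ n + B ^ n)  ≈⟨ solve 4 (λ A B X Y → A :* X :+ B :* X :+ B :* (X :+ Y) := A :* X :+ B :* Y) refl A B _ _ ⟩
    A * A ^ n + B * B ^ n  ∎
    where G = Σ⁺.sum {n} (λ i → A ^ (n ∸ suc (toℕ i)) * B ^ toℕ i)

  -- The left side is (A^q + B^q) / (A + B), a geometric sum: every binomial coefficient of exponent
  -- q - 1 is odd.
  [A+B]^p : ∀ A B → ¬ A + B ≈ 0# → (A + B) ^ p ≈ Σ⁺.sum {suc p} (λ i → A ^ (p ∸ toℕ i) * B ^ toℕ i)
  [A+B]^p A B A+B≉0 = *-cancelˡ (A + B) A+B≉0 (begin
    (A + B) * (A + B) ^ p  ≈⟨ x*x^[q-1] (A + B) ⟩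
    (A + B) ᶜ  ≈⟨ ᶜ-+ A B ⟩
    A ᶜ + B ᶜ  ≈⟨ +-cong (x*x^[q-1] A) (x*x^[q-1] B) ⟨
    A ^ suc p + B ^ suc p  ≈⟨ geometric (suc p) A B ⟨
    (A + B) * Σ⁺.sum {suc p} (λ i → A ^ (p ∸ toℕ i) * B ^ toℕ i) ∎)

  module _ (α β : Carrier) (Nα≉Nβ : ¬ α * α ᶜ ≈ β * β ᶜ) where

    ψ : Carrier → Carrier
    ψ t = t * (α * σ t + β * σ t ᶜ)

    private
      infix 4 _∥_
      _∥_ : Carrier → Carrier → Set c′
      x ∥ y = x * y ᶜ ≈ x ᶜ * y

      v : Carrier → Carrier
      v t = t ^ p

      σ-tᶜ : ∀ t → σ t ᶜ ≈ σ t * σ (v t)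
      σ-tᶜ t = trans (frob-comm k ℓ t) (trans (frob-cong ℓ (sym (x*x^[q-1] t))) (frob-* ℓ t (v t)))

      M≉0 : ∀ t → ¬ t ≈ 0# → ¬ α * σ t + β * σ t ᶜ ≈ 0#
      M≉0 t t≉0 M≈0 = Nα≉Nβ (*-cancelˡ (σ t * σ t ᶜ) (x*y≉0 (frob-≉0 ℓ t≉0) (frob-≉0 k (frob-≉0 ℓ t≉0))) (begin
        σ t * σ t ᶜ * (α * α ᶜ)  ≈⟨ solve 4 (λ z z̄ a ā → z :* z̄ :* (a :* ā) := a :* z :* (ā :* z̄)) refl _ _ α _ ⟩
        α * σ t * (α ᶜ * σ t ᶜ)  ≈⟨ *-congˡ (ᶜ-* _ _) ⟨
        α * σ t * (α * σ t) ᶜ  ≈⟨ *-cong eq (ᶜ-cong eq) ⟩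
        β * σ t ᶜ * (β * σ t ᶜ) ᶜ  ≈⟨ *-congˡ (ᶜ-*ᶜ _ _) ⟩
        β * σ t ᶜ * (β ᶜ * σ t)  ≈⟨ solve 4 (λ z z̄ a ā → z :* z̄ :* (a :* ā) := a :* z̄ :* (ā :* z)) refl _ _ β _ ⟨
        σ t * σ t ᶜ * (β * β ᶜ)  ∎))
        where eq = +≈0⇒≈ M≈0

      ψ≉0 : ∀ t → ¬ t ≈ 0# → ¬ ψ t ≈ 0#
      ψ≉0 t t≉0 = x*y≉0 t≉0 (M≉0 t t≉0)

      factorised : ∀ t → ψ t ≈ t * σ t * (α + β * σ (v t))
      factorised t = trans (*-congˡ (+-congˡ (*-congˡ (σ-tᶜ t))))
        (solve 5 (λ t s a b u → t :* (a :* s :+ b :* (s :* u)) := t :* s :* (a :+ b :* u)) refl t (σ t) α β (σ (v t)))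

      coefficient : Fin (suc p) → Carrier
      coefficient i = α ^ (p ∸ toℕ i) * β ^ toℕ i

      ψ^p : ∀ t → ψ t ^ p ≈ Σ⁺.sum {suc p} (λ i → coefficient i * t ^ E (toℕ i))
      ψ^p t = by (t ≟ 0#)
        where
        monomial : ∀ i → v t * σ (v t) * (α ^ (p ∸ i) * (β * σ (v t)) ^ i) ≈ α ^ (p ∸ i) * β ^ i * t ^ E i
        monomial i = begin
          v t * σ (v t) * (α ^ (p ∸ i) * (β * σ (v t)) ^ i)  ≈⟨ *-congˡ (*-congˡ (^-distrib-* β _ i)) ⟩
          v t * σ (v t) * (α ^ (p ∸ i) * (β ^ i * σ (v t) ^ i))  ≈⟨ solve 5 (λ v u a b w → v :* u :* (a :* (b :* w)) := a :* b :* (v :* (u :* w))) refl _ _ _ _ _ ⟩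
          α ^ (p ∸ i) * β ^ i * (v t * σ (v t) ^ suc i)  ≈⟨ *-congˡ (*-congˡ (^-assocʳ (v t) Q (suc i))) ⟩
          α ^ (p ∸ i) * β ^ i * (v t ^ suc (Q ℕ.* suc i))  ≈⟨ *-congˡ (^-assocʳ t p (suc (Q ℕ.* suc i))) ⟩
          α ^ (p ∸ i) * β ^ i * t ^ E i  ∎
        by : Dec (t ≈ 0#) → _
        by (yes t≈0) = trans (trans (^-congˡ p (x≈0⇒xy≈0 t≈0)) (0^n≈0 p 0<p))
          (sym (trans (Σ⁺.sum-cong-≋ {suc p} λ i → trans (*-congˡ {coefficient i} (trans (^-congˡ (E (toℕ i)) t≈0) (0^n≈0 (E (toℕ i)) (0<E (toℕ i))))) (zeroʳ _))
            (Σ⁺.sum-replicate-zero (suc p))))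
        by (no t≉0) = begin
          ψ t ^ p  ≈⟨ ^-congˡ p (factorised t) ⟩
          (t * σ t * (α + β * σ (v t))) ^ p  ≈⟨ trans (^-distrib-* _ _ p) (*-congʳ (trans (^-distrib-* t _ p) (*-congˡ (^-comm t Q p)))) ⟩
          v t * σ (v t) * (α + β * σ (v t)) ^ p  ≈⟨ *-congˡ ([A+B]^p α (β * σ (v t)) λ eq → ψ≉0 t t≉0 (trans (factorised t) (y≈0⇒xy≈0 eq))) ⟩
          v t * σ (v t) * Σ⁺.sum {suc p} (λ i → α ^ (p ∸ toℕ i) * (β * σ (v t)) ^ toℕ i)  ≈⟨ Σ⁺.*-distribˡ-sum {suc p} _ (λ i → α ^ (p ∸ toℕ i) * (β * σ (v t)) ^ toℕ i) ⟩
          Σ⁺.sum {suc p} (λ i → v t * σ (v t) * (α ^ (p ∸ toℕ i) * (β * σ (v t)) ^ toℕ i)) ≈⟨ Σ⁺.sum-cong-≋ {suc p} (λ i → monomial (toℕ i)) ⟩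
          Σ⁺.sum {suc p} (λ i → coefficient i * t ^ E (toℕ i))  ∎

      ∑-ψ^p : ∑ (λ t → ψ t ^ p) ≈ coefficient i₀
      ∑-ψ^p = begin
        ∑ (λ t → ψ t ^ p)  ≈⟨ ∑-cong ψ^p ⟩
        ∑ (λ t → Σ⁺.sum {suc p} (λ i → coefficient i * t ^ E (toℕ i)))  ≈⟨ ∑-comm {suc p} (λ i t → coefficient i * t ^ E (toℕ i)) ⟩
        Σ⁺.sum {suc p} (λ i → ∑ (λ t → coefficient i * t ^ E (toℕ i)))  ≈⟨ Σ⁺.sum-cong-≋ {suc p} (λ i → ∑-scale (coefficient i) (_^ E (toℕ i))) ⟩
        Σ⁺.sum {suc p} term  ≈⟨ Σ⁺.sum-remove {i = i₀} term ⟩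
        term i₀ + Σ⁺.sum {p} (λ j → term (Fin.punchIn i₀ j))  ≈⟨ +-cong (trans (*-congˡ ∑-x^Ei₀) (*-identityʳ _))
              (trans (Σ⁺.sum-cong-≋ {p} λ j → y≈0⇒xy≈0 (∑-x^E _ (Fin.punchInᵢ≢i i₀ j))) (Σ⁺.sum-replicate-zero p)) ⟩
        coefficient i₀ + 0#  ≈⟨ +-identityʳ _ ⟩
        coefficient i₀  ∎
        where
        term : Fin (suc p) → Carrier
        term i = coefficient i * ∑ (_^ E (toℕ i))

    module _ (ψ-injective : ∀ t t′ → ¬ t ≈ 0# → ¬ t′ ≈ 0# → ψ t * ψ t′ ᶜ ≈ ψ t ᶜ * ψ t′ → t * t′ ᶜ ≈ t ᶜ * t′) where
      private
        -- The norm has degree 2 over 𝔽_q, so this power of it has degree Q. Scaling `t` by `s`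
        -- multiplies `h t` by `σ s`, hence its (p-1)-th power by the inverse of `σ s`, which
        -- cancels the surplus in `ψ`.
        h : Carrier → Carrier
        h t = frob (ℓ ∸ 1) (t * t ᶜ)

        -- ψ has degree Q + 1 over 𝔽_q; the norm factor makes Ψ homogeneous of degree 1.
        Ψ : Carrier → Carrier
        Ψ t = ψ t * h t ^ (p ∸ 1)

        h≉0 : ∀ {t} → ¬ t ≈ 0# → ¬ h t ≈ 0#
        h≉0 t≉0 = frob-≉0 (ℓ ∸ 1) (x*y≉0 t≉0 (frob-≉0 k t≉0))

        h-fixed : ∀ t → h t ᶜ ≈ h t
        h-fixed t = trans (frob-comm k (ℓ ∸ 1) _) (frob-cong (ℓ ∸ 1) (trans (ᶜ-* _ _) (trans (*-congˡ (ᶜᶜ t)) (*-comm _ _))))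

        fixed⇒x^p≈1 : ∀ {x} → ¬ x ≈ 0# → x ᶜ ≈ x → x ^ p ≈ 1#
        fixed⇒x^p≈1 {x} x≉0 fix = *-cancelˡ x x≉0 (trans (x*x^[q-1] x) (trans fix (sym (*-identityʳ x))))

        ^ᶜ : ∀ x i → (x ^ i) ᶜ ≈ x ᶜ ^ i
        ^ᶜ x i = ^-comm x i q

        Ψ^p : ∀ t → Ψ t ^ p ≈ ψ t ^ p
        Ψ^p t = by (t ≟ 0#)
          where
          by : Dec (t ≈ 0#) → Ψ t ^ p ≈ ψ t ^ p
          by (yes t≈0) = ^-congˡ p (trans (*-congʳ ψ≈0) (trans (zeroˡ _) (sym ψ≈0)))
            where
            ψ≈0 : ψ t ≈ 0#
            ψ≈0 = x≈0⇒xy≈0 t≈0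
          by (no t≉0)  = begin
            Ψ t ^ p  ≈⟨ ^-distrib-* _ _ p ⟩
            ψ t ^ p * (h t ^ (p ∸ 1)) ^ p  ≈⟨ *-congˡ (^-comm (h t) (p ∸ 1) p) ⟩
            ψ t ^ p * (h t ^ p) ^ (p ∸ 1)  ≈⟨ *-congˡ (trans (^-congˡ (p ∸ 1) (fixed⇒x^p≈1 (h≉0 t≉0) (h-fixed t))) (1^n≈1 (p ∸ 1))) ⟩
            ψ t ^ p * 1#  ≈⟨ *-identityʳ _ ⟩
            ψ t ^ p  ∎

        Ψ≉0 : ∀ {t} → ¬ t ≈ 0# → ¬ Ψ t ≈ 0#
        Ψ≉0 t≉0 = x*y≉0 (ψ≉0 _ t≉0) (x^n≉0 (p ∸ 1) (h≉0 t≉0))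

        Ψ0≈0 : ∀ {t} → t ≈ 0# → Ψ t ≈ 0#
        Ψ0≈0 t≈0 = x≈0⇒xy≈0 (x≈0⇒xy≈0 t≈0)

        Ψ∥⇒ψ∥ : ∀ {t t′} → ¬ t ≈ 0# → ¬ t′ ≈ 0# → Ψ t ≈ Ψ t′ → ψ t * ψ t′ ᶜ ≈ ψ t ᶜ * ψ t′
        Ψ∥⇒ψ∥ {t} {t′} t≉0 t′≉0 eq = *-cancelˡ (w * w′) (x*y≉0 (x^n≉0 (p ∸ 1) (h≉0 t≉0)) (x^n≉0 (p ∸ 1) (h≉0 t′≉0))) (begin
          w * w′ * (ψ t * ψ t′ ᶜ)  ≈⟨ solve 4 (λ a b x y → a :* b :* (x :* y) := x :* a :* (y :* b)) refl w w′ _ _ ⟩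
          Ψ t * (ψ t′ ᶜ * w′)  ≈⟨ *-congˡ (Ψᶜ t′) ⟨
          Ψ t * Ψ t′ ᶜ  ≈⟨ *-cong eq (ᶜ-cong (sym eq)) ⟩
          Ψ t′ * Ψ t ᶜ  ≈⟨ *-congˡ (Ψᶜ t) ⟩
          Ψ t′ * (ψ t ᶜ * w)  ≈⟨ solve 4 (λ a b x y → x :* b :* (y :* a) := a :* b :* (y :* x)) refl w w′ _ _ ⟩
          w * w′ * (ψ t ᶜ * ψ t′)  ∎)
          where
          w = h t ^ (p ∸ 1)
          w′ = h t′ ^ (p ∸ 1)
          Ψᶜ : ∀ t → Ψ t ᶜ ≈ ψ t ᶜ * h t ^ (p ∸ 1)
          Ψᶜ t = trans (ᶜ-* _ _) (*-congˡ (trans (^ᶜ (h t) (p ∸ 1)) (^-congˡ (p ∸ 1) (h-fixed t))))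

        Ψ-homogeneous : ∀ s t t′ → ¬ s ≈ 0# → s ᶜ ≈ s → t ≈ s * t′ → Ψ t ≈ s * Ψ t′
        Ψ-homogeneous s t t′ s≉0 sᶜ≈s t≈st′ = begin
          Ψ t  ≈⟨ *-cong ψ-scale (trans (^-congˡ (p ∸ 1) h-scale) (^-distrib-* _ _ (p ∸ 1))) ⟩
          s * σ s * ψ t′ * (σ s ^ (p ∸ 1) * h t′ ^ (p ∸ 1))  ≈⟨ solve 5 (λ s u x y z → s :* u :* x :* (y :* z) := u :* y :* (s :* (x :* z))) refl s (σ s) _ _ _ ⟩
          σ s * σ s ^ (p ∸ 1) * (s * Ψ t′)  ≈⟨ *-congʳ (trans (reflexive (≡.cong (σ s ^_) (ℕ.m+[n∸m]≡n 0<p))) (fixed⇒x^p≈1 (frob-≉0 ℓ s≉0) (trans (frob-comm k ℓ s) (frob-cong ℓ sᶜ≈s)))) ⟩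
          1# * (s * Ψ t′)  ≈⟨ *-identityˡ _ ⟩
          s * Ψ t′  ∎
          where
          σt≈ : σ t ≈ σ s * σ t′
          σt≈ = trans (frob-cong ℓ t≈st′) (frob-* ℓ s t′)
          σtᶜ≈ : σ t ᶜ ≈ σ s * σ t′ ᶜ
          σtᶜ≈ = trans (ᶜ-cong σt≈) (trans (ᶜ-* _ _) (*-congʳ (trans (frob-comm k ℓ s) (frob-cong ℓ sᶜ≈s))))
          ψ-scale : ψ t ≈ s * σ s * ψ t′
          ψ-scale = trans (*-cong t≈st′ (+-cong (*-congˡ σt≈) (*-congˡ σtᶜ≈)))
            (solve 7 (λ s t u a b z z̄ → s :* t :* (a :* (u :* z) :+ b :* (u :* z̄)) := s :* u :* (t :* (a :* z :+ b :* z̄))) refl s t′ (σ s) α β _ _)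
          h-scale : h t ≈ σ s * h t′
          h-scale = begin
            frob (ℓ ∸ 1) (t * t ᶜ)  ≈⟨ frob-cong (ℓ ∸ 1) (*-cong t≈st′ (trans (ᶜ-cong t≈st′) (trans (ᶜ-* _ _) (*-congʳ sᶜ≈s)))) ⟩
            frob (ℓ ∸ 1) (s * t′ * (s * t′ ᶜ))  ≈⟨ frob-cong (ℓ ∸ 1) (solve 3 (λ s t t̄ → s :* t :* (s :* t̄) := s :* s :* (t :* t̄)) refl s t′ _) ⟩
            frob (ℓ ∸ 1) (s * s * (t′ * t′ ᶜ))  ≈⟨ frob-* (ℓ ∸ 1) _ _ ⟩
            frob (ℓ ∸ 1) (s * s) * h t′  ≈⟨ *-congʳ (trans (frob-* (ℓ ∸ 1) s s) (sym (frob-suc (ℓ ∸ 1) s))) ⟩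
            frob (suc (ℓ ∸ 1)) s * h t′  ≡⟨ ≡.cong (λ j → frob j s * h t′) (ℕ.m+[n∸m]≡n 0<ℓ) ⟩
            σ s * h t′  ∎

        Ψ-injective : Injective _≈_ _≈_ Ψ
        Ψ-injective {t} {t′} eq = by (t ≟ 0#) (t′ ≟ 0#)
          where
          by : Dec (t ≈ 0#) → Dec (t′ ≈ 0#) → t ≈ t′
          by (yes t≈0) (yes t′≈0) = trans t≈0 (sym t′≈0)
          by (yes t≈0) (no t′≉0)  = contradiction (trans (sym eq) (Ψ0≈0 t≈0)) (Ψ≉0 t′≉0)
          by (no t≉0)  (yes t′≈0) = contradiction (trans eq (Ψ0≈0 t′≈0)) (Ψ≉0 t≉0)
          by (no t≉0)  (no t′≉0)  = trans t≈st′ (trans (*-congʳ s≈1) (*-identityˡ t′))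
            where
            inverse = invertible t′ t′≉0
            s = t * proj₁ inverse
            t≈st′ : t ≈ s * t′
            t≈st′ = sym (trans (*-assoc _ _ _) (trans (*-congˡ (proj₁ (proj₂ inverse))) (*-identityʳ t)))
            s≉0 : ¬ s ≈ 0#
            s≉0 s≈0 = t≉0 (trans t≈st′ (x≈0⇒xy≈0 s≈0))
            t∥t′ : t * t′ ᶜ ≈ t ᶜ * t′
            t∥t′ = ψ-injective t t′ t≉0 t′≉0 (Ψ∥⇒ψ∥ t≉0 t′≉0 eq)
            sᶜ≈s : s ᶜ ≈ s
            sᶜ≈s = *-cancelˡ (t′ * t′ ᶜ) (x*y≉0 t′≉0 (frob-≉0 k t′≉0)) (begin
              t′ * t′ ᶜ * s ᶜ  ≈⟨ solve 3 (λ t t̄ s → t :* t̄ :* s := s :* t̄ :* t) refl t′ _ _ ⟩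
              s ᶜ * t′ ᶜ * t′  ≈⟨ *-congʳ (trans (ᶜ-cong t≈st′) (ᶜ-* _ _)) ⟨
              t ᶜ * t′  ≈⟨ t∥t′ ⟨
              t * t′ ᶜ  ≈⟨ *-congʳ t≈st′ ⟩
              s * t′ * t′ ᶜ  ≈⟨ solve 3 (λ t t̄ s → s :* t :* t̄ := t :* t̄ :* s) refl t′ _ s ⟩
              t′ * t′ ᶜ * s  ∎)
            s≈1 : s ≈ 1#
            s≈1 = *-cancelˡ (Ψ t′) (Ψ≉0 t′≉0) (begin
              Ψ t′ * s  ≈⟨ *-comm _ _ ⟩
              s * Ψ t′  ≈⟨ Ψ-homogeneous s t t′ s≉0 sᶜ≈s t≈st′ ⟨
              Ψ t  ≈⟨ eq ⟩
              Ψ t′  ≈⟨ *-identityʳ _ ⟨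
              Ψ t′ * 1#  ∎)

        -- `Ψ` permutes the field and has the same (q-1)-th powers as `ψ`. The power sum of `ψ` is
        -- thus the sum of all t^(q-1), which is zero.
        coefficient≈0 : coefficient i₀ ≈ 0#
        coefficient≈0 = begin
          coefficient i₀  ≈⟨ ∑-ψ^p ⟨
          ∑ (λ t → ψ t ^ p)  ≈⟨ ∑-cong Ψ^p ⟨
          ∑ (λ t → Ψ t ^ p)  ≈⟨ ∑-permute (_^ p) Ψ (^-congˡ p) Ψ-injective ⟩
          ∑ (_^ p)  ≈⟨ ∑-^≈0 p (let x , x≉0 , ne = x^[p*δ]≉1 1 ℕ.≤-refl 0<p in
                                          x , x≉0 , ne ∘ trans (reflexive (≡.cong (x ^_) (ℕ.*-identityʳ p)))) ⟩
          0#  ∎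

      αβ≈0 : α * β ≈ 0#
      αβ≈0 = decidable-stable (α * β ≟ 0#) λ αβ≉0 →
        x*y≉0 (x^n≉0 (p ∸ toℕ i₀) λ α≈0 → αβ≉0 (x≈0⇒xy≈0 α≈0))
              (x^n≉0 (toℕ i₀) λ β≈0 → αβ≉0 (y≈0⇒xy≈0 β≈0)) coefficient≈0

-- Necessity of (2).

module Necessity {c c′} (F : Field c c′) (k : ℕ) (0<k : 0 ℕ.< k)
                    (order : FieldTheory.HasOrder F ((2 ℕ.^ k) ℕ.^ 2))
                    (ℓ : ℕ) (0<ℓ : 0 ℕ.< ℓ) (a b d : Field.Carrier F)
                    (m′ D ℓ′ : ℕ) (k≡Dm : k ≡ D ℕ.* m′) (ℓ≡ℓ′m : ℓ ≡ ℓ′ ℕ.* m′) (ℓ′-odd : Odd ℓ′) where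
  open Diagonalisation F k 0<k order ℓ a b d m′ D ℓ′ k≡Dm ℓ≡ℓ′m ℓ′-odd

  N : Carrier → Carrier
  N x = x * x ᶜ

  -- In the coordinate t = p y + r yᶜ the right-hand side is a multiple of t (u σ(t) + w σ(t)ᶜ),
  -- to which the power sum argument applies.
  module _ (φ-injective : Projectively-injective) (ρ ρ′ p r α β : Carrier)
           (Nρ≉Nρ′ : ¬ N ρ ≈ N ρ′) (Np≉Nr : ¬ N p ≈ N r) (Nα≉Nβ : ¬ N α ≈ N β)
           (factorisation : ∀ y → ρ * φ y + ρ′ * φ̄ y ≈ (p * y + r * y ᶜ) * (α * σ y + β * σ y ᶜ)) where
    private
      u w Δ : Carrier
      u = α * σ p ᶜ + β * σ r ᶜ
      w = α * σ r + β * σ p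
      Δ = N p + N r

      uᶜ : u ᶜ ≈ α ᶜ * σ p + β ᶜ * σ r
      uᶜ = trans (ᶜ-+ _ _) (+-cong (ᶜ-*ᶜ _ _) (ᶜ-*ᶜ _ _))

      wᶜ : w ᶜ ≈ α ᶜ * σ r ᶜ + β ᶜ * σ p ᶜ
      wᶜ = trans (ᶜ-+ _ _) (+-cong (ᶜ-* _ _) (ᶜ-* _ _))

      Δ≉0 : ¬ Δ ≈ 0#
      Δ≉0 = Np≉Nr ∘ +≈0⇒≈

      Δᶜ : Δ ᶜ ≈ Δ
      Δᶜ = trans (ᶜ-+ _ _) (+-cong (norm-fixed p) (norm-fixed r))

      σΔ : σ Δ ≈ σ p * σ p ᶜ + σ r * σ r ᶜ
      σΔ = trans (frob-+ ℓ _ _) (+-cong (trans (frob-* ℓ _ _) (*-congˡ (σ-ᶜ p))) (trans (frob-* ℓ _ _) (*-congˡ (σ-ᶜ r))))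

      -- Determinants multiply: `u` and `w` are the coefficients of the second factor composed with
      -- the twisted coordinate change, so `N u + N w` is `(N α + N β) σ Δ`.
      Nu≉Nw : ¬ N u ≈ N w
      Nu≉Nw eq = x*y≉0 (Nα≉Nβ ∘ +≈0⇒≈) (frob-≉0 ℓ Δ≉0) (begin
        (N α + N β) * σ Δ  ≈⟨ *-congˡ σΔ ⟩
        (N α + N β) * (σ p * σ p ᶜ + σ r * σ r ᶜ)  ≈⟨ solve 8 (λ α ᾱ β β̄ p p̄ r r̄ →
             (α :* ᾱ :+ β :* β̄) :* (p :* p̄ :+ r :* r̄)
          := (α :* p̄ :+ β :* r̄) :* (ᾱ :* p :+ β̄ :* r) :+ (α :* r :+ β :* p) :* (ᾱ :* r̄ :+ β̄ :* p̄))
             refl α (α ᶜ) β (β ᶜ) (σ p) (σ p ᶜ) (σ r) (σ r ᶜ) ⟩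
        u * (α ᶜ * σ p + β ᶜ * σ r) + w * (α ᶜ * σ r ᶜ + β ᶜ * σ p ᶜ)  ≈⟨ +-cong (*-congˡ uᶜ) (*-congˡ wᶜ) ⟨
        N u + N w  ≈⟨ ≈⇒+≈0 eq ⟩
        0#  ∎)

      -- The adjugate of `y ↦ p y + r yᶜ`, which inverts the coordinate change up to its determinant
      -- `Δ`.
      y-of : Carrier → Carrier
      y-of t = p ᶜ * t + r * t ᶜ

      y-ofᶜ : ∀ t → y-of t ᶜ ≈ p * t ᶜ + r ᶜ * t
      y-ofᶜ t = trans (ᶜ-+ _ _) (+-cong (trans (ᶜ-* _ _) (*-congʳ (ᶜᶜ p))) (ᶜ-*ᶜ _ _))

      λ-y-of : ∀ t → p * y-of t + r * y-of t ᶜ ≈ Δ * t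
      λ-y-of t = trans (+-congˡ (*-congˡ (y-ofᶜ t))) (solve 6 (λ p p̄ r r̄ t t̄ →
        p :* (p̄ :* t :+ r :* t̄) :+ r :* (p :* t̄ :+ r̄ :* t) := (p :* p̄ :+ r :* r̄) :* t) refl p (p ᶜ) r (r ᶜ) t (t ᶜ))

      σ-y-of : ∀ t → σ (y-of t) ≈ σ p ᶜ * σ t + σ r * σ t ᶜ
      σ-y-of t = trans (frob-+ ℓ _ _) (+-cong (trans (frob-* ℓ _ _) (*-congʳ (σ-ᶜ p))) (trans (frob-* ℓ _ _) (*-congˡ (σ-ᶜ t))))

      μ-y-of : ∀ t → α * σ (y-of t) + β * σ (y-of t) ᶜ ≈ u * σ t + w * σ t ᶜ
      μ-y-of t = trans (+-cong (*-congˡ (σ-y-of t)) (*-congˡ (trans (ᶜ-cong (σ-y-of t)) (trans (ᶜ-+ _ _)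
          (+-cong (trans (ᶜ-* _ _) (*-congʳ (ᶜᶜ _))) (ᶜ-*ᶜ _ _))))))
        (solve 8 (λ α β p p̄ r r̄ t t̄ → α :* (p̄ :* t :+ r :* t̄) :+ β :* (p :* t̄ :+ r̄ :* t)
          := (α :* p̄ :+ β :* r̄) :* t :+ (α :* r :+ β :* p) :* t̄) refl α β (σ p) (σ p ᶜ) (σ r) (σ r ᶜ) (σ t) (σ t ᶜ))

      G : Carrier → Carrier
      G y = ρ * φ y + ρ′ * φ̄ y

      Gᶜ : ∀ y → G y ᶜ ≈ ρ ᶜ * φ̄ y + ρ′ ᶜ * φ y
      Gᶜ y = trans (ᶜ-+ _ _) (+-cong (trans (ᶜ-* _ _) (*-congˡ (φᶜ y)))
        (trans (ᶜ-* _ _) (*-congˡ (trans (ᶜ-cong (sym (φᶜ y))) (ᶜᶜ _)))))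

      G∥⇒φ∥ : ∀ y y′ → G y ∥ G y′ → φ y ∥ φ y′
      G∥⇒φ∥ y y′ eq = trans (*-congˡ (φᶜ y′)) (trans (+≈0⇒≈ (*-cancelˡ (N ρ + N ρ′) (Nρ≉Nρ′ ∘ +≈0⇒≈) (begin
        (N ρ + N ρ′) * (φ y * φ̄ y′ + φ̄ y * φ y′)  ≈⟨ solve 8 (λ r r̄ s s̄ f f̄ g ḡ →
             (r :* r̄ :+ s :* s̄) :* (f :* ḡ :+ f̄ :* g)
          := (r :* f :+ s :* f̄) :* (r̄ :* ḡ :+ s̄ :* g) :+ (r̄ :* f̄ :+ s̄ :* f) :* (r :* g :+ s :* ḡ))
             refl ρ (ρ ᶜ) ρ′ (ρ′ ᶜ) _ _ _ _ ⟩
        G y * (ρ ᶜ * φ̄ y′ + ρ′ ᶜ * φ y′) + (ρ ᶜ * φ̄ y + ρ′ ᶜ * φ y) * G y′  ≈⟨ +-cong (*-congˡ (Gᶜ y′)) (*-congʳ (Gᶜ y)) ⟨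
        G y * G y′ ᶜ + G y ᶜ * G y′  ≈⟨ ≈⇒+≈0 eq ⟩
        0#  ≈⟨ zeroʳ _ ⟨
        (N ρ + N ρ′) * 0#  ∎))) (*-congʳ (sym (φᶜ y))))

      ψ′ : Carrier → Carrier
      ψ′ t = t * (u * σ t + w * σ t ᶜ)

      G-y-of : ∀ t → G (y-of t) ≈ Δ * ψ′ t
      G-y-of t = trans (factorisation (y-of t)) (trans (*-cong (λ-y-of t) (μ-y-of t)) (*-assoc _ _ _))

      y-of≉0 : ∀ t → ¬ t ≈ 0# → ¬ y-of t ≈ 0#
      y-of≉0 t t≉0 y≈0 = x*y≉0 Δ≉0 t≉0 (trans (sym (λ-y-of t))
        (trans (+-cong (*-congˡ y≈0) (*-congˡ (frob-≈0 k y≈0)))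
          (solve 2 (λ p r → p :* :0 :+ r :* :0 := :0) refl p r)))

      scale-∥ : ∀ x y → x ∥ y → Δ * x ∥ Δ * y
      scale-∥ x y eq = begin
        Δ * x * (Δ * y) ᶜ  ≈⟨ *-congˡ (trans (ᶜ-* _ _) (*-congʳ Δᶜ)) ⟩
        Δ * x * (Δ * y ᶜ)  ≈⟨ combine₁ (Δ * Δ) (solve 5 (λ Δ x x̄ y ȳ → Δ :* x :* (Δ :* ȳ) :+ Δ :* x̄ :* (Δ :* y)
                                    := Δ :* Δ :* (x :* ȳ :+ x̄ :* y)) refl Δ x _ y _) eq ⟩
        Δ * x ᶜ * (Δ * y)  ≈⟨ *-congʳ (trans (ᶜ-* _ _) (*-congʳ Δᶜ)) ⟨
        (Δ * x) ᶜ * (Δ * y)  ∎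

      unscale-∥ : ∀ x y → Δ * x ∥ Δ * y → x ∥ y
      unscale-∥ x y eq = *-cancelˡ (Δ * Δ) (x*y≉0 Δ≉0 Δ≉0) (begin
        Δ * Δ * (x * y ᶜ)  ≈⟨ solve 3 (λ Δ x y → Δ :* Δ :* (x :* y) := Δ :* x :* (Δ :* y)) refl Δ _ _ ⟩
        Δ * x * (Δ * y ᶜ)  ≈⟨ *-congˡ (trans (ᶜ-* _ _) (*-congʳ Δᶜ)) ⟨
        Δ * x * (Δ * y) ᶜ  ≈⟨ eq ⟩
        (Δ * x) ᶜ * (Δ * y)  ≈⟨ *-congʳ (trans (ᶜ-* _ _) (*-congʳ Δᶜ)) ⟩
        Δ * x ᶜ * (Δ * y)  ≈⟨ solve 3 (λ Δ x y → Δ :* Δ :* (x :* y) := Δ :* x :* (Δ :* y)) refl Δ _ _ ⟨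
        Δ * Δ * (x ᶜ * y)  ∎)

      λ-∥ : ∀ y y′ → y ∥ y′ → (p * y + r * y ᶜ) ∥ (p * y′ + r * y′ ᶜ)
      λ-∥ y y′ eq = begin
        (p * y + r * y ᶜ) * (p * y′ + r * y′ ᶜ) ᶜ  ≈⟨ *-congˡ (conj y′) ⟩
        (p * y + r * y ᶜ) * (p ᶜ * y′ ᶜ + r ᶜ * y′)  ≈⟨ combine₁ (p * p ᶜ + r * r ᶜ) (solve 8 (λ p p̄ r r̄ y ȳ z z̄ →
             (p :* y :+ r :* ȳ) :* (p̄ :* z̄ :+ r̄ :* z) :+ (p̄ :* ȳ :+ r̄ :* y) :* (p :* z :+ r :* z̄)
          := (p :* p̄ :+ r :* r̄) :* (y :* z̄ :+ ȳ :* z)) refl p _ r _ y _ y′ _) eq ⟩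
        (p ᶜ * y ᶜ + r ᶜ * y) * (p * y′ + r * y′ ᶜ)  ≈⟨ *-congʳ (conj y) ⟨
        (p * y + r * y ᶜ) ᶜ * (p * y′ + r * y′ ᶜ)  ∎
        where
        conj : ∀ y → (p * y + r * y ᶜ) ᶜ ≈ p ᶜ * y ᶜ + r ᶜ * y
        conj y = trans (ᶜ-+ _ _) (+-cong (ᶜ-* _ _) (ᶜ-*ᶜ _ _))

      ∥-cong : ∀ {x x′ y y′} → x ≈ x′ → y ≈ y′ → x ∥ y → x′ ∥ y′
      ∥-cong p q eq = trans (*-cong (sym p) (ᶜ-cong (sym q))) (trans eq (*-cong (ᶜ-cong p) q))

      ψ′-injective : ∀ t t′ → ¬ t ≈ 0# → ¬ t′ ≈ 0# → ψ′ t ∥ ψ′ t′ → t ∥ t′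
      ψ′-injective t t′ t≉0 t′≉0 eq = unscale-∥ t t′ (∥-cong (λ-y-of t) (λ-y-of t′) (λ-∥ _ _
        (Projectively-injective.injective φ-injective (y-of t) (y-of t′) (y-of≉0 t t≉0) (y-of≉0 t′ t′≉0)
          (G∥⇒φ∥ _ _ (∥-cong (sym (G-y-of t)) (sym (G-y-of t′)) (scale-∥ _ _ eq))))))

    -- This is `u * w`. Its vanishing says that in the coordinate `t` the second factor is a
    -- multiple of `σ t` or of its conjugate.
    resonance : (α * σ p ᶜ + β * σ r ᶜ) * (α * σ r + β * σ p) ≈ 0#
    resonance = PowerSums.αβ≈0 F k 0<k order ℓ 0<ℓ u w Nu≉Nw ψ′-injective

  module _ (φ-injective : Projectively-injective) (e≉0 : ¬ e ≈ 0#) where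
    open Projectively-injective φ-injective

    private
      1+Nb : Carrier
      1+Nb = 1# + b * b ᶜ

      N1≉Nb : ¬ 1+Nb ≈ 0# → ¬ N 1# ≈ N b
      N1≉Nb ≉0 eq = ≉0 (≈⇒+≈0 (trans (trans (sym (*-identityˡ 1#)) (*-congˡ (sym (frob-const-1 k)))) eq))

      C̄≈0 : C ≈ 0# → C̄ ≈ 0#
      C̄≈0 C≈0 = trans (sym Cᶜ) (frob-≈0 k C≈0)

      H̄≈0 : H ≈ 0# → H̄ ≈ 0#
      H̄≈0 H≈0 = trans (sym Hᶜ) (frob-≈0 k H≈0)

      *1+Nb≉0 : ∀ {f} → e ≈ 1+Nb * f → ¬ 1+Nb ≈ 0# × ¬ f ≈ 0#
      *1+Nb≉0 e≈ = (λ eq → e≉0 (trans e≈ (x≈0⇒xy≈0 eq)))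
                 , (λ eq → e≉0 (trans e≈ (y≈0⇒xy≈0 eq)))

    -- The diagonalising change of basis is singular here, but `φ + b φ̄` is already a multiple of
    -- `y ᶜ` times a form in `σ y`. In `resonance` the factor `w` is then nonzero, and `u` is `a`
    -- times a nonzero element.
    C≈0⇒a≈0 : C ≈ 0# → a ≈ 0#
    C≈0⇒a≈0 C≈0 = [ u-case , w-case ]′ (zero-product
        (resonance φ-injective 1# b 0# 1+Nb 1# a (N1≉Nb 1+Nb≉0) N0≉Nr N1≉Na factorisation))
      where
      e≈ : e ≈ 1+Nb * (1# + a * a ᶜ)
      e≈ = combine₂ (d ᶜ) (a ᶜ * b) (solve 6 (λ a ā b b̄ d d̄ → let open :Forms a ā b b̄ d d̄ in
        :e :+ (:1 :+ b :* b̄) :* (:1 :+ a :* ā) := d̄ :* (:C :+ :0) :+ ā :* b :* (:C̄ :+ :0))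
        refl a _ b _ d _) C≈0 (C̄≈0 C≈0)
      1+Nb≉0 = proj₁ (*1+Nb≉0 e≈)
      N0≉Nr : ¬ N 0# ≈ N 1+Nb
      N0≉Nr eq = x*y≉0 1+Nb≉0 (frob-≉0 k 1+Nb≉0) (trans (sym eq) (zeroˡ _))
      N1≉Na : ¬ N 1# ≈ N a
      N1≉Na eq = proj₂ (*1+Nb≉0 e≈) (≈⇒+≈0 (trans (trans (sym (*-identityˡ 1#)) (*-congˡ (sym (frob-const-1 k)))) eq))
      factorisation : ∀ y → 1# * φ y + b * φ̄ y ≈ (0# * y + 1+Nb * y ᶜ) * (1# * σ y + a * σ y ᶜ)
      factorisation y = combine₂ (σ y * y) (b * (σ y ᶜ * y ᶜ)) (solve 10 (λ a ā b b̄ d d̄ y ȳ z z̄ → let open :Forms a ā b b̄ d d̄ in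
           :1 :* :B y ȳ z z̄ :+ b :* :B̄ y ȳ z z̄ :+ (:0 :* y :+ (:1 :+ b :* b̄) :* ȳ) :* (:1 :* z :+ a :* z̄)
        := z :* y :* (:C :+ :0) :+ b :* (z̄ :* ȳ) :* (:C̄ :+ :0))
        refl a _ b _ d _ y _ (σ y) _) C≈0 (C̄≈0 C≈0)
      σr≉0 = frob-≉0 ℓ 1+Nb≉0
      u-case : 1# * σ 0# ᶜ + a * σ 1+Nb ᶜ ≈ 0# → a ≈ 0#
      u-case eq = decidable-stable (a ≟ 0#) λ a≉0 → x*y≉0 a≉0 (frob-≉0 k σr≉0) (begin
        a * σ 1+Nb ᶜ  ≈⟨ solve 2 (λ x y → y := :1 :* :0 :+ y) refl 0# _ ⟩
        1# * 0# + a * σ 1+Nb ᶜ  ≈⟨ +-congʳ (*-congˡ (frob-≈0 k (frob-const-0 ℓ))) ⟨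
        1# * σ 0# ᶜ + a * σ 1+Nb ᶜ  ≈⟨ eq ⟩
        0#  ∎)
      w-case : 1# * σ 1+Nb + a * σ 0# ≈ 0# → a ≈ 0#
      w-case eq = contradiction (begin
        σ 1+Nb  ≈⟨ solve 2 (λ a x → x := :1 :* x :+ a :* :0) refl a _ ⟩
        1# * σ 1+Nb + a * 0#  ≈⟨ +-congˡ (*-congˡ (frob-const-0 ℓ)) ⟨
        1# * σ 1+Nb + a * σ 0#  ≈⟨ eq ⟩
        0#  ∎) σr≉0

    -- Now `φ + b φ̄` is a form in `y` times `σ y`. Again `w` is nonzero, and `u` vanishes only with
    -- `d`.
    H≈0⇒d≈0 : H ≈ 0# → d ≈ 0#
    H≈0⇒d≈0 H≈0 = [ u-case , w-case ]′ (zero-product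
        (resonance φ-injective 1# b p r 1# 0# (N1≉Nb r≉0) Np≉Nr N1≉N0 factorisation))
      where
      r = 1+Nb
      p = r * d
      e≈ : e ≈ r * (1# + d * d ᶜ)
      e≈ = combine₂ (a ᶜ) (b * d ᶜ) (solve 6 (λ a ā b b̄ d d̄ → let open :Forms a ā b b̄ d d̄ in
        :e :+ (:1 :+ b :* b̄) :* (:1 :+ d :* d̄) := ā :* (:H :+ :0) :+ b :* d̄ :* (:H̄ :+ :0))
        refl a _ b _ d _) H≈0 (H̄≈0 H≈0)
      r≉0 = proj₁ (*1+Nb≉0 e≈)
      Np≉Nr : ¬ N p ≈ N r
      Np≉Nr eq = x*y≉0 (x*y≉0 r≉0 (frob-≉0 k r≉0)) (proj₂ (*1+Nb≉0 e≈)) (begin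
        r * r ᶜ * (1# + d * d ᶜ)  ≈⟨ solve 4 (λ r r̄ d d̄ → r :* r̄ :* (:1 :+ d :* d̄) := r :* d :* (r̄ :* d̄) :+ r :* r̄) refl r _ d _ ⟩
        r * d * (r ᶜ * d ᶜ) + r * r ᶜ  ≈⟨ +-congʳ (*-congˡ (ᶜ-* _ _)) ⟨
        N p + N r  ≈⟨ ≈⇒+≈0 eq ⟩
        0#  ∎)
      N1≉N0 : ¬ N 1# ≈ N 0#
      N1≉N0 eq = x*y≉0 1≉0 (frob-≉0 k 1≉0) (trans eq (zeroˡ _))
      factorisation : ∀ y → 1# * φ y + b * φ̄ y ≈ (p * y + r * y ᶜ) * (1# * σ y + 0# * σ y ᶜ)
      factorisation y = combine₂ (σ y ᶜ * y ᶜ) (b * (σ y * y)) (solve 10 (λ a ā b b̄ d d̄ y ȳ z z̄ → let open :Forms a ā b b̄ d d̄ in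
           :1 :* :B y ȳ z z̄ :+ b :* :B̄ y ȳ z z̄ :+ ((:1 :+ b :* b̄) :* d :* y :+ (:1 :+ b :* b̄) :* ȳ) :* (:1 :* z :+ :0 :* z̄)
        := z̄ :* ȳ :* (:H :+ :0) :+ b :* (z :* y) :* (:H̄ :+ :0))
        refl a _ b _ d _ y _ (σ y) _) H≈0 (H̄≈0 H≈0)
      u-case : 1# * σ p ᶜ + 0# * σ r ᶜ ≈ 0# → d ≈ 0#
      u-case eq = decidable-stable (d ≟ 0#) λ d≉0 → frob-≉0 k (frob-≉0 ℓ (x*y≉0 r≉0 d≉0))
        (trans (solve 2 (λ x y → x := :1 :* x :+ :0 :* y) refl _ _) eq)
      w-case : 1# * σ r + 0# * σ p ≈ 0# → d ≈ 0#
      w-case eq = contradiction (trans (solve 2 (λ x y → x := :1 :* x :+ :0 :* y) refl _ _) eq) (frob-≉0 ℓ r≉0)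

    degenerate⇒balanced : C̄ ≈ 0# → H ≈ 0# → Balanced
    degenerate⇒balanced C̄≈0 H≈0 = trans (y≈0⇒xy≈0 (frob-≈0 ℓ C̄≈0))
      (sym (y≈0⇒xy≈0 H≈0))

    C≈0⇒balanced : C ≈ 0# → Balanced
    C≈0⇒balanced C≈0 = degenerate⇒balanced (C̄≈0 C≈0) (combine₂ 1+Nb b
      (solve 4 (λ a b b̄ d̄ → a :+ b :* d̄ :+ :0 := (:1 :+ b :* b̄) :* (a :+ :0) :+ b :* (d̄ :+ a :* b̄ :+ :0)) refl a b (b ᶜ) (d ᶜ))
      (C≈0⇒a≈0 C≈0) (C̄≈0 C≈0))

    H≈0⇒balanced : H ≈ 0# → Balanced
    H≈0⇒balanced H≈0 = degenerate⇒balanced (trans (+-cong d̄≈0 (x≈0⇒xy≈0 a≈0)) (+-identityʳ 0#)) H≈0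
      where
      d̄≈0 : d ᶜ ≈ 0#
      d̄≈0 = frob-≈0 k (H≈0⇒d≈0 H≈0)
      a≈0 : a ≈ 0#
      a≈0 = trans (sym (trans (+-congˡ (trans (*-congˡ d̄≈0) (zeroʳ b))) (+-identityʳ a))) H≈0

    module _ (C̄≉0 : ¬ C̄ ≈ 0#) (H≉0 : ¬ H ≈ 0#) where
      open Diagonal e≉0 C̄≉0 H≉0

      private
        σ-root : ∀ {x} → Root x → σ x * (σ x + σ e) ≈ σ C * σ C̄
        σ-root root = trans (*-congˡ (sym (frob-+ ℓ _ _))) (trans (sym (frob-* ℓ _ _)) (trans (frob-cong ℓ root) (frob-* ℓ _ _)))

        H̄≉0 : ¬ H̄ ≈ 0#
        H̄≉0 H̄≈0 = frob-≉0 k H≉0 (trans Hᶜ H̄≈0)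

        x+n≉0 : ∀ {x} → Root x → ¬ x + n ≈ 0# × ¬ x + n + e ≈ 0#
        x+n≉0 root = (λ eq → HH̄≉0 (x≈0⇒xy≈0 eq)) , (λ eq → HH̄≉0 (y≈0⇒xy≈0 eq))
          where
          HH̄≉0 : ¬ _ ≈ 0#
          HH̄≉0 eq = x*y≉0 H≉0 H̄≉0 (trans (sym (root-H root)) eq)

        -- The relations at `x` and at `x + e` add up to `e σ C̄ + σ e H = 0`.
        eC̄-from : ∀ {x} → H * σ x ≈ (x + n + e) * σ C̄ → H * (σ x + σ e) ≈ (x + n) * σ C̄ → Balanced
        eC̄-from {x} = combine₂ 1# 1# (solve 6 (λ e c f H s t → e :* c :+ f :* H := :1 :* (H :* s :+ (t :+ e) :* c) :+ :1 :* (H :* (s :+ f) :+ t :* c))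
          refl e (σ C̄) (σ e) H (σ x) (x + n))

        eC̄-from′ : ∀ {x} → H * σ x ≈ (x + n) * σ C̄ → H * (σ x + σ e) ≈ (x + n + e) * σ C̄ → Balanced
        eC̄-from′ {x} = combine₂ 1# 1# (solve 6 (λ e c f H s t → e :* c :+ f :* H := :1 :* (H :* s :+ t :* c) :+ :1 :* (H :* (s :+ f) :+ (t :+ e) :* c))
          refl e (σ C̄) (σ e) H (σ x) (x + n))

      module InertCase {x : Carrier} (root : Root x) (inert : Inert x) where
        private
          g = x + n + e
          g≉0 = proj₂ (x+n≉0 root)
          x≉0 = root≉0 root
          σx≉0 = frob-≉0 ℓ x≉0

          gᶜ : g ᶜ ≈ g
          gᶜ = trans (ᶜ-+ _ _) (+-cong (trans (ᶜ-+ _ _) (+-cong inert nᶜ)) eᶜ)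

          σxᶜ : σ x ᶜ ≈ σ x
          σxᶜ = trans (sym (σ-ᶜ x)) (frob-cong ℓ inert)

          σC̄ᶜ : σ C̄ ᶜ ≈ σ C
          σC̄ᶜ = trans (sym (σ-ᶜ C̄)) (frob-cong ℓ C̄ᶜ)

          ρ₁ᶜ : ρ₁ x ᶜ ≈ d * x + C
          ρ₁ᶜ = trans (ᶜ-+ _ _) (+-cong (trans (ᶜ-* _ _) (*-cong (ᶜᶜ d) inert)) C̄ᶜ)

          ρ₂ᶜ : ρ₂ x ᶜ ≈ a ᶜ * x + b ᶜ * C
          ρ₂ᶜ = trans (ᶜ-+ _ _) (+-cong (trans (ᶜ-* _ _) (*-congˡ inert)) (trans (ᶜ-* _ _) (*-congˡ C̄ᶜ)))

          Nρ≉ : ¬ N (ρ₁ x) ≈ N (ρ₂ x)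
          Nρ≉ eq = x*y≉0 (x*y≉0 e≉0 x≉0) g≉0 (begin
            e * x * g  ≈⟨ combine₁ (1# + b * b ᶜ) (solve 7 (λ x a ā b b̄ d d̄ → let open :Forms a ā b b̄ d d̄ in
                 :e :* x :* (x :+ :n :+ :e) :+ ((d̄ :* x :+ :C̄) :* (d :* x :+ :C) :+ (a :* x :+ b :* :C̄) :* (ā :* x :+ b̄ :* :C))
              := (:1 :+ b :* b̄) :* (x :* (x :+ :e) :+ :C :* :C̄)) refl x a _ b _ d _) root ⟩
            ρ₁ x * (d * x + C) + ρ₂ x * (a ᶜ * x + b ᶜ * C)  ≈⟨ +-cong (*-congˡ ρ₁ᶜ) (*-congˡ ρ₂ᶜ) ⟨
            N (ρ₁ x) + N (ρ₂ x)  ≈⟨ ≈⇒+≈0 eq ⟩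
            0#  ∎)

          Np≉ : ¬ N x ≈ N C̄
          Np≉ eq = x*y≉0 e≉0 x≉0 (begin
            e * x  ≈⟨ solve 2 (λ e x → e :* x := x :* x :+ x :* (x :+ e)) refl e x ⟩
            x * x + x * (x + e)  ≈⟨ +-cong (*-congˡ inert) (trans (*-congˡ C̄ᶜ) (trans (*-comm _ _) (sym root))) ⟨
            N x + N C̄  ≈⟨ ≈⇒+≈0 eq ⟩
            0#  ∎)

          Nα≉ : ¬ N g ≈ N H
          Nα≉ eq = x*y≉0 e≉0 g≉0 (begin
            e * g  ≈⟨ solve 2 (λ e x → e :* (x :+ e) := (x :+ e) :* (x :+ e) :+ x :* (x :+ e)) refl e (x + n) ⟩
            g * g + (x + n) * g  ≈⟨ +-cong (*-congˡ gᶜ) (trans (*-congˡ Hᶜ) (sym (root-H root))) ⟨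
            N g + N H  ≈⟨ ≈⇒+≈0 eq ⟩
            0#  ∎)

          factorisation : ∀ y → ρ₁ x * φ y + ρ₂ x * φ̄ y ≈ (x * y + C̄ * y ᶜ) * (g * σ y + H * σ y ᶜ)
          factorisation y = trans (sym (diagonal root y)) (*-cong (+-comm _ _)
            (solve 6 (λ H z̄ x e n z → H :* z̄ :+ (x :+ e :+ n) :* z := (x :+ n :+ e) :* z :+ H :* z̄) refl H (σ y ᶜ) x e n (σ y)))

          -- In the coordinate `l x`, `u = 0` makes `m (x + e)` a multiple of the twist of the
          -- conjugate factor `l (x + e)`, the opposite pairing; `w = 0` makes it a multiple of the
          -- twist of `l x`, the same pairing. Conjugation and the root equations supply the two
          -- relations whose sum is (2).
          u-case : g * σ x ᶜ + H * σ C̄ ᶜ ≈ 0# → Balanced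
          u-case u≈0 = eC̄-from′ (*-cancelˡ g g≉0 (begin
              g * (H * σ x)  ≈⟨ solve 3 (λ g h s → g :* (h :* s) := h :* (g :* s)) refl g H _ ⟩
              H * (g * σ x)  ≈⟨ *-congˡ gσx≈H̄σC̄ ⟩
              H * (H̄ * σ C̄)  ≈⟨ *-assoc _ _ _ ⟨
              H * H̄ * σ C̄  ≈⟨ *-congʳ (root-H root) ⟨
              (x + n) * g * σ C̄  ≈⟨ solve 3 (λ x g s → x :* g :* s := g :* (x :* s)) refl (x + n) g _ ⟩
              g * ((x + n) * σ C̄)  ∎))
            (*-cancelˡ (σ x) σx≉0 (begin
              σ x * (H * (σ x + σ e))  ≈⟨ combine₂ H (σ C̄) (solve 6 (λ s f H C C̄ g → s :* (H :* (s :+ f)) :+ s :* (g :* C̄)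
                                              := H :* (s :* (s :+ f) :+ C :* C̄) :+ C̄ :* (g :* s :+ H :* C)) refl (σ x) (σ e) H (σ C) (σ C̄) g) (σ-root root) gσx≈HσC ⟩
              σ x * (g * σ C̄)  ∎))
            where
            gσx≈HσC : g * σ x ≈ H * σ C
            gσx≈HσC = trans (*-congˡ (sym σxᶜ)) (trans (+≈0⇒≈ u≈0) (*-congˡ σC̄ᶜ))
            gσx≈H̄σC̄ : g * σ x ≈ H̄ * σ C̄
            gσx≈H̄σC̄ = begin
              g * σ x  ≈⟨ *-cong gᶜ σxᶜ ⟨
              g ᶜ * σ x ᶜ  ≈⟨ ᶜ-* _ _ ⟨
              (g * σ x) ᶜ  ≈⟨ ᶜ-cong gσx≈HσC ⟩
              (H * σ C) ᶜ  ≈⟨ ᶜ-* _ _ ⟩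
              H ᶜ * σ C ᶜ  ≈⟨ *-cong Hᶜ (trans (ᶜ-cong (sym σC̄ᶜ)) (ᶜᶜ _)) ⟩
              H̄ * σ C̄  ∎

          w-case : g * σ C̄ + H * σ x ≈ 0# → Balanced
          w-case w≈0 = eC̄-from Hσx≈gσC̄ (*-cancelˡ (σ x) σx≉0 (combine₂ H (σ C̄)
              (solve 6 (λ s f H C C̄ g → s :* (H :* (s :+ f)) :+ s :* (g :* C̄)
                 := H :* (s :* (s :+ f) :+ C :* C̄) :+ C̄ :* (g :* s :+ H :* C)) refl (σ x) (σ e) H (σ C) (σ C̄) (x + n)) (σ-root root)
              (*-cancelˡ g g≉0 (begin
                g * ((x + n) * σ x)  ≈⟨ solve 3 (λ g x s → g :* (x :* s) := x :* g :* s) refl g (x + n) _ ⟩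
                (x + n) * g * σ x  ≈⟨ *-congʳ (root-H root) ⟩
                H * H̄ * σ x  ≈⟨ *-assoc _ _ _ ⟩
                H * (H̄ * σ x)  ≈⟨ *-congˡ H̄σx≈gσC ⟩
                H * (g * σ C)  ≈⟨ solve 3 (λ h g c → h :* (g :* c) := g :* (h :* c)) refl H g _ ⟩
                g * (H * σ C)  ∎))))
            where
            Hσx≈gσC̄ : H * σ x ≈ g * σ C̄
            Hσx≈gσC̄ = sym (+≈0⇒≈ w≈0)
            H̄σx≈gσC : H̄ * σ x ≈ g * σ C
            H̄σx≈gσC = begin
              H̄ * σ x  ≈⟨ *-cong Hᶜ σxᶜ ⟨
              H ᶜ * σ x ᶜ  ≈⟨ ᶜ-* _ _ ⟨
              (H * σ x) ᶜ  ≈⟨ ᶜ-cong Hσx≈gσC̄ ⟩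
              (g * σ C̄) ᶜ  ≈⟨ ᶜ-* _ _ ⟩
              g ᶜ * σ C̄ ᶜ  ≈⟨ *-cong gᶜ σC̄ᶜ ⟩
              g * σ C  ∎

        inert⇒balanced : Balanced
        inert⇒balanced = [ u-case , w-case ]′ (zero-product
          (resonance φ-injective (ρ₁ x) (ρ₂ x) x C̄ g H Nρ≉ Np≉ Nα≉ factorisation))

      -- Both factors of `ψ x` have a zero, one in `y` and one in `σ y`. At either of these points
      -- `ψ x` vanishes, so the values of `φ` are proportional and injectivity identifies the
      -- points; forms with a common zero have proportional coefficients.
      matched : ∀ {x} → Root x → Split x → H * σ x ≈ (x + n + e) * σ C̄
      matched {x} root split = *-cancelˡ (σ y * z) (x*y≉0 (frob-≉0 ℓ y≉0) z≉0) (combine₃ (H * z) (H * σ C̄) (σ y * σ C̄)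
          (solve 8 (λ s s̄ z z̄ H t g c → s :* z :* (H :* t) :+ s :* z :* (g :* c)
             := H :* z :* (c :* s̄ :+ t :* s) :+ H :* c :* (s :* z̄ :+ s̄ :* z) :+ s :* c :* (g :* z :+ H :* z̄))
            refl (σ y) (σ y ᶜ) z (z ᶜ) H (σ x) g (σ C̄))
          (+≈0⇒≈ (trans (sym (σ-l x y)) (frob-≈0 ℓ l≈0))) σy∥z gz≈Hz̄)
        where
        g = x + n + e
        y = proj₁ (kernel-l root split)
        y≉0 = proj₁ (proj₂ (kernel-l root split))
        l≈0 = proj₂ (proj₂ (kernel-l root split))
        gᶜ : g ᶜ ≈ x + n
        gᶜ = trans (ᶜ-+ _ _) (trans (+-cong (trans (ᶜ-+ _ _) (+-cong split nᶜ)) eᶜ)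
          (solve 3 (λ x n e → x :+ e :+ n :+ e := x :+ n) refl x n e))
        kernel-m = hilbert90 g H (proj₂ (x+n≉0 root)) (trans (*-congˡ gᶜ) (trans (*-comm _ _) (trans (root-H root) (*-congˡ (sym Hᶜ)))))
        z = proj₁ kernel-m
        z≉0 = proj₁ (proj₂ kernel-m)
        gz≈Hz̄ = proj₂ (proj₂ kernel-m)
        y′ = proj₁ (frob-surjective ℓ z)
        σy′≈z = proj₂ (frob-surjective ℓ z)
        y′≉0 : ¬ y′ ≈ 0#
        y′≉0 y′≈0 = z≉0 (trans (sym σy′≈z) (frob-≈0 ℓ y′≈0))
        ψy≈0 : ψ x y ≈ 0#
        ψy≈0 = x≈0⇒xy≈0 l≈0
        ψy′≈0 : ψ x y′ ≈ 0#
        ψy′≈0 = y≈0⇒xy≈0 (trans (+-cong (*-congˡ (ᶜ-cong σy′≈z)) (*-cong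
            (solve 3 (λ x e n → x :+ e :+ n := x :+ n :+ e) refl x e n) σy′≈z)) (≈⇒+≈0 (sym gz≈Hz̄)))
        y∥y′ : y ∥ y′
        y∥y′ = injective y y′ y≉0 y′≉0 (cross⇒φ∥ root (trans (x≈0⇒xy≈0 ψy≈0) (sym (x≈0⇒xy≈0 ψy′≈0))))
        σy∥z : σ y * z ᶜ ≈ σ y ᶜ * z
        σy∥z = begin
          σ y * z ᶜ  ≈⟨ *-congˡ (trans (σ-ᶜ y′) (ᶜ-cong σy′≈z)) ⟨
          σ y * σ (y′ ᶜ)  ≈⟨ frob-* ℓ _ _ ⟨
          σ (y * y′ ᶜ)  ≈⟨ frob-cong ℓ y∥y′ ⟩
          σ (y ᶜ * y′)  ≈⟨ frob-* ℓ _ _ ⟩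
          σ (y ᶜ) * σ y′  ≈⟨ *-cong (σ-ᶜ y) σy′≈z ⟩
          σ y ᶜ * z  ∎

      split⇒balanced : ∀ {x} → Root x → Split x → Balanced
      split⇒balanced {x} root split = eC̄-from (matched root split) (begin
        H * (σ x + σ e)  ≈⟨ *-congˡ (frob-+ ℓ x e) ⟨
        H * σ (x + e)  ≈⟨ matched (conjugate-root root) (conjugate-split split) ⟩
        (x + e + n + e) * σ C̄  ≈⟨ *-congʳ (solve 3 (λ x n e → x :+ e :+ n :+ e := x :+ n) refl x n e) ⟩
        (x + n) * σ C̄  ∎)

    necessarily-balanced : Balanced
    necessarily-balanced = by (C̄ ≟ 0#) (H ≟ 0#)
      where
      by : Dec (C̄ ≈ 0#) → Dec (H ≈ 0#) → Balanced
      by (yes C̄≈0′) _         = C≈0⇒balanced (trans (sym C̄ᶜ) (frob-≈0 k C̄≈0′))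
      by (no _)    (yes H≈0) = H≈0⇒balanced H≈0
      by (no C̄≉0)  (no H≉0)  = [ InertCase.inert⇒balanced C̄≉0 H≉0 root , split⇒balanced C̄≉0 H≉0 root ]′ (inert⊎split root)
        where root = proj₂ (root-exists e≉0)

  -- Necessity of (3): collisions made from a root of unity.

  ζ*σζ≈1 : ζ * σ ζ ≈ 1#
  ζ*σζ≈1 = ≡.subst (λ j → ζ * frob j ζ ≈ 1#) (≡.sym ℓ≡ℓ′m) (frob-odd m′ ζ (proj₂ (proj₂ unit-exists)) ℓ′-odd)

  module _ (φ-injective : Projectively-injective) (e≉0 : ¬ e ≈ 0#) (balanced : Balanced)
           (C̄≉0 : ¬ C̄ ≈ 0#) (H≉0 : ¬ H ≈ 0#) {x : Carrier} (root : Root x) where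
    open Projectively-injective φ-injective
    open Diagonal e≉0 C̄≉0 H≉0

    same⇒ratio-injective : Same x → ∀ y y′ → ¬ y ≈ 0# → ¬ y′ ≈ 0# →
      let open Ratio x y y′ in R * σ R ≈ R′ * σ R′ → R ≈ R′
    same⇒ratio-injective same y y′ y≉0 y′≉0 eq =
      ∥⇒R≈R′ (injective y y′ y≉0 y′≉0 (cross⇒φ∥ root (same-cross⁻¹ balanced e≉0 same eq)))
      where open Ratio x y y′

    -- For odd D, `ζ` lies in μ_{q+1} and its (Q+1)-th power is 1, so X^(Q+1) identifies two points
    -- of μ_{q+1} whose ratio is `ζ`.
    inert-same⇒even : Inert x → Same x → Even D
    inert-same⇒even inert same = [ id , (λ D-odd → contradiction (ζ≈1 D-odd) ζ≉1) ]′ (even⊎odd D)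
      where
      xe≉0 : ¬ x * e ≈ 0#
      xe≉0 = x*y≉0 (root≉0 root) e≉0
      -- The adjugate of `l x`: at `y-of t` the two coordinates are multiples of `t` and of `t ᶜ`.
      y-of : Carrier → Carrier
      y-of t = x * t + C̄ * t ᶜ
      y-ofᶜ : ∀ t → y-of t ᶜ ≈ x * t ᶜ + C * t
      y-ofᶜ t = trans (ᶜ-+ _ _) (+-cong (trans (ᶜ-* _ _) (*-congʳ inert)) (trans (ᶜ-* _ _) (*-cong C̄ᶜ (ᶜᶜ t))))
      l-y-of : ∀ t → l x (y-of t) ≈ x * e * t
      l-y-of t = trans (+-congʳ (*-congˡ (y-ofᶜ t))) (combine₁ t (solve 6 (λ x e C C̄ t t̄ →
        C̄ :* (x :* t̄ :+ C :* t) :+ x :* (x :* t :+ C̄ :* t̄) :+ x :* e :* t := t :* (x :* (x :+ e) :+ C :* C̄))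
        refl x e C C̄ t (t ᶜ)) root)
      l′-y-of : ∀ t → l (x + e) (y-of t) ≈ e * C̄ * t ᶜ
      l′-y-of t = trans (+-congʳ (*-congˡ (y-ofᶜ t))) (combine₁ t (solve 6 (λ x e C C̄ t t̄ →
        C̄ :* (x :* t̄ :+ C :* t) :+ (x :+ e) :* (x :* t :+ C̄ :* t̄) :+ e :* C̄ :* t̄ := t :* (x :* (x :+ e) :+ C :* C̄))
        refl x e C C̄ t (t ᶜ)) root)
      y-of≉0 : ∀ t → ¬ t ≈ 0# → ¬ y-of t ≈ 0#
      y-of≉0 t t≉0 y≈0 = x*y≉0 xe≉0 t≉0 (trans (sym (l-y-of t)) (trans (+-cong
          (*-congˡ (frob-≈0 k y≈0)) (*-congˡ y≈0)) (solve 2 (λ c x → c :* :0 :+ x :* :0 := :0) refl C̄ x)))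
      -- Chosen so that `t / t ᶜ` is `ζ`, as Hilbert 90 suggests for an element of norm 1.
      t = 1# + ζ
      t≉0 : ¬ t ≈ 0#
      t≉0 t≈0 = ζ≉1 (sym (+≈0⇒≈ t≈0))
      κ = x * e * (e * C̄)
      κ≉0 : ¬ κ ≈ 0#
      κ≉0 = x*y≉0 xe≉0 (x*y≉0 e≉0 C̄≉0)
      module _ (D-odd : Odd D) where
        t≈ζt̄ : t ≈ ζ * t ᶜ
        t≈ζt̄ = begin
          1# + ζ  ≈⟨ +-comm _ _ ⟩
          ζ + 1#  ≈⟨ +-cong (*-identityʳ ζ) (ζ*ζᶜ≈1 D-odd) ⟨
          ζ * 1# + ζ * ζ ᶜ  ≈⟨ distribˡ _ _ _ ⟨
          ζ * (1# + ζ ᶜ)  ≈⟨ *-congˡ (trans (ᶜ-+ _ _) (+-congʳ (frob-const-1 k))) ⟨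
          ζ * t ᶜ  ∎
        open Ratio x (y-of t) (y-of 1#)
        R≈ : R ≈ κ * t
        R≈ = trans (*-cong (l-y-of t) (trans (l′-y-of 1#) (*-congˡ (frob-const-1 k))))
          (solve 4 (λ x e c t → x :* e :* t :* (e :* c :* :1) := x :* e :* (e :* c) :* t) refl x e C̄ t)
        R′≈ : R′ ≈ κ * t ᶜ
        R′≈ = trans (*-cong (l-y-of 1#) (l′-y-of t))
          (solve 4 (λ x e c t → x :* e :* :1 :* (e :* c :* t) := x :* e :* (e :* c) :* t) refl x e C̄ (t ᶜ))
        tσt : t * σ t ≈ t ᶜ * σ (t ᶜ)
        tσt = begin
          t * σ t  ≈⟨ *-cong t≈ζt̄ (trans (frob-cong ℓ t≈ζt̄) (frob-* ℓ _ _)) ⟩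
          ζ * t ᶜ * (σ ζ * σ (t ᶜ))  ≈⟨ solve 4 (λ ζ t s u → ζ :* t :* (s :* u) := ζ :* s :* (t :* u)) refl ζ _ _ _ ⟩
          ζ * σ ζ * (t ᶜ * σ (t ᶜ))  ≈⟨ trans (*-congʳ ζ*σζ≈1) (*-identityˡ _) ⟩
          t ᶜ * σ (t ᶜ)  ∎
        κt : ∀ {r} t → r ≈ κ * t → r * σ r ≈ κ * σ κ * (t * σ t)
        κt {r} t eq = trans (*-cong eq (trans (frob-cong ℓ eq) (frob-* ℓ _ _)))
          (solve 4 (λ a b s u → a :* s :* (b :* u) := a :* b :* (s :* u)) refl κ _ t _)
        R≈R′ : R ≈ R′
        R≈R′ = same⇒ratio-injective same (y-of t) (y-of 1#) (y-of≉0 t t≉0) (y-of≉0 1# 1≉0)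
          (trans (κt t R≈) (trans (*-congˡ tσt) (sym (κt (t ᶜ) R′≈))))
        ζ≈1 : ζ ≈ 1#
        ζ≈1 = *-cancelˡ (t ᶜ) (frob-≉0 k t≉0) (begin
          t ᶜ * ζ  ≈⟨ *-comm _ _ ⟩
          ζ * t ᶜ  ≈⟨ t≈ζt̄ ⟨
          t  ≈⟨ *-cancelˡ κ κ≉0 (trans (sym R≈) (trans R≈R′ R′≈)) ⟩
          t ᶜ  ≈⟨ *-identityʳ _ ⟨
          t ᶜ * 1#  ∎)

    -- At a zero of `l x` the twisted factor of `ψ (x + e)` vanishes as well, so both components of
    -- `φ` are zero there.
    split⇒¬opposite : Split x → ¬ Opposite x
    split⇒¬opposite split opposite = nonzero y y≉0 (ψ≈0⇒φ≈0 root (x≈0⇒xy≈0 l≈0)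
        (y≈0⇒xy≈0 m≈0))
      where
      y = proj₁ (kernel-l root split)
      y≉0 = proj₁ (proj₂ (kernel-l root split))
      l≈0 = proj₂ (proj₂ (kernel-l root split))
      m≈0 : m (x + e + e) (σ y) ≈ 0#
      m≈0 = trans (+-congˡ (*-congʳ (+-congʳ e-fixed-+))) (*-cancelˡ (σ e) (frob-≉0 ℓ e≉0) (begin
        σ e * m x (σ y)  ≈⟨ m-opposite balanced opposite y ⟩
        e * σ (l x y)  ≈⟨ *-congˡ (frob-≈0 ℓ l≈0) ⟩
        e * 0#  ≈⟨ zeroʳ e ⟩
        0#  ≈⟨ zeroʳ _ ⟨
        σ e * 0#  ∎))

    split⇒same : Split x → Same x
    split⇒same split = [ (λ opposite → contradiction opposite (split⇒¬opposite split)) , id ]′ (opposite⊎same balanced root)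

    -- For even D, `ζ` lies in 𝔽_q. On the line through the zeros of the two coordinates, the points
    -- `s * y₁ + y₂` have coordinate ratio inversely proportional to `s`, and X^(Q+1) does not
    -- distinguish `s = ζ` from `s = 1`.
    split⇒odd : Split x → Odd D
    split⇒odd split = [ (λ D-even → contradiction (ζ≈1 D-even) ζ≉1) , id ]′ (even⊎odd D)
      where
      kernel = kernel-l root split
      kernel′ = kernel-l (conjugate-root root) (conjugate-split split)
      y₁ = proj₁ kernel
      y₂ = proj₁ kernel′
      L = l x y₂
      L′ = l (x + e) y₁
      L≉0 : ¬ L ≈ 0#
      L≉0 L≈0 = proj₁ (proj₂ kernel′) (l≈0⇒≈0 x y₂ L≈0 (proj₂ (proj₂ kernel′)))
      L′≉0 : ¬ L′ ≈ 0#
      L′≉0 L′≈0 = proj₁ (proj₂ kernel) (l≈0⇒≈0 x y₁ (proj₂ (proj₂ kernel)) L′≈0)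
      l-linear : ∀ x s y y′ → s ᶜ ≈ s → l x (s * y + y′) ≈ s * l x y + l x y′
      l-linear x s y y′ fix = trans (+-congʳ (*-congˡ (trans (ᶜ-+ _ _) (+-congʳ (trans (ᶜ-* _ _) (*-congʳ fix))))))
        (solve 7 (λ c x s y ȳ z z̄ → c :* (s :* ȳ :+ z̄) :+ x :* (s :* y :+ z) := s :* (c :* ȳ :+ x :* y) :+ (c :* z̄ :+ x :* z))
          refl C̄ x s y _ y′ _)
      y-of : Carrier → Carrier
      y-of s = s * y₁ + y₂
      l-y-of : ∀ s → s ᶜ ≈ s → l x (y-of s) ≈ L
      l-y-of s fix = trans (l-linear x s y₁ y₂ fix) (trans (+-congʳ (trans (*-congˡ (proj₂ (proj₂ kernel))) (zeroʳ s))) (+-identityˡ L))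
      l′-y-of : ∀ s → s ᶜ ≈ s → l (x + e) (y-of s) ≈ s * L′
      l′-y-of s fix = trans (l-linear (x + e) s y₁ y₂ fix) (trans (+-congˡ (proj₂ (proj₂ kernel′))) (+-identityʳ _))
      y-of≉0 : ∀ s → s ᶜ ≈ s → ¬ y-of s ≈ 0#
      y-of≉0 s fix y≈0 = L≉0 (trans (sym (l-y-of s fix)) (trans (+-cong
          (*-congˡ (frob-≈0 k y≈0)) (*-congˡ y≈0)) (solve 2 (λ c x → c :* :0 :+ x :* :0 := :0) refl C̄ x)))
      module _ (D-even : Even D) where
        fix₁ = frob-const-1 k
        fixζ = ζᶜ≈ζ D-even
        open Ratio x (y-of ζ) (y-of 1#)
        R≈ : R ≈ L * L′
        R≈ = *-cong (l-y-of ζ fixζ) (trans (l′-y-of 1# fix₁) (*-identityˡ L′))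
        R′≈ : R′ ≈ ζ * R
        R′≈ = trans (*-cong (l-y-of 1# fix₁) (l′-y-of ζ fixζ))
          (trans (solve 3 (λ L ζ L′ → L :* (ζ :* L′) := ζ :* (L :* L′)) refl L ζ L′) (*-congˡ (sym R≈)))
        R≈R′ : R ≈ R′
        R≈R′ = same⇒ratio-injective (split⇒same split) (y-of ζ) (y-of 1#) (y-of≉0 ζ fixζ) (y-of≉0 1# fix₁) (sym (begin
          R′ * σ R′  ≈⟨ *-cong R′≈ (trans (frob-cong ℓ R′≈) (frob-* ℓ _ _)) ⟩
          ζ * R * (σ ζ * σ R)  ≈⟨ solve 4 (λ ζ t s u → ζ :* t :* (s :* u) := ζ :* s :* (t :* u)) refl ζ _ _ _ ⟩
          ζ * σ ζ * (R * σ R)  ≈⟨ trans (*-congʳ ζ*σζ≈1) (*-identityˡ _) ⟩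
          R * σ R  ∎))
        ζ≈1 : ζ ≈ 1#
        ζ≈1 = *-cancelˡ R (λ R≈0 → x*y≉0 L≉0 L′≉0 (trans (sym R≈) R≈0)) (begin
          R * ζ  ≈⟨ *-comm _ _ ⟩
          ζ * R  ≈⟨ R′≈ ⟨
          R′  ≈⟨ R≈R′ ⟨
          R  ≈⟨ *-identityʳ R ⟨
          R * 1#  ∎)

-- Consequences of the coprimality of Q - 1 and q + 1.

module Coprime {c c′} (F : Field c c′) (k : ℕ) (0<k : 0 ℕ.< k)
               (order : FieldTheory.HasOrder F ((2 ℕ.^ k) ℕ.^ 2)) (ℓ : ℕ)
               (coprime : gcd (2 ℕ.^ ℓ ∸ 1) (2 ℕ.^ k ℕ.+ 1) ≡ 1) where
  open SquareOrder F k 0<k order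
  private
    q Q : ℕ
    q = 2 ℕ.^ k
    Q = 2 ℕ.^ ℓ

    bézout : Bézout.Identity.Identity 1 (Q ∸ 1) (q ℕ.+ 1)
    bézout = coprime-Bézout (gcd≡1⇒coprime coprime)

  x^[q+1] : ∀ x → x ^ (q ℕ.+ 1) ≈ x * x ᶜ
  x^[q+1] x = trans (^-homo-* x q 1) (trans (*-comm _ _) (*-congʳ (*-identityʳ x)))

  x*x^[Q-1] : ∀ x → x * x ^ (Q ∸ 1) ≈ frob ℓ x
  x*x^[Q-1] x = reflexive (≡.cong (x ^_) (ℕ.m+[n∸m]≡n (ℕ.m^n>0 2 ℓ)))

  private
    split-identity : ∀ x i {j j′} → 1 ℕ.+ i ℕ.* j ≡ j′ → x * (x ^ j) ^ i ≈ x ^ j′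
    split-identity x i {j} eq = trans (*-congˡ (trans (^-assocʳ x j i) (reflexive (≡.cong (x ^_) (ℕ.*-comm j i)))))
      (reflexive (≡.cong (x ^_) eq))

    ^-* : ∀ x i j → x ^ (i ℕ.* j) ≈ (x ^ j) ^ i
    ^-* x i j = sym (trans (^-assocʳ x j i) (reflexive (≡.cong (x ^_) (ℕ.*-comm j i))))

  Q-1⊥q+1 : ∀ t → t * t ᶜ ≈ 1# → frob ℓ t ≈ t → t ≈ 1#
  Q-1⊥q+1 t ttᶜ≈1 σt≈t = by bézout
    where
    t≉0 : ¬ t ≈ 0#
    t≉0 t≈0 = 1≉0 (trans (sym ttᶜ≈1) (x≈0⇒xy≈0 t≈0))
    t^[q+1]≈1 : t ^ (q ℕ.+ 1) ≈ 1#
    t^[q+1]≈1 = trans (x^[q+1] t) ttᶜ≈1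
    t^[Q-1]≈1 : t ^ (Q ∸ 1) ≈ 1#
    t^[Q-1]≈1 = *-cancelˡ t t≉0 (trans (x*x^[Q-1] t) (trans σt≈t (sym (*-identityʳ t))))
    conclude : ∀ i {j} i′ {j′} → t ^ j ≈ 1# → t ^ j′ ≈ 1# → 1 ℕ.+ i ℕ.* j ≡ i′ ℕ.* j′ → t ≈ 1#
    conclude i {j} i′ {j′} one′ one″ eq = begin
      t  ≈⟨ *-identityʳ t ⟨
      t * 1#  ≈⟨ *-congˡ (trans (^-congˡ i one′) (1^n≈1 i)) ⟨
      t * (t ^ j) ^ i  ≈⟨ split-identity t i eq ⟩
      t ^ (i′ ℕ.* j′)  ≈⟨ ^-* t i′ j′ ⟩
      (t ^ j′) ^ i′  ≈⟨ trans (^-congˡ i′ one″) (1^n≈1 i′) ⟩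
      1#  ∎
    by : Bézout.Identity.Identity 1 (Q ∸ 1) (q ℕ.+ 1) → t ≈ 1#
    by (Bézout.Identity.+- x y eq) = conclude y x t^[q+1]≈1 t^[Q-1]≈1 eq
    by (Bézout.Identity.-+ x y eq) = conclude x y t^[Q-1]≈1 t^[q+1]≈1 eq

  inverse-of : ∀ x → ¬ x ≈ 0# → ∃ λ i → i * x ≈ 1# × ¬ i ≈ 0#
  inverse-of x x≉0 = let i , ix≈1 , _ = invertible x x≉0 in
    i , ix≈1 , λ i≈0 → 1≉0 (trans (sym ix≈1) (x≈0⇒xy≈0 i≈0))

  fixed-inverse : ∀ {i x} → ¬ x ≈ 0# → i * x ≈ 1# → x ᶜ ≈ x → i ᶜ ≈ i
  fixed-inverse {i} {x} x≉0 ix≈1 fix = *-cancelˡ x x≉0 (begin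
    x * i ᶜ  ≈⟨ *-comm _ _ ⟩
    i ᶜ * x  ≈⟨ *-congˡ fix ⟨
    i ᶜ * x ᶜ  ≈⟨ ᶜ-* _ _ ⟨
    (i * x) ᶜ  ≈⟨ ᶜ-cong ix≈1 ⟩
    1# ᶜ  ≈⟨ frob-const-1 k ⟩
    1#  ≈⟨ ix≈1 ⟨
    i * x  ≈⟨ *-comm _ _ ⟩
    x * i  ∎)

  ^-fixed : ∀ x i → x ᶜ ≈ x → (x ^ i) ᶜ ≈ x ^ i
  ^-fixed x i fix = trans (^-assocʳ x i q) (trans (^-* x i q) (^-congˡ i fix))

  -- Bézout writes `x` as a power of its norm, which lies in 𝔽_q, times a (Q-1)-th power. Over the
  -- natural numbers the negative coefficient may fall on either side, and the corresponding factor
  -- is inverted.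
  decompose : ∀ x → ¬ x ≈ 0# → ∃ λ s → ∃ λ y → ¬ s ≈ 0# × s ᶜ ≈ s × ¬ y ≈ 0# × x ≈ s * y ^ (Q ∸ 1)
  decompose x x≉0 = by bézout
    where
    Nx≉0 : ¬ x ^ (q ℕ.+ 1) ≈ 0#
    Nx≉0 = x^n≉0 (q ℕ.+ 1) x≉0
    Nxᶜ : (x ^ (q ℕ.+ 1)) ᶜ ≈ x ^ (q ℕ.+ 1)
    Nxᶜ = trans (ᶜ-cong (x^[q+1] x)) (trans (trans (ᶜ-* _ _) (trans (*-congˡ (ᶜᶜ x)) (*-comm _ _))) (sym (x^[q+1] x)))
    by : Bézout.Identity.Identity 1 (Q ∸ 1) (q ℕ.+ 1) → _
    by (Bézout.Identity.+- i j eq) =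
      let r , rN≈1 , r≉0 = inverse-of ((x ^ (q ℕ.+ 1)) ^ j) (x^n≉0 j Nx≉0) in
      r , x ^ i , r≉0 , fixed-inverse (x^n≉0 j Nx≉0) rN≈1 (^-fixed _ j Nxᶜ) , x^n≉0 i x≉0 , (begin
        x  ≈⟨ *-identityˡ x ⟨
        1# * x  ≈⟨ *-congʳ rN≈1 ⟨
        r * (x ^ (q ℕ.+ 1)) ^ j * x  ≈⟨ trans (*-assoc _ _ _) (*-congˡ (*-comm _ _)) ⟩
        r * (x * (x ^ (q ℕ.+ 1)) ^ j)  ≈⟨ *-congˡ (split-identity x j eq) ⟩
        r * x ^ (i ℕ.* (Q ∸ 1))  ≈⟨ *-congˡ (^-assocʳ x i (Q ∸ 1)) ⟨
        r * (x ^ i) ^ (Q ∸ 1)  ∎)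
    by (Bézout.Identity.-+ i j eq) =
      let r , rx≈1 , r≉0 = inverse-of (x ^ i) (x^n≉0 i x≉0) in
      (x ^ (q ℕ.+ 1)) ^ j , r , x^n≉0 j Nx≉0 , ^-fixed _ j Nxᶜ , r≉0 , (begin
        x  ≈⟨ *-identityʳ x ⟨
        x * 1#  ≈⟨ *-congˡ (trans (^-congˡ (Q ∸ 1) rx≈1) (1^n≈1 (Q ∸ 1))) ⟨
        x * (r * x ^ i) ^ (Q ∸ 1)  ≈⟨ *-congˡ (^-distrib-* _ _ (Q ∸ 1)) ⟩
        x * (r ^ (Q ∸ 1) * (x ^ i) ^ (Q ∸ 1))  ≈⟨ *-congˡ (*-congˡ (trans (^-assocʳ x i (Q ∸ 1)) (^-* x i (Q ∸ 1)))) ⟩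
        x * (r ^ (Q ∸ 1) * (x ^ (Q ∸ 1)) ^ i)  ≈⟨ solve 3 (λ x r y → x :* (r :* y) := x :* y :* r) refl x _ _ ⟩
        x * (x ^ (Q ∸ 1)) ^ i * r ^ (Q ∸ 1)  ≈⟨ *-congʳ (trans (split-identity x i eq) (^-* x j (q ℕ.+ 1))) ⟩
        (x ^ (q ℕ.+ 1)) ^ j * r ^ (Q ∸ 1)  ∎)

  ^-≡mod : ∀ {n} i j → i ≡ j [mod n ] → ∀ x → ¬ x ≈ 0# → x ^ n ≈ 1# → x ^ i ≈ x ^ j
  ^-≡mod {n} i j n∣i-j x x≉0 x^n≈1 = [ (λ i≤j → go i≤j (≡.subst (n ∣_) (ℕ.m≤n⇒∣m-n∣≡n∸m i≤j) n∣i-j))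
                                 , (λ j≤i → sym (go j≤i (≡.subst (n ∣_) (ℕ.m≤n⇒∣n-m∣≡n∸m j≤i) n∣i-j))) ]′ (ℕ.≤-total i j)
    where
    go : ∀ {i j} → i ℕ.≤ j → n ∣ j ∸ i → x ^ i ≈ x ^ j
    go {i} {j} i≤j (divides r eq) = begin
      x ^ i  ≈⟨ *-identityʳ _ ⟨
      x ^ i * 1#  ≈⟨ *-congˡ (trans (reflexive (≡.cong (x ^_) eq)) (trans (^-* x r n) (trans (^-congˡ r x^n≈1) (1^n≈1 r)))) ⟨
      x ^ i * x ^ (j ∸ i)  ≈⟨ ^-homo-* x i (j ∸ i) ⟨
      x ^ (i ℕ.+ (j ∸ i))  ≡⟨ ≡.cong (x ^_) (ℕ.m+[n∸m]≡n i≤j) ⟩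
      x ^ j  ∎

-- From the polynomial `f` to projective injectivity of `φ`, and back.

module Translation {c c′} (F : Field c c′) (k : ℕ) (0<k : 0 ℕ.< k)
              (order : FieldTheory.HasOrder F ((2 ℕ.^ k) ℕ.^ 2))
              (ℓ : ℕ) (coprime : gcd (2 ℕ.^ ℓ ∸ 1) (2 ℕ.^ k ℕ.+ 1) ≡ 1) (a b d : Field.Carrier F)
              (m′ D ℓ′ : ℕ) (k≡Dm : k ≡ D ℕ.* m′) (ℓ≡ℓ′m : ℓ ≡ ℓ′ ℕ.* m′) (ℓ′-odd : Odd ℓ′)
              (u v : ℕ) (u≡ : u ℕ.* (2 ℕ.^ ℓ ∸ 1) ≡ 2 ℕ.^ k [mod 2 ℕ.^ k ℕ.+ 1 ])
              (v≡ : v ℕ.* (2 ℕ.^ ℓ ∸ 1) ≡ 2 ℕ.^ ℓ [mod 2 ℕ.^ k ℕ.+ 1 ]) where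
  open Diagonalisation F k 0<k order ℓ a b d m′ D ℓ′ k≡Dm ℓ≡ℓ′m ℓ′-odd
  open Coprime F k 0<k order ℓ coprime

  private
    q Q p : ℕ
    q = 2 ℕ.^ k
    Q = 2 ℕ.^ ℓ
    p = q ∸ 1

  P : Polynomial
  P = X· (((1# , 0) ∷ (b , 1) ∷ (a , v) ∷ (d , u) ∷ []) ∘X^ p)

  f : Carrier → Carrier
  f = ⟦ P ⟧

  f-cong : ∀ {x y} → x ≈ y → f x ≈ f y
  f-cong eq = +-cong (*-congˡ (^-congˡ (suc (p ℕ.* 0)) eq)) (+-cong (*-congˡ (^-congˡ (suc (p ℕ.* 1)) eq))
    (+-cong (*-congˡ (^-congˡ (suc (p ℕ.* v)) eq)) (+-congʳ (*-congˡ (^-congˡ (suc (p ℕ.* u)) eq)))))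

  f≈ : ∀ x → f x ≈ x * (1# + b * x ^ p + a * (x ^ p) ^ v + d * (x ^ p) ^ u)
  f≈ x = begin
    f x  ≈⟨ +-cong (*-congˡ (*-congˡ (reflexive (≡.cong (x ^_) (ℕ.*-zeroʳ p)))))
                               (+-cong (*-congˡ (*-congˡ (reflexive (≡.cong (x ^_) (ℕ.*-identityʳ p)))))
                               (+-cong (*-congˡ (*-congˡ (sym (^-assocʳ x p v)))) (+-congʳ (*-congˡ (*-congˡ (sym (^-assocʳ x p u))))))) ⟩
    1# * (x * 1#) + (b * (x * x ^ p) + (a * (x * (x ^ p) ^ v) + (d * (x * (x ^ p) ^ u) + 0#)))
                           ≈⟨ solve 7 (λ x a b d w y z → :1 :* (x :* :1) :+ (b :* (x :* w) :+ (a :* (x :* y) :+ (d :* (x :* z) :+ :0)))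
                                := x :* (:1 :+ b :* w :+ a :* y :+ d :* z)) refl x a b d _ _ _ ⟩
    x * (1# + b * x ^ p + a * (x ^ p) ^ v + d * (x ^ p) ^ u) ∎

  f-0 : f 0# ≈ 0#
  f-0 = trans (f≈ 0#) (zeroˡ _)

  -- `Y = y^(q-1)` lies in μ_{q+1} and x^(q-1) = Y^(Q-1), so the congruences turn its v-th and u-th
  -- powers into Y^Q and Y^q. Since `Y` is `y ᶜ / y`, the norm of `y` clears the denominators.
  f-φ : ∀ s y → ¬ s ≈ 0# → s ᶜ ≈ s → ¬ y ≈ 0# → y * y ᶜ * f (s * y ^ (Q ∸ 1)) ≈ s * φ y
  f-φ s y s≉0 sᶜ≈s y≉0 = begin
    y * y ᶜ * f x  ≈⟨ *-congˡ (f≈ x) ⟩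
    y * y ᶜ * (x * (1# + b * x ^ p + a * (x ^ p) ^ v + d * (x ^ p) ^ u))
      ≈⟨ *-congˡ (*-congˡ (+-cong (+-cong (+-congˡ (*-congˡ x^p)) (*-congˡ (x^p^ v v≡))) (*-congˡ (x^p^ u u≡)))) ⟩
    y * y ᶜ * (s * g * (1# + b * Y ^ (Q ∸ 1) + a * Y ^ Q + d * Y ^ q))
      ≈⟨ solve 10 (λ s y ȳ g a b d A B C → y :* ȳ :* (s :* g :* (:1 :+ b :* A :+ a :* B :+ d :* C))
           := s :* ((y :* g) :* ȳ :+ b :* ((y :* g) :* (ȳ :* A)) :+ a :* ((y :* g) :* B) :* ȳ :+ d :* (y :* g) :* (ȳ :* C)))
         refl s y (y ᶜ) g a b d _ _ _ ⟩
    s * ((y * g) * y ᶜ + b * ((y * g) * (y ᶜ * Y ^ (Q ∸ 1))) + a * ((y * g) * Y ^ Q) * y ᶜ + d * (y * g) * (y ᶜ * Y ^ q))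
      ≈⟨ *-congˡ (+-cong (+-cong (+-cong (*-congʳ yg) (*-congˡ b-term)) (*-congʳ (*-congˡ a-term))) (*-cong (*-congˡ yg) d-term)) ⟩
    s * (σ y * y ᶜ + b * (σ y ᶜ * y) + a * σ y ᶜ * y ᶜ + d * σ y * y)
      ≈⟨ *-congˡ (+-congʳ (+-congʳ (+-congˡ (*-assoc _ _ _)))) ⟨
    s * φ y ∎
    where
    x g Y : Carrier
    g = y ^ (Q ∸ 1)
    x = s * g
    Y = y ^ p
    Y≉0 : ¬ Y ≈ 0#
    Y≉0 = x^n≉0 p y≉0
    yg : y * g ≈ σ y
    yg = x*x^[Q-1] y
    s^p≈1 : s ^ p ≈ 1#
    s^p≈1 = *-cancelˡ s s≉0 (trans (x*x^[q-1] s) (trans sᶜ≈s (sym (*-identityʳ s))))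
    x^p : x ^ p ≈ Y ^ (Q ∸ 1)
    x^p = trans (^-distrib-* s g p) (trans (*-congʳ s^p≈1) (trans (*-identityˡ _) (^-comm y (Q ∸ 1) p)))
    Y^[q+1]≈1 : Y ^ (q ℕ.+ 1) ≈ 1#
    Y^[q+1]≈1 = *-cancelˡ (y * y ᶜ) (x*y≉0 y≉0 (frob-≉0 k y≉0)) (begin
      y * y ᶜ * Y ^ (q ℕ.+ 1)  ≈⟨ *-congˡ (x^[q+1] Y) ⟩
      y * y ᶜ * (Y * Y ᶜ)  ≈⟨ solve 4 (λ y ȳ Y Ȳ → y :* ȳ :* (Y :* Ȳ) := y :* Y :* (ȳ :* Ȳ)) refl y _ Y _ ⟩
      y * Y * (y ᶜ * Y ᶜ)  ≈⟨ *-cong (x*x^[q-1] y) (trans (sym (ᶜ-* y Y)) (ᶜ-cong (x*x^[q-1] y))) ⟩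
      y ᶜ * y ᶜ ᶜ  ≈⟨ trans (*-congˡ (ᶜᶜ y)) (*-comm _ _) ⟩
      y * y ᶜ  ≈⟨ *-identityʳ _ ⟨
      y * y ᶜ * 1#  ∎)
    x^p^ : ∀ i {j} → i ℕ.* (Q ∸ 1) ≡ j [mod q ℕ.+ 1 ] → (x ^ p) ^ i ≈ Y ^ j
    x^p^ i {j} i≡j = begin
      (x ^ p) ^ i  ≈⟨ ^-congˡ i x^p ⟩
      (Y ^ (Q ∸ 1)) ^ i  ≈⟨ trans (^-assocʳ Y (Q ∸ 1) i) (reflexive (≡.cong (Y ^_) (ℕ.*-comm (Q ∸ 1) i))) ⟩
      Y ^ (i ℕ.* (Q ∸ 1))  ≈⟨ ^-≡mod (i ℕ.* (Q ∸ 1)) j i≡j Y Y≉0 Y^[q+1]≈1 ⟩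
      Y ^ j  ∎
    σyᶜ : σ y * σ Y ≈ σ y ᶜ
    σyᶜ = trans (sym (frob-* ℓ y Y)) (trans (frob-cong ℓ (x*x^[q-1] y)) (σ-ᶜ y))
    a-term : (y * g) * Y ^ Q ≈ σ y ᶜ
    a-term = trans (*-congʳ yg) σyᶜ
    b-term : (y * g) * (y ᶜ * Y ^ (Q ∸ 1)) ≈ σ y ᶜ * y
    b-term = begin
      (y * g) * (y ᶜ * Y ^ (Q ∸ 1))  ≈⟨ *-cong yg (*-congʳ (sym (x*x^[q-1] y))) ⟩
      σ y * (y * Y * Y ^ (Q ∸ 1))  ≈⟨ solve 4 (λ z y Y W → z :* (y :* Y :* W) := z :* (Y :* W) :* y) refl (σ y) y Y _ ⟩
      σ y * (Y * Y ^ (Q ∸ 1)) * y  ≈⟨ *-congʳ (trans (*-congˡ (x*x^[Q-1] Y)) σyᶜ) ⟩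
      σ y ᶜ * y  ∎
    d-term : y ᶜ * Y ᶜ ≈ y
    d-term = trans (sym (ᶜ-* y Y)) (trans (ᶜ-cong (x*x^[q-1] y)) (ᶜᶜ y))

  fixed-quotient : ∀ {x y} → ¬ y ≈ 0# → x ∥ y → ∃ λ s → s ᶜ ≈ s × x ≈ s * y
  fixed-quotient {x} {y} y≉0 x∥y = s , *-cancelˡ (y * y ᶜ) (x*y≉0 y≉0 (frob-≉0 k y≉0)) (begin
      y * y ᶜ * s ᶜ  ≈⟨ solve 3 (λ y ȳ s → y :* ȳ :* s := s :* ȳ :* y) refl y _ _ ⟩
      s ᶜ * y ᶜ * y  ≈⟨ *-congʳ (trans (ᶜ-cong x≈sy) (ᶜ-* s y)) ⟨
      x ᶜ * y  ≈⟨ x∥y ⟨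
      x * y ᶜ  ≈⟨ *-congʳ x≈sy ⟩
      s * y * y ᶜ  ≈⟨ solve 3 (λ y ȳ s → s :* y :* ȳ := y :* ȳ :* s) refl y _ s ⟩
      y * y ᶜ * s  ∎) , x≈sy
    where
    s = proj₁ (quotient x y y≉0)
    x≈sy = proj₂ (quotient x y y≉0)

  -- In x = s y^(Q-1), `y` is determined only up to a factor `r` in 𝔽_q, which changes `s` by
  -- r^(Q-1). Injectivity of `φ` provides `r`, and comparing the values gives `s * σ r = s′ * r`,
  -- the matching change of `s`.
  φ-injective⇒f-injective : Projectively-injective → Injective _≈_ _≈_ f
  φ-injective⇒f-injective φ-injective {x} {x′} fx≈fx′ = by (x ≟ 0#) (x′ ≟ 0#)
    where
    open Projectively-injective φ-injective
    f≉0 : ∀ {x} → ¬ x ≈ 0# → ¬ f x ≈ 0#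
    f≉0 {x} x≉0 fx≈0 =
      let s , y , s≉0 , sᶜ≈s , y≉0 , x≈ = decompose x x≉0 in
      x*y≉0 s≉0 (nonzero y y≉0) (trans (sym (f-φ s y s≉0 sᶜ≈s y≉0)) (y≈0⇒xy≈0 (trans (f-cong (sym x≈)) fx≈0)))
    by : Dec (x ≈ 0#) → Dec (x′ ≈ 0#) → x ≈ x′
    by (yes x≈0) (yes x′≈0) = trans x≈0 (sym x′≈0)
    by (yes x≈0) (no x′≉0)  = contradiction (trans (sym fx≈fx′) (trans (f-cong x≈0) f-0)) (f≉0 x′≉0)
    by (no x≉0)  (yes x′≈0) = contradiction (trans fx≈fx′ (trans (f-cong x′≈0) f-0)) (f≉0 x≉0)
    by (no x≉0)  (no x′≉0)  = compare (decompose x x≉0) (decompose x′ x′≉0)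
      where
      compare : (∃ λ s → ∃ λ y → ¬ s ≈ 0# × s ᶜ ≈ s × ¬ y ≈ 0# × x ≈ s * y ^ (Q ∸ 1)) →
                (∃ λ s → ∃ λ y → ¬ s ≈ 0# × s ᶜ ≈ s × ¬ y ≈ 0# × x′ ≈ s * y ^ (Q ∸ 1)) → x ≈ x′
      compare (s , y , s≉0 , sᶜ≈s , y≉0 , x≈) (s′ , y′ , s′≉0 , s′ᶜ≈s′ , y′≉0 , x′≈) =
        *-cancelˡ r r≉0 (begin
          r * x  ≈⟨ *-congˡ (trans x≈ (*-congˡ (trans (^-congˡ (Q ∸ 1) y≈ry′) (^-distrib-* r y′ (Q ∸ 1))))) ⟩
          r * (s * (r ^ (Q ∸ 1) * g′))  ≈⟨ solve 4 (λ r s w g → r :* (s :* (w :* g)) := s :* (r :* w) :* g) refl r s _ g′ ⟩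
          s * (r * r ^ (Q ∸ 1)) * g′  ≈⟨ *-congʳ (trans (*-congˡ (x*x^[Q-1] r)) sσr≈s′r) ⟩
          s′ * r * g′  ≈⟨ solve 3 (λ s r g → s :* r :* g := r :* (s :* g)) refl s′ r g′ ⟩
          r * (s′ * g′)  ≈⟨ *-congˡ x′≈ ⟨
          r * x′  ∎)
        where
        g′ = y′ ^ (Q ∸ 1)
        Nfx : y * y ᶜ * f x ≈ s * φ y
        Nfx = trans (*-congˡ (f-cong x≈)) (f-φ s y s≉0 sᶜ≈s y≉0)
        Nfx′ : y′ * y′ ᶜ * f x ≈ s′ * φ y′
        Nfx′ = trans (*-congˡ (trans fx≈fx′ (f-cong x′≈))) (f-φ s′ y′ s′≉0 s′ᶜ≈s′ y′≉0)
        cross : (y′ * y′ ᶜ * s) * φ y ≈ (y * y ᶜ * s′) * φ y′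
        cross = begin
          (y′ * y′ ᶜ * s) * φ y  ≈⟨ *-assoc _ _ _ ⟩
          y′ * y′ ᶜ * (s * φ y)  ≈⟨ *-congˡ Nfx ⟨
          y′ * y′ ᶜ * (y * y ᶜ * f x)  ≈⟨ solve 3 (λ a b c → a :* (b :* c) := b :* (a :* c)) refl _ _ _ ⟩
          y * y ᶜ * (y′ * y′ ᶜ * f x)  ≈⟨ *-congˡ Nfx′ ⟩
          y * y ᶜ * (s′ * φ y′)  ≈⟨ *-assoc _ _ _ ⟨
          (y * y ᶜ * s′) * φ y′  ∎
        A = y′ * y′ ᶜ * s
        A′ = y * y ᶜ * s′
        A≉0 = x*y≉0 (x*y≉0 y′≉0 (frob-≉0 k y′≉0)) s≉0
        A′≉0 = x*y≉0 (x*y≉0 y≉0 (frob-≉0 k y≉0)) s′≉0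
        Aᶜ : A ᶜ ≈ A
        Aᶜ = trans (ᶜ-* _ _) (*-cong (norm-fixed y′) sᶜ≈s)
        A′ᶜ : A′ ᶜ ≈ A′
        A′ᶜ = trans (ᶜ-* _ _) (*-cong (norm-fixed y) s′ᶜ≈s′)
        φ∥φ′ : φ y ∥ φ y′
        φ∥φ′ = *-cancelˡ (A * A′) (x*y≉0 A≉0 A′≉0) (begin
          A * A′ * (φ y * φ y′ ᶜ)  ≈⟨ solve 4 (λ a b x y → a :* b :* (x :* y) := a :* x :* (b :* y)) refl A A′ _ _ ⟩
          A * φ y * (A′ * φ y′ ᶜ)  ≈⟨ *-congˡ (trans (ᶜ-* _ _) (*-congʳ A′ᶜ)) ⟨
          A * φ y * (A′ * φ y′) ᶜ  ≈⟨ *-cong cross (ᶜ-cong (sym cross)) ⟩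
          A′ * φ y′ * (A * φ y) ᶜ  ≈⟨ *-congˡ (trans (ᶜ-* _ _) (*-congʳ Aᶜ)) ⟩
          A′ * φ y′ * (A * φ y ᶜ)  ≈⟨ solve 4 (λ a b x y → b :* y :* (a :* x) := a :* b :* (x :* y)) refl A A′ _ _ ⟩
          A * A′ * (φ y ᶜ * φ y′)  ∎)
        ratio = fixed-quotient y′≉0 (injective y y′ y≉0 y′≉0 φ∥φ′)
        r = proj₁ ratio
        rᶜ≈r = proj₁ (proj₂ ratio)
        y≈ry′ = proj₂ (proj₂ ratio)
        r≉0 : ¬ r ≈ 0#
        r≉0 r≈0 = y≉0 (trans y≈ry′ (x≈0⇒xy≈0 r≈0))
        yᶜ≈ : y ᶜ ≈ r * y′ ᶜ
        yᶜ≈ = trans (ᶜ-cong y≈ry′) (trans (ᶜ-* _ _) (*-congʳ rᶜ≈r))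
        σy≈ : σ y ≈ σ r * σ y′
        σy≈ = trans (frob-cong ℓ y≈ry′) (frob-* ℓ _ _)
        σyᶜ≈ : σ y ᶜ ≈ σ r * σ y′ ᶜ
        σyᶜ≈ = trans (sym (σ-ᶜ y)) (trans (frob-cong ℓ yᶜ≈) (trans (frob-* ℓ _ _) (*-congˡ (σ-ᶜ y′))))
        φ-scale : φ y ≈ r * σ r * φ y′
        φ-scale = trans (+-cong (+-cong (+-cong (*-cong σy≈ yᶜ≈) (*-cong (*-congˡ σyᶜ≈) y≈ry′)) (*-cong (*-congˡ σyᶜ≈) yᶜ≈)) (*-cong (*-congˡ σy≈) y≈ry′))
          (solve 9 (λ r w a b d y ȳ z z̄ →
               (w :* z) :* (r :* ȳ) :+ b :* (w :* z̄) :* (r :* y) :+ a :* (w :* z̄) :* (r :* ȳ) :+ d :* (w :* z) :* (r :* y)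
            := r :* w :* (z :* ȳ :+ b :* z̄ :* y :+ a :* z̄ :* ȳ :+ d :* z :* y)) refl r (σ r) a b d y′ _ (σ y′) _)
        sσr≈s′r : s * σ r ≈ s′ * r
        sσr≈s′r = *-cancelˡ (y′ * y′ ᶜ * r * φ y′) (x*y≉0 (x*y≉0 (x*y≉0 y′≉0 (frob-≉0 k y′≉0)) r≉0) (nonzero y′ y′≉0)) (begin
          y′ * y′ ᶜ * r * φ y′ * (s * σ r)  ≈⟨ solve 5 (λ N r f s w → N :* r :* f :* (s :* w) := N :* s :* (r :* w :* f)) refl _ r _ s _ ⟩
          y′ * y′ ᶜ * s * (r * σ r * φ y′)  ≈⟨ *-congˡ φ-scale ⟨
          A * φ y  ≈⟨ cross ⟩
          y * y ᶜ * s′ * φ y′  ≈⟨ *-congʳ (*-congʳ (*-cong y≈ry′ yᶜ≈)) ⟩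
          r * y′ * (r * y′ ᶜ) * s′ * φ y′  ≈⟨ solve 5 (λ r y ȳ s f → r :* y :* (r :* ȳ) :* s :* f := y :* ȳ :* r :* f :* (s :* r)) refl r y′ _ s′ _ ⟩
          y′ * y′ ᶜ * r * φ y′ * (s′ * r)  ∎)

  f-injective⇒φ-injective : Injective _≈_ _≈_ f → Projectively-injective
  f-injective⇒φ-injective f-injective = record { nonzero = nonzero ; injective = injective }
    where
    y^≉0 : ∀ {y} → ¬ y ≈ 0# → ¬ y ^ (Q ∸ 1) ≈ 0#
    y^≉0 = x^n≉0 (Q ∸ 1)
    N≉0 : ∀ {y} → ¬ y ≈ 0# → ¬ y * y ᶜ ≈ 0#
    N≉0 y≉0 = x*y≉0 y≉0 (frob-≉0 k y≉0)

    nonzero : ∀ y → ¬ y ≈ 0# → ¬ φ y ≈ 0#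
    nonzero y y≉0 φy≈0 = x*y≉0 1≉0 (y^≉0 y≉0) (f-injective (trans (*-cancelˡ (y * y ᶜ) (N≉0 y≉0) (begin
      y * y ᶜ * f (1# * y ^ (Q ∸ 1))  ≈⟨ f-φ 1# y 1≉0 (frob-const-1 k) y≉0 ⟩
      1# * φ y  ≈⟨ y≈0⇒xy≈0 φy≈0 ⟩
      0#  ≈⟨ zeroʳ _ ⟨
      y * y ᶜ * 0#  ∎)) (sym f-0)))

    injective : ∀ y y′ → ¬ y ≈ 0# → ¬ y′ ≈ 0# → φ y ∥ φ y′ → y ∥ y′
    -- The quotient of `y * y′ ᶜ` by its conjugate has norm 1, and `g ∥ g′` makes it fixed by `σ`;
    -- coprimality then makes it 1.
    injective y y′ y≉0 y′≉0 φ∥φ′ = trans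
        (equal-opposite-inert Q-1⊥q+1 {y * y′ ᶜ} {y′ * y ᶜ} (x*y≉0 y′≉0 (frob-≉0 k y≉0))
          (begin
            y * y′ ᶜ * (y * y′ ᶜ) ᶜ  ≈⟨ *-congˡ (ᶜ-*ᶜ _ _) ⟩
            y * y′ ᶜ * (y ᶜ * y′)  ≈⟨ solve 4 (λ y ȳ′ ȳ y′ → y :* ȳ′ :* (ȳ :* y′) := y′ :* ȳ :* (ȳ′ :* y)) refl y _ _ y′ ⟩
            y′ * y ᶜ * (y′ ᶜ * y)  ≈⟨ *-congˡ (ᶜ-*ᶜ _ _) ⟨
            y′ * y ᶜ * (y′ * y ᶜ) ᶜ  ∎)
          (begin
            y * y′ ᶜ * σ (y′ * y ᶜ)  ≈⟨ *-congˡ (trans (frob-* ℓ _ _) (*-cong (sym (x*x^[Q-1] y′)) (trans (σ-ᶜ y) (ᶜ-cong (sym (x*x^[Q-1] y)))))) ⟩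
            y * y′ ᶜ * (y′ * g′ * (y * g) ᶜ)  ≈⟨ *-congˡ (*-congˡ (ᶜ-* y g)) ⟩
            y * y′ ᶜ * (y′ * g′ * (y ᶜ * g ᶜ))  ≈⟨ combine₁ (y * y′ ᶜ * y′ * y ᶜ) (solve 8 (λ y ȳ y′ ȳ′ g ḡ g′ ḡ′ →
                 y :* ȳ′ :* (y′ :* g′ :* (ȳ :* ḡ)) :+ y′ :* ȳ :* (y :* g :* (ȳ′ :* ḡ′)) := y :* ȳ′ :* y′ :* ȳ :* (g :* ḡ′ :+ ḡ :* g′))
                 refl y _ y′ _ g _ g′ _) g∥g′ ⟩
            y′ * y ᶜ * (y * g * (y′ ᶜ * g′ ᶜ))  ≈⟨ *-congˡ (*-congˡ (ᶜ-* y′ g′)) ⟨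
            y′ * y ᶜ * (y * g * (y′ * g′) ᶜ)  ≈⟨ *-congˡ (trans (frob-* ℓ _ _) (*-cong (sym (x*x^[Q-1] y)) (trans (σ-ᶜ y′) (ᶜ-cong (sym (x*x^[Q-1] y′)))))) ⟨
            y′ * y ᶜ * σ (y * y′ ᶜ)  ∎)) (*-comm _ _)
      where
      g = y ^ (Q ∸ 1)
      g′ = y′ ^ (Q ∸ 1)
      ratio = fixed-quotient (nonzero y′ y′≉0) φ∥φ′
      r = proj₁ ratio
      rᶜ≈r = proj₁ (proj₂ ratio)
      φ≈rφ′ = proj₂ (proj₂ ratio)
      r≉0 : ¬ r ≈ 0#
      r≉0 r≈0 = nonzero y y≉0 (trans φ≈rφ′ (x≈0⇒xy≈0 r≈0))
      -- The scalars cancel the norms: `f (s * g)` is `φ y`, and `f (s′ * g′)` is `r * φ y′`.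
      s = y * y ᶜ
      s′ = y′ * y′ ᶜ * r
      s≉0 = N≉0 y≉0
      s′≉0 = x*y≉0 (N≉0 y′≉0) r≉0
      s′ᶜ : s′ ᶜ ≈ s′
      s′ᶜ = trans (ᶜ-* _ _) (*-cong (norm-fixed y′) rᶜ≈r)
      x≈x′ : s * g ≈ s′ * g′
      x≈x′ = f-injective (begin
        f (s * g)  ≈⟨ *-cancelˡ (y * y ᶜ) (N≉0 y≉0) (f-φ s y s≉0 (norm-fixed y) y≉0) ⟩
        φ y  ≈⟨ φ≈rφ′ ⟩
        r * φ y′  ≈⟨ *-cancelˡ (y′ * y′ ᶜ) (N≉0 y′≉0) (trans (f-φ s′ y′ s′≉0 s′ᶜ y′≉0) (*-assoc _ _ _)) ⟨
        f (s′ * g′)  ∎)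
      g∥g′ : g * g′ ᶜ ≈ g ᶜ * g′
      g∥g′ = *-cancelˡ (s * s′) (x*y≉0 s≉0 s′≉0) (begin
        s * s′ * (g * g′ ᶜ)  ≈⟨ solve 4 (λ a b x y → a :* b :* (x :* y) := a :* x :* (b :* y)) refl s s′ _ _ ⟩
        s * g * (s′ * g′ ᶜ)  ≈⟨ *-congˡ (trans (ᶜ-* _ _) (*-congʳ s′ᶜ)) ⟨
        s * g * (s′ * g′) ᶜ  ≈⟨ *-cong x≈x′ (ᶜ-cong (sym x≈x′)) ⟩
        s′ * g′ * (s * g) ᶜ  ≈⟨ *-congˡ (trans (ᶜ-* _ _) (*-congʳ (norm-fixed y))) ⟩
        s′ * g′ * (s * g ᶜ)  ≈⟨ solve 4 (λ a b x y → b :* y :* (a :* x) := a :* b :* (x :* y)) refl s s′ _ _ ⟩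
        s * s′ * (g ᶜ * g′)  ∎)

-- The trace in (3) evaluated on each type of root.

module Equivalence {c c′} (F : Field c c′) (k : ℕ) (0<k : 0 ℕ.< k)
              (order : FieldTheory.HasOrder F ((2 ℕ.^ k) ℕ.^ 2))
              (ℓ : ℕ) (0<ℓ : 0 ℕ.< ℓ) (coprime : gcd (2 ℕ.^ ℓ ∸ 1) (2 ℕ.^ k ℕ.+ 1) ≡ 1) (a b d : Field.Carrier F)
              (m′ D ℓ′ : ℕ) (k≡Dm : k ≡ D ℕ.* m′) (ℓ≡ℓ′m : ℓ ≡ ℓ′ ℕ.* m′) (ℓ′-odd : Odd ℓ′) where
  open Diagonalisation F k 0<k order ℓ a b d m′ D ℓ′ k≡Dm ℓ≡ℓ′m ℓ′-odd
  open Coprime F k 0<k order ℓ coprime using (Q-1⊥q+1)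

  module _ (e≉0 : ¬ e ≈ 0#) (s : Carrier) (es≈n : e * s ≈ n) (x : Carrier) where
    private
      S : Carrier
      S = proj₁ (quotient x e e≉0)
      x≈Se : x ≈ S * e
      x≈Se = proj₂ (quotient x e e≉0)
      σx≈ : σ x ≈ σ S * σ e
      σx≈ = trans (frob-cong ℓ x≈Se) (frob-* ℓ S e)
      Sᶜe : S ᶜ * e ≈ x ᶜ
      Sᶜe = trans (*-congˡ (sym eᶜ)) (trans (sym (ᶜ-* S e)) (ᶜ-cong (sym x≈Se)))
      inert-S : Inert x → S ᶜ ≈ S
      inert-S inert = *-cancelˡ e e≉0 (trans (*-comm _ _) (trans Sᶜe (trans inert (trans x≈Se (*-comm _ _)))))
      split-S : Split x → S ᶜ ≈ S + 1#
      split-S split = *-cancelˡ e e≉0 (begin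
        e * S ᶜ  ≈⟨ trans (*-comm _ _) (trans Sᶜe split) ⟩
        x + e  ≈⟨ +-congʳ x≈Se ⟩
        S * e + e  ≈⟨ solve 2 (λ s e → s :* e :+ e := e :* (s :+ :1)) refl S e ⟩
        e * (S + 1#)  ∎)
      -- Division by `e σ e` exhibits the argument of the trace in (3) as a coboundary of `σ`, which
      -- is what makes the trace computable.
      opposite-S : Opposite x → s ≈ σ S + S
      opposite-S opposite = *-cancelˡ (e * σ e) (x*y≉0 e≉0 (frob-≉0 ℓ e≉0)) (begin
        e * σ e * s  ≈⟨ solve 3 (λ e f s → e :* f :* s := f :* (e :* s)) refl e _ s ⟩
        σ e * (e * s)  ≈⟨ *-congˡ es≈n ⟩
        σ e * n  ≈⟨ solve 3 (λ f n x → f :* n := f :* (x :+ n) :+ f :* x) refl (σ e) n x ⟩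
        σ e * (x + n) + σ e * x  ≈⟨ +-cong (trans (sym opposite) (*-congˡ σx≈)) (*-congˡ x≈Se) ⟩
        e * (σ S * σ e) + σ e * (S * e)  ≈⟨ solve 4 (λ e f t s → e :* (t :* f) :+ f :* (s :* e) := e :* f :* (t :+ s)) refl e (σ e) _ S ⟩
        e * σ e * (σ S + S)  ∎)
      same-S : Same x → s ≈ σ S + S + 1#
      same-S same = *-cancelˡ (e * σ e) (x*y≉0 e≉0 (frob-≉0 ℓ e≉0)) (begin
        e * σ e * s  ≈⟨ solve 3 (λ e f s → e :* f :* s := f :* (e :* s)) refl e _ s ⟩
        σ e * (e * s)  ≈⟨ *-congˡ es≈n ⟩
        σ e * n  ≈⟨ solve 4 (λ f n x e → f :* n := f :* (x :+ n :+ e) :+ f :* x :+ f :* e) refl (σ e) n x e ⟩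
        σ e * (x + n + e) + σ e * x + σ e * e  ≈⟨ +-congʳ (+-cong (trans (sym same) (*-congˡ σx≈)) (*-congˡ x≈Se)) ⟩
        e * (σ S * σ e) + σ e * (S * e) + σ e * e  ≈⟨ solve 4 (λ e f t s → e :* (t :* f) :+ f :* (s :* e) :+ f :* e := e :* f :* (t :+ s :+ :1)) refl e (σ e) _ S ⟩
        e * σ e * (σ S + S + 1#)  ∎)

    trace-opposite-inert : Opposite x → Inert x → trace D s ≈ 0#
    trace-opposite-inert opposite inert = trans (trace-cong D (opposite-S opposite)) (trace-inert ℓ ℓ′ ℓ≡ℓ′m ℓ′-odd S (inert-S inert))

    trace-opposite-split : Opposite x → Split x → trace D s ≈ 1#
    trace-opposite-split opposite split = trans (trace-cong D (opposite-S opposite)) (trace-split ℓ ℓ′ ℓ≡ℓ′m ℓ′-odd S (split-S split))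

    -- The extra 1 in `same-S` contributes `trace D 1#`, which is D modulo 2; this is how the parity
    -- of D enters (3).
    trace-same-inert : Same x → Inert x → trace D s ≈ trace D 1#
    trace-same-inert same inert = trans (trace-cong D (same-S same)) (trans (trace-+ D _ _)
      (trans (+-congʳ (trace-inert ℓ ℓ′ ℓ≡ℓ′m ℓ′-odd S (inert-S inert))) (+-identityˡ _)))

    trace-same-split : Same x → Split x → trace D s ≈ 1# + trace D 1#
    trace-same-split same split = trans (trace-cong D (same-S same)) (trans (trace-+ D _ _)
      (+-congʳ (trace-split ℓ ℓ′ ℓ≡ℓ′m ℓ′-odd S (split-S split))))

  private
    C≈0 : C̄ ≈ 0# → C ≈ 0#
    C≈0 C̄≈0 = trans (sym C̄ᶜ) (frob-≈0 k C̄≈0)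

    trace-0 : ∀ {x} → x ≈ 0# → trace D x ≈ 0#
    trace-0 x≈0 = trans (trace-cong D (trans x≈0 (sym (+-identityʳ 0#)))) (trans (trace-+ D 0# 0#) (x+x≈0 _))

  necessary : ∀ (φ-injective : Projectively-injective) → ¬ e ≈ 0# → ∀ s → e * s ≈ n → Balanced × trace D s ≈ 0#
  necessary φ-injective e≉0 s es≈n = balanced , by (C̄ ≟ 0#)
    where
    balanced : Balanced
    balanced = Necessity.necessarily-balanced F k 0<k order ℓ 0<ℓ a b d m′ D ℓ′ k≡Dm ℓ≡ℓ′m ℓ′-odd φ-injective e≉0
    by : Dec (C̄ ≈ 0#) → trace D s ≈ 0#
    by (yes C̄≈0) = trace-0 (*-cancelˡ e e≉0 (trans es≈n (trans
      (ZeroC.n≈0 Q-1⊥q+1 e≉0 balanced (C≈0 C̄≈0)) (sym (zeroʳ e)))))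
    by (no C̄≉0) = go (inert⊎split root) (opposite⊎same balanced root)
      where
      open Necessity F k 0<k order ℓ 0<ℓ a b d m′ D ℓ′ k≡Dm ℓ≡ℓ′m ℓ′-odd using (inert-same⇒even; split⇒same; split⇒odd)
      x = proj₁ (root-exists e≉0)
      root : Root x
      root = proj₂ (root-exists e≉0)
      H≉0′ = H≉0 Q-1⊥q+1 e≉0 balanced C̄≉0
      go : Inert x ⊎ Split x → Opposite x ⊎ Same x → trace D s ≈ 0#
      go (inj₁ inert) (inj₁ opposite) = trace-opposite-inert e≉0 s es≈n x opposite inert
      go (inj₁ inert) (inj₂ same)     = trans (trace-same-inert e≉0 s es≈n x same inert)
        (trace-1-even (inert-same⇒even φ-injective e≉0 balanced C̄≉0 H≉0′ root inert same))
      go (inj₂ split) _               = trans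
        (trace-same-split e≉0 s es≈n x (split⇒same φ-injective e≉0 balanced C̄≉0 H≉0′ root split) split)
        (≈⇒+≈0 (sym (trace-1-odd (split⇒odd φ-injective e≉0 balanced C̄≉0 H≉0′ root split))))

  sufficient : ¬ e ≈ 0# → ∀ s → e * s ≈ n → Balanced → trace D s ≈ 0# → Projectively-injective
  sufficient e≉0 s es≈n balanced trace≈0 = by (C̄ ≟ 0#)
    where
    by : Dec (C̄ ≈ 0#) → Projectively-injective
    by (yes C̄≈0) = ZeroC.injective-zeroC Q-1⊥q+1 e≉0 balanced (C≈0 C̄≈0)
    by (no C̄≉0)  = NonzeroC.injective-nonzeroC Q-1⊥q+1 e≉0 balanced C̄≉0 root inert-same split-same opposite-inert
      where
      x = proj₁ (root-exists e≉0)
      root : Root x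
      root = proj₂ (root-exists e≉0)
      inert-same : Inert x → Same x → Even D
      inert-same inert same = [ id , (λ D-odd → contradiction
        (trans (sym (trace-1-odd D-odd)) (trans (sym (trace-same-inert e≉0 s es≈n x same inert)) trace≈0)) 1≉0) ]′ (even⊎odd D)
      split-same : Split x → Same x → Odd D
      split-same split same = [ (λ D-even → contradiction (begin
          1#  ≈⟨ +-identityʳ 1# ⟨
          1# + 0#  ≈⟨ +-congˡ (trace-1-even D-even) ⟨
          1# + trace D 1#  ≈⟨ trace-same-split e≉0 s es≈n x same split ⟨
          trace D s  ≈⟨ trace≈0 ⟩
          0#  ∎) 1≉0) , id ]′ (even⊎odd D)
      opposite-inert : Opposite x → Inert x
      opposite-inert opposite = [ id , (λ split → contradiction
        (trans (sym (trace-opposite-split e≉0 s es≈n x opposite split)) trace≈0) 1≉0) ]′ (inert⊎split root)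

-- Oddness of ℓ / m.

module OddPart {c c′} (F : Field c c′) (k ℓ : ℕ) (0<k : 0 ℕ.< k)
               (order : FieldTheory.HasOrder F ((2 ℕ.^ k) ℕ.^ 2))
               (coprime : gcd (2 ℕ.^ ℓ ∸ 1) (2 ℕ.^ k ℕ.+ 1) ≡ 1) where
  private
    o m : ℕ
    o = ord₂ (gcd k ℓ)
    m = 2 ℕ.^ o
    instance
      m≢0 : NonZero m
      m≢0 = m^n≢0 2 o
      gcd≢0 : NonZero (gcd k ℓ)
      gcd≢0 = ℕ.≢-nonZero (gcd[m,n]≢0 k ℓ (inj₁ (ℕ.m<n⇒n≢0 0<k)))

  D ℓ′ : ℕ
  D  = k div m
  ℓ′ = ℓ div m

  k≡Dm : k ≡ D ℕ.* m
  k≡Dm = ≡.sym (m/n*n≡m (∣-trans (proj₁ (ord₂-largest (gcd k ℓ))) (gcd[m,n]∣m k ℓ)))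

  ℓ≡ℓ′m : ℓ ≡ ℓ′ ℕ.* m
  ℓ≡ℓ′m = ≡.sym (m/n*n≡m (∣-trans (proj₁ (ord₂-largest (gcd k ℓ))) (gcd[m,n]∣n k ℓ)))

  -- As m is the 2-part of the gcd, D and ℓ′ are not both even. If ℓ′ were even and D odd, then `ζ`
  -- would have norm 1 and be fixed by `σ`, against the coprimality of Q - 1 and q + 1.
  ℓ′-odd : Odd ℓ′
  ℓ′-odd = [ (λ ℓ′-even → contradiction ℓ′-even ¬even) , id ]′ (even⊎odd ℓ′)
    where
    open SquareOrder F k 0<k order
    open Iterates F k 0<k order m D k≡Dm
    2m∣ : ∀ {n j} → n ≡ j ℕ.* m → Even j → 2 ℕ.^ suc o ∣ n
    2m∣ n≡jm (i , ≡.refl) = divides i (≡.trans n≡jm (ℕ.*-assoc i 2 m))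
    ¬even : ¬ Even ℓ′
    ¬even ℓ′-even = [ (λ D-even → ℕ.1+n≰n (proj₂ (ord₂-largest (gcd k ℓ)) (suc o) (gcd-greatest (2m∣ k≡Dm D-even) (2m∣ ℓ≡ℓ′m ℓ′-even))))
                    , (λ D-odd → ζ≉1 (Coprime.Q-1⊥q+1 F k 0<k order ℓ coprime ζ (ζ*ζᶜ≈1 D-odd)
                        (≡.subst (λ j → frob j ζ ≈ ζ) (≡.sym ℓ≡ℓ′m) (frob-even m ζ (proj₂ (proj₂ unit-exists)) ℓ′-even)))) ]′ (even⊎odd D)

corollary9p2 :
  ∀ {c c′} (F : Field c c′) (k ℓ : ℕ) → 0 ℕ.< k → 0 ℕ.< ℓ →
  let open FieldTheory F
      o = ord₂ (gcd k ℓ)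
      m = 2 ℕ.^ o
      q = 2 ℕ.^ k
      Q = 2 ℕ.^ ℓ
  in
  HasOrder (q ℕ.^ 2) →
  gcd (Q ∸ 1) (q ℕ.+ 1) ≡ 1 →
  (a b d : Carrier) (u v : ℕ) → 0 ℕ.< u → 0 ℕ.< v →
  u ℕ.* (Q ∸ 1) ≡ q [mod q ℕ.+ 1 ] →
  v ℕ.* (Q ∸ 1) ≡ Q [mod q ℕ.+ 1 ] →
  let A = (1# , 0) ∷ (b , 1) ∷ (a , v) ∷ (d , u) ∷ []
      f = X· (A ∘X^ (q ∸ 1))
      N = λ x → x ^ (q ℕ.+ 1)
      e = 1# + N a + N b + N d
  in
  Permutes f ⇔
    (Σ (¬ (e ≈ 0#)) λ e≉0 →
      ((a * b ^ q + d ^ q) ^ Q ≈ e ^ (Q ∸ 1) * (a + b * d ^ q)) ×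
      (Tr k m {{m^n≢0 2 o}} ((N a + N d) / e by e≉0) ≈ 0#))
corollary9p2 F k ℓ 0<k 0<ℓ order coprime a b d u v _ _ u≡ v≡ = mk⇔ necessity sufficiency
  where
  open OddPart F k ℓ 0<k order coprime
  m′ = 2 ℕ.^ ord₂ (gcd k ℓ)
  open Diagonalisation F k 0<k order ℓ a b d m′ D ℓ′ k≡Dm ℓ≡ℓ′m ℓ′-odd
  open Coprime F k 0<k order ℓ coprime using (x^[q+1]; x*x^[Q-1])
  open Translation F k 0<k order ℓ coprime a b d m′ D ℓ′ k≡Dm ℓ≡ℓ′m ℓ′-odd u v u≡ v≡
  open Equivalence F k 0<k order ℓ 0<ℓ coprime a b d m′ D ℓ′ k≡Dm ℓ≡ℓ′m ℓ′-odd

  N : Carrier → Carrier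
  N x = x ^ (2 ℕ.^ k ℕ.+ 1)

  e′ : Carrier
  e′ = 1# + N a + N b + N d

  e′≈e : e′ ≈ e
  e′≈e = +-cong (+-cong (+-congˡ (x^[q+1] a)) (x^[q+1] b)) (x^[q+1] d)

  module _ (e′≉0 : ¬ e′ ≈ 0#) where
    e≉0 : ¬ e ≈ 0#
    e≉0 = e′≉0 ∘ trans e′≈e

    s : Carrier
    s = divide (N a + N d) e′ e′≉0

    es≈n : e * s ≈ n
    es≈n = begin
      e * ((N a + N d) * i)  ≈⟨ solve 3 (λ e n i → e :* (n :* i) := i :* e :* n) refl e _ i ⟩
      i * e * (N a + N d)  ≈⟨ *-congʳ (*-congˡ e′≈e) ⟨
      i * e′ * (N a + N d)  ≈⟨ *-congʳ (proj₁ (proj₂ (invertible e′ e′≉0))) ⟩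
      1# * (N a + N d)  ≈⟨ *-identityˡ _ ⟩
      N a + N d  ≈⟨ +-cong (x^[q+1] a) (x^[q+1] d) ⟩
      n  ∎
      where i = proj₁ (invertible e′ e′≉0)

    Condition₂ : Set _
    Condition₂ = (a * b ^ (2 ℕ.^ k) + d ^ (2 ℕ.^ k)) ^ (2 ℕ.^ ℓ) ≈ e′ ^ (2 ℕ.^ ℓ ∸ 1) * (a + b * d ^ (2 ℕ.^ k))

    e-times : e * (e′ ^ (2 ℕ.^ ℓ ∸ 1) * H) ≈ σ e * H
    e-times = trans (sym (*-assoc _ _ _)) (*-congʳ (trans (*-congˡ (^-congˡ (2 ℕ.^ ℓ ∸ 1) e′≈e)) (x*x^[Q-1] e)))

    condition₂⇒balanced : Condition₂ → Balanced
    condition₂⇒balanced eq = trans (*-congˡ (trans (frob-cong ℓ (+-comm _ _)) eq)) e-times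

    balanced⇒condition₂ : Balanced → Condition₂
    balanced⇒condition₂ balanced = trans (frob-cong ℓ (+-comm _ _)) (*-cancelˡ e e≉0 (trans balanced (sym e-times)))

  Conditions : Set _
  Conditions = Σ (¬ e′ ≈ 0#) λ e′≉0 → Condition₂ e′≉0 × Tr k m′ {{m^n≢0 2 (ord₂ (gcd k ℓ))}} (s e′≉0) ≈ 0#

  necessity : Permutes P → Conditions
  necessity (f-injective , _) = e′≉0 , balanced⇒condition₂ e′≉0 (proj₁ conditions) , proj₂ conditions
    where
    φ-injective : Projectively-injective
    φ-injective = f-injective⇒φ-injective f-injective
    e′≉0 : ¬ e′ ≈ 0#
    e′≉0 = Nondegenerate.e≉0 F k 0<k order ℓ a b d φ-injective ∘ trans (sym e′≈e)
    conditions = necessary φ-injective (e≉0 e′≉0) (s e′≉0) (es≈n e′≉0)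

  sufficiency : Conditions → Permutes P
  sufficiency (e′≉0 , condition₂ , condition₃) = f-injective , λ y →
      let x , fx≈y = injective⇒surjective-on-field f f-injective y in
      x , λ z≈x → trans (f-cong z≈x) fx≈y
    where
    f-injective : Injective _≈_ _≈_ f
    f-injective = φ-injective⇒f-injective
      (sufficient (e≉0 e′≉0) (s e′≉0) (es≈n e′≉0) (condition₂⇒balanced e′≉0 condition₂) condition₃)
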